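{- Let $p$ be a prime, let $\zeta_p$ be a fixed primitive $p$th root of unity in an algebraic closure of $\mathbb{Q}_p$, and let $\pi=-\sum_{k=1}^{p-1}\frac{(1-\zeta_p)^k}{k}\in\mathbb{Z}_p[\zeta_p]$. (i) $\pi^{p-1}\equiv-p\pmod{p^2}$, i.e. $\pi^{p-1}/p\equiv-1\pmod p$. (ii) Let $a\in\mathbb{Z}$ and $n\in\mathbb{N}$. If $m\in\mathbb{N}$ and $m\equiv-n\pmod p$, then $$(\zeta_p^a-1)^n\equiv\sum_{j=0}^{p-2}B^{(m)}_j\frac{(a\pi)^{n+j}}{j!}\pmod{p\pi^n}.$$ Moreover, for each positive integer $b$, $$(\zeta_p^a-1)^{p^bn}\equiv(a\pi)^{p^bn}+p^bn\sum_{1<k<p-1}\frac{B_k}{k!\,k}(a\pi)^{p^bn+k}\pmod{p^{b+1}\pi^{p^bn}}.$$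
   Context: For $m\in\mathbb{N}$ the $m$th order Bernoulli numbers $B^{(m)}_k$ are defined by $\left(\frac{x}{e^x-1}\right)^m=\sum_{k\ge0}B^{(m)}_k\frac{x^k}{k!}$, and $B_k=B^{(1)}_k$. For elements $\alpha,\beta,\gamma$ ($\gamma\ne0$) of $\mathbb{Q}_p(\zeta_p)$, $\alpha\equiv\beta\pmod\gamma$ means $(\alpha-\beta)/\gamma\in\mathbb{Z}_p[\zeta_p]$. -}

module Defs where

open import Data.Nat as ℕ using (ℕ; zero; suc; NonZero; _∸_)
open import Data.Nat.DivMod using (m%n<n)
open import Data.Nat.Divisibility using (_∣_)
open import Data.Integer as ℤ using (ℤ; +_; _%ℕ_)

open import Data.Rational as ℚ using (ℚ; 0ℚ; 1ℚ; _/_)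
open import Data.Fin as Fin using (Fin; toℕ; fromℕ<)
open import Data.List using (List; []; _∷_; foldr; map; upTo)
open import Data.List.Base using (allFin)
open import Data.Product using (Σ; _×_)
open import Relation.Nullary using (¬_; yes; no)
open import Relation.Binary.PropositionalEquality using (_≡_)

sumℚ : List ℚ → ℚ
sumℚ = foldr ℚ._+_ 0ℚ

fromℕℚ : ℕ → ℚ
fromℕℚ n = + n / 1

fromℤℚ : ℤ → ℚ
fromℤℚ z = z / 1

invFact : ℕ → ℚ
invFact zero    = 1ℚ
invFact (suc n) = invFact n ℚ.* (+ 1 / suc n)

fact : ℕ → ℕ
fact zero    = 1
fact (suc n) = suc n ℕ.* fact n

IsPIntegral : ℕ → ℚ → Set
IsPIntegral p q = ¬ (p ∣ ℚ.denominatorℕ q)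

-- Bernoulli numbers, via the generating function (x/(e^x-1))^m.
-- (e^x - 1)/x = Σ x^k/(k+1)!, and b k = [x^k] x/(e^x-1) is its
-- reciprocal series:  b 0 = 1,  b n = - Σ_{k=1}^{n} b (n-k) / (k+1)!.

-- bRev n = [ b n , b (n-1) , … , b 0 ]
private
  wsum : ℕ → List ℚ → ℚ
  wsum k []       = 0ℚ
  wsum k (x ∷ xs) = x ℚ.* invFact (suc k) ℚ.+ wsum (suc k) xs

bRev : ℕ → List ℚ
bRev zero    = 1ℚ ∷ []
bRev (suc n) = ℚ.- (wsum 1 (bRev n)) ∷ bRev n

headℚ : List ℚ → ℚ
headℚ []      = 0ℚ
headℚ (x ∷ _) = x

bcoef : ℕ → ℚ
bcoef k = headℚ (bRev k)

coefPow : ℕ → ℕ → ℚ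
coefPow zero    zero    = 1ℚ
coefPow zero    (suc j) = 0ℚ
coefPow (suc m) j       = sumℚ (map (λ i → bcoef i ℚ.* coefPow m (j ∸ i)) (upTo (suc j)))

-- m-th order Bernoulli numbers B^(m)_j  ( (x/(e^x-1))^m = Σ B^(m)_j x^j / j! )
Bᵐ : ℕ → ℕ → ℚ
Bᵐ m j = fromℕℚ (fact j) ℚ.* coefPow m j

Bern : ℕ → ℚ
Bern k = Bᵐ 1 k

-- The cyclotomic field ℚ(ζ_p), modelled as the group algebra ℚ[C_p]
-- (vectors Fin p → ℚ, coefficient i being that of ζ^i) modulo the
-- constant vectors (the ideal generated by 1 + ζ + … + ζ^(p-1)).

Cyc : ℕ → Set
Cyc p = Fin p → ℚ

module _ {p : ℕ} .{{_ : NonZero p}} where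

  infix 4 _≡_[mod_]
  infixl 6 _⊕_ _⊝_
  infixl 7 _⊗_ _·_
  infixr 8 _^_

  idx : ℕ → Fin p
  idx k = fromℕ< (m%n<n k p)

  _⊕_ : Cyc p → Cyc p → Cyc p
  (x ⊕ y) i = x i ℚ.+ y i

  ⊖_ : Cyc p → Cyc p
  (⊖ x) i = ℚ.- (x i)

  _⊝_ : Cyc p → Cyc p → Cyc p
  x ⊝ y = x ⊕ (⊖ y)

  -- cyclic convolution (ζ^p = 1)
  _⊗_ : Cyc p → Cyc p → Cyc p
  (x ⊗ y) i = sumℚ (map (λ j → x j ℚ.* y (idx (toℕ i ℕ.+ (p ∸ toℕ j)))) (allFin p))

  _·_ : ℚ → Cyc p → Cyc p
  (q · x) i = q ℚ.* x i

  ι : ℚ → Cyc p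
  ι q i with toℕ i
  ... | zero  = q
  ... | suc _ = 0ℚ

  𝟙 : Cyc p
  𝟙 = ι 1ℚ

  ζ^ : ℤ → Cyc p
  ζ^ a i with toℕ i ℕ.≟ (a %ℕ p)
  ... | yes _ = 1ℚ
  ... | no _  = 0ℚ

  _^_ : Cyc p → ℕ → Cyc p
  x ^ zero  = 𝟙
  x ^ suc n = x ⊗ (x ^ n)

  Σ⊕ : List (Cyc p) → Cyc p
  Σ⊕ = foldr _⊕_ (ι 0ℚ)

  -- x represents 0 in ℚ(ζ_p): all coefficients equal
  IsZero : Cyc p → Set
  IsZero x = (i : Fin p) → x i ≡ x (idx 0)

  -- α ≡ β (mod γ): (α - β)/γ ∈ ℤ_p[ζ_p], i.e. α - β = γ δ with
  -- δ ∈ ℤ_(p)[ζ_p] = ℚ(ζ_p) ∩ ℤ_p[ζ_p]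
  _≡_[mod_] : Cyc p → Cyc p → Cyc p → Set
  α ≡ β [mod γ ] = Σ (Cyc p) (λ δ → ((i : Fin p) → IsPIntegral p (δ i)) × IsZero ((α ⊝ β) ⊝ (γ ⊗ δ)))

  ϖ : Cyc p
  ϖ = ⊖ Σ⊕ (map (λ i → (+ 1 / suc i) · ((𝟙 ⊝ ζ^ (+ 1)) ^ suc i)) (upTo (p ∸ 1)))

{-# OPTIONS --safe #-}
module Submission where

-- Work in R = ℤ_(p)[C_p]/(constants) = ℤ_(p)[ζ], put λ = 1 - ζ and let exp, log be truncated below degree p.
-- Formally exp (log (1 - X)) = 1 - X, and p ∣ λ^(p-1), so exp π ≡ ζ mod pλ; as 1 + pR consists of units, π and λ
-- are associates, and exp a · exp b = exp (a + b) gives ζ^a ≡ exp (aπ) mod pπ.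
-- (i) From ζ^p = 1 we get (exp π)^p ≡ 1 mod p²π, while a p-th power of a series has coefficients divisible by p
-- except in degrees divisible by p; this leaves pπ + π^p ≡ 0 mod p²π, and π can be cancelled.
-- (ii) With u(x) = (eˣ - 1)/x we have ζ^a - 1 = π (a u(aπ) + pV), so everything reduces to powers of u(aπ): first
-- u^p ≡ 1 mod p, and then u^p mod p² is read off from the differential equation of u, the term x/2 of log u
-- being cancelled by the degree p coefficient of u^p through (i).

open import Level using (Level; _⊔_; 0ℓ)
open import Algebra.Bundles using (CommutativeRing)
open import Relation.Binary.Bundles using (Setoid)
open import Relation.Binary.PropositionalEquality as ≡ using (_≡_)
import Relation.Binary.Reasoning.Setoid as SetoidReasoning
open import Relation.Nullary using (¬_; yes; no; contradiction)
import Algebra.Properties.Ring as RingProperties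
import Algebra.Properties.CommutativeSemiring.Binomial as Binomial
import Algebra.Properties.CommutativeSemiring.Exp as Exponentiation
import Algebra.Properties.Semiring.Mult as Multiplication
import Algebra.Properties.Semiring.Sum as Summation
import Algebra.Solver.Ring.NaturalCoefficients.Default as SemiringSolver
open import Data.Fin.Base as Fin using (Fin; toℕ; fromℕ; inject₁)
open import Data.Fin.Permutation using (Permutation; permutation)
import Data.Fin.Properties as Fin
open import Data.Integer.Base as ℤ using (ℤ; +_; -[1+_]; ∣_∣; _%ℕ_)
import Data.Integer.Divisibility.Signed as ℤ∣
import Data.Integer.DivMod as ℤ
import Data.Integer.Properties as ℤ
open import Data.Integer.Solver using () renaming (module +-*-Solver to ℤ-Solver)
open import Data.List.Base using (List; []; _∷_; map; upTo; applyUpTo; tabulate; allFin)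
open import Data.List.Properties using (map-tabulate; map-upTo)
open import Data.Nat.Base as ℕ using (ℕ; zero; suc; z≤n; s≤s; _∸_; NonZero)
open import Data.Nat.Combinatorics using (_C_; nC1≡n; nCn≡1; k>n⇒nCk≡0; nCk+nC[k+1]≡[n+1]C[k+1])
open import Data.Nat.Divisibility as ℕ∣ using (divides; divides-refl)
open import Data.Nat.DivMod using (_%_; %-distribˡ-+; [m+n]%n≡m%n; m%n%n≡m%n; m<n⇒m%n≡m; n%n≡0)
open import Data.Nat.Primality using (Prime; euclidsLemma; ¬prime[0]; ¬prime[1])
import Data.Nat.Properties as ℕ
open import Data.Nat.Solver using (module +-*-Solver)
open import Data.Product as Σ using (Σ; _,_; proj₁; proj₂; ∃)
open import Data.Rational.Base as ℚ using (ℚ; 0ℚ; 1ℚ; _/_)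
import Data.Rational.Properties as ℚ
open import Data.Rational.Solver using () renaming (module +-*-Solver to ℚ-Solver)
import Data.Rational.Unnormalised.Base as ℚᵘ
import Data.Rational.Unnormalised.Properties as ℚᵘ
open import Data.Sum.Base using (inj₁; inj₂)



-- Over ℤ_(p) only 1, ..., p - 1 have inverses at hand, so exp and log stop below degree p and u
-- below degree p - 1, and every step has to pay for its truncation. The price is a power of the
-- argument: evaluation below degree d is multiplicative up to x^d, and p divides x^(p-1). This
-- suffices modulo p and modulo pπ, but not modulo p². There the p-th power of a truncated
-- polynomial is expanded up to degree 2p, since x^(2p) does contain p². Its coefficients are
-- controlled by the binomial theorem in R[X]/(X^d), which is why the lemmas are stated for an
-- arbitrary commutative ring and used both for R and for its truncated series. The functional
-- equations of exp and log are not proved by manipulating sums: both sides solve the same equation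
-- θP = P·G with θ = X d/dX, whose solution below degree p is unique. Neither a valuation nor
-- completeness enters: inverses of 1 + pv come from linear algebra over ℤ_(p), and the only
-- non-units cancelled are 1 - ζ and its associate π. The prime 2 needs its own argument at one
-- place, since 1/2 is missing and y^p has no third factor y.

-- Divisibility and congruence in a commutative ring

module Congruence {c ℓ : Level} (R : CommutativeRing c ℓ) where
  open CommutativeRing R hiding (zero)
  open RingProperties ring using (-‿distribʳ-*)
  open Exponentiation commutativeSemiring using (_^_; ^-homo-*)
  open SemiringSolver commutativeSemiring using (solve; _:=_; _:+_; _:*_)

  infix 4 _≡_[_] _∣_

  _∣_ : Carrier → Carrier → Set (c ⊔ ℓ)
  γ ∣ x = ∃ λ δ → x ≈ γ * δ

  -- Free of subtraction, so that the solver for commutative semirings settles the algebra of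
  -- congruences.
  _≡_[_] : Carrier → Carrier → Carrier → Set (c ⊔ ℓ)
  x ≡ y [ γ ] = ∃ λ δ → x ≈ y + γ * δ

  private variable
    x y z u v γ η : Carrier

  cancel-sum : ∀ a b → a + b + - b ≈ a
  cancel-sum a b = trans (+-assoc a b (- b)) (trans (+-congˡ (-‿inverseʳ b)) (+-identityʳ a))

  ≈⇒≡ : x ≈ y → x ≡ y [ γ ]
  ≈⇒≡ {γ = γ} x≈y = 0# , trans x≈y (sym (trans (+-congˡ (zeroʳ γ)) (+-identityʳ _)))

  ≡-sym : x ≡ y [ γ ] → y ≡ x [ γ ]
  ≡-sym {x} {y} {γ} (δ , e) = - δ , (begin
    y                       ≈⟨ cancel-sum y (γ * δ) ⟨
    y + γ * δ + - (γ * δ)   ≈⟨ +-cong (sym e) (-‿distribʳ-* γ δ) ⟩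
    x + γ * - δ             ∎)
    where open SetoidReasoning setoid

  ≡-trans : x ≡ y [ γ ] → y ≡ z [ γ ] → x ≡ z [ γ ]
  ≡-trans {γ = γ} {z = z} (δ , e) (ε , e′) = ε + δ ,
    trans e (trans (+-congʳ e′)
      (solve 4 (λ z γ ε δ → z :+ γ :* ε :+ γ :* δ := z :+ γ :* (ε :+ δ)) refl z γ ε δ))

  ≡-setoid : Carrier → Setoid c (c ⊔ ℓ)
  ≡-setoid γ = record
    { Carrier = Carrier
    ; _≈_ = _≡_[ γ ]
    ; isEquivalence = record { refl = ≈⇒≡ refl ; sym = ≡-sym ; trans = ≡-trans }
    }

  ≡-+ : x ≡ y [ γ ] → u ≡ v [ γ ] → x + u ≡ y + v [ γ ]
  ≡-+ {y = y} {γ = γ} {v = v} (δ , e) (ε , e′) = δ + ε , trans (+-cong e e′)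
    (solve 5 (λ y v γ δ ε → (y :+ γ :* δ) :+ (v :+ γ :* ε) := y :+ v :+ γ :* (δ :+ ε)) refl y v γ δ ε)

  ≡-* : x ≡ y [ γ ] → u ≡ v [ γ ] → x * u ≡ y * v [ γ ]
  ≡-* {y = y} {γ = γ} {v = v} (δ , e) (ε , e′) = δ * v + y * ε + γ * (δ * ε) , trans (*-cong e e′)
    (solve 5 (λ y v γ δ ε → (y :+ γ :* δ) :* (v :+ γ :* ε)
                          := y :* v :+ γ :* (δ :* v :+ y :* ε :+ γ :* (δ :* ε))) refl y v γ δ ε)

  ≡-^ : ∀ n → x ≡ y [ γ ] → x ^ n ≡ y ^ n [ γ ]
  ≡-^ zero    _ = ≈⇒≡ refl
  ≡-^ (suc n) e = ≡-* e (≡-^ n e)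

  ≡-scale : ∀ z → x ≡ y [ γ ] → z * x ≡ z * y [ z * γ ]
  ≡-scale {y = y} {γ = γ} z (δ , e) = δ , trans (*-congˡ e)
    (trans (distribˡ z y (γ * δ)) (+-congˡ (sym (*-assoc z γ δ))))

  ≡-weaken : γ ∣ η → x ≡ y [ η ] → x ≡ y [ γ ]
  ≡-weaken {γ} (ρ , e) (δ , e′) = ρ * δ , trans e′ (+-congˡ (trans (*-congʳ e) (*-assoc γ ρ δ)))

  ∣⇒≡0 : γ ∣ x → x ≡ 0# [ γ ]
  ∣⇒≡0 (δ , e) = δ , trans e (sym (+-identityˡ _))

  ≡0⇒∣ : x ≡ 0# [ γ ] → γ ∣ x
  ≡0⇒∣ (δ , e) = δ , trans e (+-identityˡ _)

  ∣-refl : x ∣ x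
  ∣-refl {x} = 1# , sym (*-identityʳ x)

  ∣-respʳ : x ≈ y → γ ∣ x → γ ∣ y
  ∣-respʳ x≈y (δ , e) = δ , trans (sym x≈y) e

  ∣-respˡ : x ≈ y → x ∣ z → y ∣ z
  ∣-respˡ x≈y (δ , e) = δ , trans e (*-congʳ x≈y)

  ∣-+ : γ ∣ x → γ ∣ y → γ ∣ x + y
  ∣-+ {γ} (δ , e) (ε , e′) = δ + ε , trans (+-cong e e′) (sym (distribˡ γ δ ε))

  ∣-*ʳ : ∀ y → γ ∣ x → γ ∣ x * y
  ∣-*ʳ {γ} y (δ , e) = δ * y , trans (*-congʳ e) (*-assoc γ δ y)

  ∣-*ˡ : ∀ y → γ ∣ x → γ ∣ y * x
  ∣-*ˡ y d = ∣-respʳ (*-comm _ y) (∣-*ʳ y d)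

  ∣-* : x ∣ y → u ∣ v → x * u ∣ y * v
  ∣-* {x} {y} {u} (δ , e) (ε , e′) = δ * ε , trans (*-cong e e′)
    (solve 4 (λ x δ u ε → x :* δ :* (u :* ε) := x :* u :* (δ :* ε)) refl x δ u ε)

  ∣-^ : ∀ n → x ∣ y → x ^ n ∣ y ^ n
  ∣-^ zero    _ = ∣-refl
  ∣-^ (suc n) d = ∣-* d (∣-^ n d)

  ∣-trans : x ∣ y → y ∣ z → x ∣ z
  ∣-trans {x} (δ , e) (ε , e′) = δ * ε , trans e′ (trans (*-congʳ e) (*-assoc x δ ε))

  ∣-^-≤ : ∀ x {m n} → m ℕ.≤ n → x ^ m ∣ x ^ n
  ∣-^-≤ x {m} {n} m≤n = x ^ (n ∸ m) ,
    trans (reflexive (≡.cong (x ^_) (≡.sym (ℕ.m+[n∸m]≡n m≤n)))) (^-homo-* x m (n ∸ m))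

-- Power series, the ring of truncated series, and truncated evaluation

module PowerSeries {c ℓ : Level} (R : CommutativeRing c ℓ) where
  open CommutativeRing R hiding (zero)
  open Exponentiation commutativeSemiring using (_^_)
  open Multiplication semiring using (_×_; ×-comm-*)
  open SemiringSolver commutativeSemiring using (solve; _:=_; _:+_; _:*_)
  open Congruence R

  Series : Set c
  Series = ℕ → Carrier

  tl : Series → Series
  tl f j = f (suc j)

  infixl 7 _⊛_ _◂_
  infixl 6 _⊞_

  _⊞_ : Series → Series → Series
  (f ⊞ g) j = f j + g j

  _◂_ : Carrier → Series → Series
  (a ◂ f) j = a * f j

  -- The Cauchy product as f(0)·g + X·(tl f)·g, so that proofs go by recursion on the degree and
  -- need no finite sums.
  _⊛_ : Series → Series → Series
  (f ⊛ g) zero    = f 0 * g 0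
  (f ⊛ g) (suc n) = f 0 * g (suc n) + (tl f ⊛ g) n

  const : Carrier → Series
  const a zero    = a
  const a (suc _) = 0#

  X· : Series → Series
  X· f zero    = 0#
  X· f (suc j) = f j

  infix 4 _≈[_]_
  record _≈[_]_ (f : Series) (d : ℕ) (g : Series) : Set ℓ where
    constructor below
    field coeff : ∀ j → j ℕ.< d → f j ≈ g j
  open _≈[_]_ public

  ⊛-cong-≤ : ∀ {f f′ g g′} n → (∀ j → j ℕ.≤ n → f j ≈ f′ j) → (∀ j → j ℕ.≤ n → g j ≈ g′ j) →
             (f ⊛ g) n ≈ (f′ ⊛ g′) n
  ⊛-cong-≤ zero    p q = *-cong (p 0 z≤n) (q 0 z≤n)
  ⊛-cong-≤ (suc n) p q = +-cong (*-cong (p 0 z≤n) (q (suc n) ℕ.≤-refl))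
    (⊛-cong-≤ n (λ j j≤n → p (suc j) (s≤s j≤n)) (λ j j≤n → q j (ℕ.m≤n⇒m≤1+n j≤n)))

  ⊛-cong : ∀ {f f′ g g′} d → f ≈[ d ] f′ → g ≈[ d ] g′ → f ⊛ g ≈[ d ] f′ ⊛ g′
  ⊛-cong d p q = below λ n n<d →
    ⊛-cong-≤ n (λ j j≤n → coeff p j (ℕ.≤-<-trans j≤n n<d)) (λ j j≤n → coeff q j (ℕ.≤-<-trans j≤n n<d))

  ⊛-distribʳ : ∀ h f g n → ((f ⊞ g) ⊛ h) n ≈ (f ⊛ h) n + (g ⊛ h) n
  ⊛-distribʳ h f g zero    = distribʳ (h 0) (f 0) (g 0)
  ⊛-distribʳ h f g (suc n) = trans (+-congˡ (⊛-distribʳ h (tl f) (tl g) n))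
    (solve 5 (λ a b h u v → (a :+ b) :* h :+ (u :+ v) := (a :* h :+ u) :+ (b :* h :+ v)) refl
      (f 0) (g 0) (h (suc n)) ((tl f ⊛ h) n) ((tl g ⊛ h) n))

  ⊛-suc : ∀ f g n → (f ⊛ g) (suc n) ≈ (f ⊛ tl g) n + f (suc n) * g 0
  ⊛-suc f g zero    = refl
  ⊛-suc f g (suc n) = trans (+-congˡ (⊛-suc (tl f) g n)) (sym (+-assoc _ _ _))

  ⊛-comm : ∀ f g n → (f ⊛ g) n ≈ (g ⊛ f) n
  ⊛-comm f g zero    = *-comm (f 0) (g 0)
  ⊛-comm f g (suc n) = begin
    f 0 * g (suc n) + (tl f ⊛ g) n   ≈⟨ +-cong (*-comm _ _) (⊛-comm (tl f) g n) ⟩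
    g (suc n) * f 0 + (g ⊛ tl f) n   ≈⟨ +-comm _ _ ⟩
    (g ⊛ tl f) n + g (suc n) * f 0   ≈⟨ ⊛-suc g f n ⟨
    (g ⊛ f) (suc n)                  ∎
    where open SetoidReasoning setoid

  ◂-⊛ : ∀ a f g n → ((a ◂ f) ⊛ g) n ≈ a * (f ⊛ g) n
  ◂-⊛ a f g zero    = *-assoc a (f 0) (g 0)
  ◂-⊛ a f g (suc n) = trans (+-cong (*-assoc a _ _) (◂-⊛ a (tl f) g n)) (sym (distribˡ a _ _))

  ⊛-assoc : ∀ f g h n → ((f ⊛ g) ⊛ h) n ≈ (f ⊛ (g ⊛ h)) n
  ⊛-assoc f g h zero    = *-assoc _ _ _
  ⊛-assoc f g h (suc n) = begin
    f 0 * g 0 * h (suc n) + (((f 0 ◂ tl g) ⊞ (tl f ⊛ g)) ⊛ h) n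
      ≈⟨ +-congˡ (⊛-distribʳ h (f 0 ◂ tl g) (tl f ⊛ g) n) ⟩
    f 0 * g 0 * h (suc n) + (((f 0 ◂ tl g) ⊛ h) n + ((tl f ⊛ g) ⊛ h) n)
      ≈⟨ +-congˡ (+-cong (◂-⊛ (f 0) (tl g) h n) (⊛-assoc (tl f) g h n)) ⟩
    f 0 * g 0 * h (suc n) + (f 0 * (tl g ⊛ h) n + (tl f ⊛ (g ⊛ h)) n)
      ≈⟨ solve 5 (λ a b h u v → a :* b :* h :+ (a :* u :+ v) := a :* (b :* h :+ u) :+ v) refl
           (f 0) (g 0) (h (suc n)) ((tl g ⊛ h) n) ((tl f ⊛ (g ⊛ h)) n) ⟩
    f 0 * (g 0 * h (suc n) + (tl g ⊛ h) n) + (tl f ⊛ (g ⊛ h)) n ∎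
    where open SetoidReasoning setoid

  0⊛ : ∀ g n → ((λ _ → 0#) ⊛ g) n ≈ 0#
  0⊛ g zero    = zeroˡ _
  0⊛ g (suc n) = trans (+-cong (zeroˡ _) (0⊛ g n)) (+-identityˡ 0#)

  const-⊛ : ∀ a g n → (const a ⊛ g) n ≈ a * g n
  const-⊛ a g zero    = refl
  const-⊛ a g (suc n) = trans (+-congˡ (0⊛ g n)) (+-identityʳ _)

  -- Equality ignores the degrees from d on, so this is R[X]/(X^d).
  series : ℕ → CommutativeRing c ℓ
  series d = record
    { Carrier = Series
    ; _≈_ = _≈[ d ]_
    ; _+_ = _⊞_
    ; _*_ = _⊛_
    ; -_ = λ f j → - f j
    ; 0# = λ _ → 0#
    ; 1# = const 1#
    ; isCommutativeRing = record
      { isRing = record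
        { +-isAbelianGroup = record
          { isGroup = record
            { isMonoid = record
              { isSemigroup = record
                { isMagma = record
                  { isEquivalence = record
                    { refl = below λ _ _ → refl
                    ; sym = λ p → below λ j j<d → sym (coeff p j j<d)
                    ; trans = λ p q → below λ j j<d → trans (coeff p j j<d) (coeff q j j<d) }
                  ; ∙-cong = λ p q → below λ j j<d → +-cong (coeff p j j<d) (coeff q j j<d) }
                ; assoc = λ f g h → below λ j _ → +-assoc (f j) (g j) (h j) }
              ; identity = (λ f → below λ j _ → +-identityˡ (f j)) , (λ f → below λ j _ → +-identityʳ (f j)) }
            ; inverse = (λ f → below λ j _ → -‿inverseˡ (f j)) , (λ f → below λ j _ → -‿inverseʳ (f j))
            ; ⁻¹-cong = λ p → below λ j j<d → -‿cong (coeff p j j<d) }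
          ; comm = λ f g → below λ j _ → +-comm (f j) (g j) }
        ; *-cong = ⊛-cong d
        ; *-assoc = λ f g h → below λ n _ → ⊛-assoc f g h n
        ; *-identity = (λ f → below λ n _ → one-⊛ f n)
                     , (λ f → below λ n _ → trans (⊛-comm f (const 1#) n) (one-⊛ f n))
        ; distrib = (λ f g h → below λ n _ → trans (⊛-comm f (g ⊞ h) n)
                       (trans (⊛-distribʳ f g h n) (+-cong (⊛-comm g f n) (⊛-comm h f n))))
                  , (λ f g h → below λ n _ → ⊛-distribʳ f g h n) }
      ; *-comm = λ f g → below λ n _ → ⊛-comm f g n }
    }
    where
    one-⊛ : ∀ f n → (const 1# ⊛ f) n ≈ f n
    one-⊛ f n = trans (const-⊛ 1# f n) (*-identityˡ _)

  infixr 8 _^ˢ_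
  -- Powers that do not mention a truncation degree. The exponentiation of `series d` depends on d;
  -- `^ˢ≡^` allows results for each d to be read off one series.
  _^ˢ_ : Series → ℕ → Series
  f ^ˢ zero  = const 1#
  f ^ˢ suc n = f ⊛ (f ^ˢ n)

  module Ring (d : ℕ) where
    private module S = CommutativeRing (series d)
    open S public
    open Exponentiation S.commutativeSemiring public
    open Multiplication S.semiring public using (_×_)

  ^ˢ≡^ : ∀ d f n → f ^ˢ n ≡ (d Ring.^ f) n
  ^ˢ≡^ d f zero    = ≡.refl
  ^ˢ≡^ d f (suc n) = ≡.cong (f ⊛_) (^ˢ≡^ d f n)

  ×-series : ∀ d n f j → Ring._×_ d n f j ≈ n × f j
  ×-series d zero    f j = refl
  ×-series d (suc n) f j = +-congˡ (×-series d n f j)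

  X·-⊛ : ∀ f g n → (X· f ⊛ g) n ≈ X· (f ⊛ g) n
  X·-⊛ f g zero    = zeroˡ _
  X·-⊛ f g (suc n) = trans (+-congʳ (zeroˡ _)) (+-identityˡ _)

  -- The Euler operator X d/dX. Unlike d/dX it keeps the degree, so differential equations hold up
  -- to the same truncation on both sides.
  θ : Series → Series
  θ f j = j × f j

  θ-⊛ : ∀ f g n → θ (f ⊛ g) n ≈ (θ f ⊛ g) n + (f ⊛ θ g) n
  θ-⊛ f g zero    = sym (trans (+-cong (zeroˡ _) (zeroʳ _)) (+-identityˡ 0#))
  θ-⊛ f g (suc n) = begin
    suc n × (f 0 * g (suc n) + t)
      ≈⟨ distrib-× (suc n) (f 0 * g (suc n)) t ⟩
    suc n × (f 0 * g (suc n)) + (t + n × t)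
      ≈⟨ +-cong (sym (×-comm-* (suc n) (f 0) (g (suc n)))) (+-congˡ (θ-⊛ (tl f) g n)) ⟩
    f 0 * θ g (suc n) + (t + ((θ (tl f) ⊛ g) n + (tl f ⊛ θ g) n))
      ≈⟨ solve 4 (λ a t u v → a :+ (t :+ (u :+ v)) := (t :+ u) :+ (a :+ v)) refl
           (f 0 * θ g (suc n)) t ((θ (tl f) ⊛ g) n) ((tl f ⊛ θ g) n) ⟩
    t + (θ (tl f) ⊛ g) n + (f 0 * θ g (suc n) + (tl f ⊛ θ g) n)
      ≈⟨ +-congʳ (trans (sym (⊛-distribʳ g (tl f) (θ (tl f)) n))
           (sym (trans (+-congʳ (zeroˡ (g (suc n)))) (+-identityˡ _)))) ⟩
    (θ f ⊛ g) (suc n) + (f ⊛ θ g) (suc n) ∎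
    where
    open SetoidReasoning setoid
    t = (tl f ⊛ g) n
    distrib-× : ∀ m x y → m × (x + y) ≈ m × x + m × y
    distrib-× zero    x y = sym (+-identityˡ 0#)
    distrib-× (suc m) x y = trans (+-congˡ (distrib-× m x y))
      (solve 4 (λ x y u v → (x :+ y) :+ (u :+ v) := (x :+ u) :+ (y :+ v)) refl x y (m × x) (m × y))

  ev : ℕ → Series → Carrier → Carrier
  ev zero    f x = 0#
  ev (suc d) f x = f 0 + x * ev d (tl f) x

  ev-cong : ∀ d {f g} x → f ≈[ d ] g → ev d f x ≈ ev d g x
  ev-cong zero    x p = refl
  ev-cong (suc d) x p = +-cong (coeff p 0 (s≤s z≤n)) (*-congˡ (ev-cong d x (below λ j j<d → coeff p (suc j) (s≤s j<d))))

  ev-⊞ : ∀ d f g x → ev d (f ⊞ g) x ≈ ev d f x + ev d g x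
  ev-⊞ zero    f g x = sym (+-identityˡ 0#)
  ev-⊞ (suc d) f g x = trans (+-congˡ (*-congˡ (ev-⊞ d (tl f) (tl g) x)))
    (solve 5 (λ a b x u v → a :+ b :+ x :* (u :+ v) := (a :+ x :* u) :+ (b :+ x :* v)) refl
      (f 0) (g 0) x (ev d (tl f) x) (ev d (tl g) x))

  ev-◂ : ∀ d a f x → ev d (a ◂ f) x ≈ a * ev d f x
  ev-◂ zero    a f x = sym (zeroʳ a)
  ev-◂ (suc d) a f x = trans (+-congˡ (*-congˡ (ev-◂ d a (tl f) x)))
    (solve 4 (λ a f x u → a :* f :+ x :* (a :* u) := a :* (f :+ x :* u)) refl a (f 0) x (ev d (tl f) x))

  ev-0 : ∀ d x → ev d (λ _ → 0#) x ≈ 0#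
  ev-0 zero    x = refl
  ev-0 (suc d) x = trans (+-identityˡ _) (trans (*-congˡ (ev-0 d x)) (zeroʳ x))

  ev-+ : ∀ m n f x → ev (m ℕ.+ n) f x ≈ ev m f x + x ^ m * ev n (λ j → f (m ℕ.+ j)) x
  ev-+ zero    n f x = sym (trans (+-identityˡ _) (*-identityˡ _))
  ev-+ (suc m) n f x = trans (+-congˡ (*-congˡ (ev-+ m n (tl f) x)))
    (solve 5 (λ a x u m v → a :+ x :* (u :+ m :* v) := (a :+ x :* u) :+ x :* m :* v) refl
      (f 0) x (ev m (tl f) x) (x ^ m) (ev n (λ j → f (suc m ℕ.+ j)) x))

  ev-snoc : ∀ d f x → ev (suc d) f x ≈ ev d f x + f d * x ^ d
  ev-snoc zero    f x = trans (+-congˡ (zeroʳ x)) (trans (+-comm _ _) (+-congˡ (sym (*-identityʳ _))))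
  ev-snoc (suc d) f x = trans (+-congˡ (*-congˡ (ev-snoc d (tl f) x)))
    (solve 5 (λ a x u g m → a :+ x :* (u :+ g :* m) := (a :+ x :* u) :+ g :* (x :* m)) refl
      (f 0) x (ev d (tl f) x) (f (suc d)) (x ^ d))

  ev-arg-cong : ∀ d f {x y γ} → x ≡ y [ γ ] → ev d f x ≡ ev d f y [ γ ]
  ev-arg-cong zero    f p = ≈⇒≡ refl
  ev-arg-cong (suc d) f p = ≡-+ (≈⇒≡ refl) (≡-* p (ev-arg-cong d (tl f) p))

  ev-scale : ∀ d a f x → ev d f (a * x) ≈ ev d (λ j → a ^ j * f j) x
  ev-scale zero    a f x = refl
  ev-scale (suc d) a f x = +-cong (sym (*-identityˡ _))
    (trans (*-congʳ (*-comm a x)) (trans (*-assoc x a _) (*-congˡ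
      (trans (*-congˡ (ev-scale d a (tl f) x)) (trans (sym (ev-◂ d a _ x))
        (ev-cong d x (below λ j _ → sym (*-assoc a (a ^ j) _))))))))

  ∣-ev : ∀ d f x {γ} → (∀ j → j ℕ.< d → γ ∣ f j) → γ ∣ ev d f x
  ∣-ev zero    f x {γ} p = 0# , sym (zeroʳ γ)
  ∣-ev (suc d) f x p = ∣-+ (p 0 (s≤s z≤n)) (∣-*ˡ x (∣-ev d (tl f) x (λ j j<d → p (suc j) (s≤s j<d))))

  ev-≡ : ∀ d {f g} x {γ} → (∀ j → j ℕ.< d → f j ≡ g j [ γ ]) → ev d f x ≡ ev d g x [ γ ]
  ev-≡ zero    x p = ≈⇒≡ refl
  ev-≡ (suc d) x p = ≡-+ (p 0 (s≤s z≤n)) (≡-* (≈⇒≡ refl) (ev-≡ d x (λ j j<d → p (suc j) (s≤s j<d))))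

  -- What truncation loses in the product has degree at least d and therefore a factor x^d.
  ev-⊛ : ∀ d f g x → ev d f x * ev d g x ≡ ev d (f ⊛ g) x [ x ^ d ]
  ev-⊛ zero    f g x = ≈⇒≡ (zeroˡ _)
  ev-⊛ (suc d) f g x = begin
    ev (suc d) f x * ev (suc d) g x
      ≈⟨ ≈⇒≡ (trans (solve 4 (λ a x u e → (a :+ x :* u) :* e := a :* e :+ x :* (u :* e)) refl
           (f 0) x u (ev (suc d) g x)) (+-congˡ (*-congˡ (*-congˡ (ev-snoc d g x))))) ⟩
    f 0 * ev (suc d) g x + x * (u * (ev d g x + g d * x ^ d))
      -- The top term of g meets the factor x in front of the tail of f and thus lies in the
      -- multiples of x^(d+1).
      ≈⟨ (u * g d , solve 6 (λ a x u e h m → a :+ x :* (u :* (e :+ h :* m)) := a :+ x :* (u :* e) :+ x :* m :* (u :* h)) refl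
           (f 0 * ev (suc d) g x) x u (ev d g x) (g d) (x ^ d)) ⟩
    f 0 * ev (suc d) g x + x * (u * ev d g x)
      ≈⟨ ≡-+ (≈⇒≡ refl) (≡-scale x (ev-⊛ d (tl f) g x)) ⟩
    f 0 * ev (suc d) g x + x * ev d (tl f ⊛ g) x
      ≈⟨ ≈⇒≡ (trans (solve 5 (λ a g x w v → a :* (g :+ x :* w) :+ x :* v := a :* g :+ x :* (a :* w :+ v)) refl
           (f 0) (g 0) x (ev d (tl g) x) (ev d (tl f ⊛ g) x)) (+-congˡ (*-congˡ
           (trans (+-congʳ (sym (ev-◂ d (f 0) (tl g) x))) (sym (ev-⊞ d (f 0 ◂ tl g) (tl f ⊛ g) x)))))) ⟩
    ev (suc d) (f ⊛ g) x ∎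
    where
    open SetoidReasoning (≡-setoid (x ^ suc d))
    u = ev d (tl f) x

  ev-const : ∀ d .{{_ : NonZero d}} a x → ev d (const a) x ≈ a
  ev-const (suc d) a x = trans (+-congˡ (trans (*-congˡ (ev-0 d x)) (zeroʳ x))) (+-identityʳ a)

  ev-^ : ∀ d .{{_ : NonZero d}} f x n → ev d f x ^ n ≡ ev d (f ^ˢ n) x [ x ^ d ]
  ev-^ d f x zero    = ≈⇒≡ (sym (ev-const d 1# x))
  ev-^ d f x (suc n) = ≡-trans (≡-* (≈⇒≡ refl) (ev-^ d f x n)) (ev-⊛ d f (f ^ˢ n) x)

-- Binomial coefficients and p-th powers modulo p

absorption : ∀ n k → suc k ℕ.* (suc n C suc k) ≡ suc n ℕ.* (n C k)
absorption n zero = ≡.trans (ℕ.*-identityˡ _) (≡.trans (nC1≡n (suc n)) (≡.sym (ℕ.*-identityʳ (suc n))))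
absorption zero (suc k) = ≡.trans
  (≡.cong (suc (suc k) ℕ.*_) (k>n⇒nCk≡0 {1} {suc (suc k)} (s≤s (s≤s z≤n))))
  (≡.trans (ℕ.*-zeroʳ (suc (suc k))) (≡.sym (≡.trans (ℕ.*-identityˡ _) (k>n⇒nCk≡0 {0} {suc k} (s≤s z≤n)))))
absorption (suc n) (suc k) = begin
  suc (suc k) ℕ.* (suc (suc n) C suc (suc k))
    ≡⟨ ≡.cong (suc (suc k) ℕ.*_) (≡.sym (nCk+nC[k+1]≡[n+1]C[k+1] (suc n) (suc k))) ⟩
  suc (suc k) ℕ.* (a ℕ.+ b)
    ≡⟨ solve 3 (λ k a b → (con 2 :+ k) :* (a :+ b) := (con 1 :+ k) :* a :+ a :+ (con 2 :+ k) :* b) ≡.refl k a b ⟩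
  suc k ℕ.* a ℕ.+ a ℕ.+ suc (suc k) ℕ.* b
    ≡⟨ ≡.cong₂ (λ u v → u ℕ.+ a ℕ.+ v) (absorption n k) (absorption n (suc k)) ⟩
  suc n ℕ.* (n C k) ℕ.+ a ℕ.+ suc n ℕ.* (n C suc k)
    ≡⟨ solve 4 (λ n x a y → (con 1 :+ n) :* x :+ a :+ (con 1 :+ n) :* y := (con 1 :+ n) :* (x :+ y) :+ a) ≡.refl n (n C k) a (n C suc k) ⟩
  suc n ℕ.* (n C k ℕ.+ n C suc k) ℕ.+ a
    ≡⟨ ≡.cong (λ u → suc n ℕ.* u ℕ.+ a) (nCk+nC[k+1]≡[n+1]C[k+1] n k) ⟩
  suc n ℕ.* a ℕ.+ a
    ≡⟨ ℕ.+-comm _ a ⟩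
  suc (suc n) ℕ.* a ∎
  where
  open ≡.≡-Reasoning
  open +-*-Solver
  a = suc n C suc k
  b = suc n C suc (suc k)

-- By `absorption`, p divides (k + 1)·C(p, k + 1), and it cannot divide k + 1 < p.
prime∣C : ∀ {p} → Prime p → ∀ k → suc k ℕ.< p → p ℕ∣.∣ p C suc k
prime∣C {suc n} pr k k<p with euclidsLemma (suc k) (suc n C suc k) pr
                                (divides (n C k) (≡.trans (absorption n k) (ℕ.*-comm (suc n) _)))
... | inj₁ p∣k = contradiction (ℕ∣.∣⇒≤ p∣k) (ℕ.<⇒≱ k<p)
... | inj₂ p∣C = p∣C

module Naturals {c ℓ : Level} (R : CommutativeRing c ℓ) where
  open CommutativeRing R hiding (zero)
  open Multiplication semiring using (_×_; ×1-homo-*; ×-assoc-*; ×-congʳ) public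
  open Exponentiation commutativeSemiring using (_^_)
  open Congruence R

  ⟦_⟧ : ℕ → Carrier
  ⟦ n ⟧ = n × 1#

  ⟦1⟧ : ⟦ 1 ⟧ ≈ 1#
  ⟦1⟧ = +-identityʳ 1#

  ×≈⟦⟧* : ∀ n x → n × x ≈ ⟦ n ⟧ * x
  ×≈⟦⟧* n x = sym (trans (×-assoc-* n 1# x) (×-congʳ n (*-identityˡ x)))

  ⟦⟧-∣ : ∀ {m n} → m ℕ∣.∣ n → ⟦ m ⟧ ∣ ⟦ n ⟧
  ⟦⟧-∣ {m} (divides-refl q) = ⟦ q ⟧ , trans (×1-homo-* q m) (*-comm _ _)

  ⟦⟧-^ : ∀ m n → ⟦ m ℕ.^ n ⟧ ≈ ⟦ m ⟧ ^ n
  ⟦⟧-^ m zero    = ⟦1⟧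
  ⟦⟧-^ m (suc n) = trans (×1-homo-* m (m ℕ.^ n)) (*-congˡ (⟦⟧-^ m n))

module Frobenius {c ℓ : Level} (R : CommutativeRing c ℓ) {q : ℕ} (pr : Prime (suc (suc q))) where
  open CommutativeRing R hiding (zero)
  open Exponentiation commutativeSemiring
  open Summation semiring using (sum; sum-init-last)
  open SemiringSolver commutativeSemiring using (solve; _:=_; _:+_; _:*_)
  open Congruence R
  open Naturals R

  private
    p : ℕ
    p = suc (suc q)

  ∣-sum : ∀ {n γ} (t : Fin n → Carrier) → (∀ i → γ ∣ t i) → γ ∣ sum t
  ∣-sum {zero}  {γ} t d = 0# , sym (zeroʳ γ)
  ∣-sum {suc n}     t d = ∣-+ (d Fin.zero) (∣-sum (λ i → t (Fin.suc i)) (λ i → d (Fin.suc i)))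

  -- The term linear in y is kept exact because the passage from b to b + 1 in the second congruence
  -- needs it. The inner terms carry both p and y²; y^p is separate since it has no factor p of its
  -- own.
  binomial-prime : ∀ x y → ∃ λ h →
    (x + y) ^ p ≈ x ^ p + ⟦ p ⟧ * (x ^ suc q * y) + ⟦ p ⟧ * (y * y) * h + y ^ p
  binomial-prime x y = proj₁ middle , (begin
    (x + y) ^ p
      -- After the swap the binomial index counts the powers of `y`.
      ≈⟨ ^-congˡ p (+-comm x y) ⟩
    (y + x) ^ p
      ≈⟨ Binomial.theorem commutativeSemiring p y x ⟩
    t Fin.zero + (t (Fin.suc Fin.zero) + sum r)
      ≈⟨ +-cong first (+-cong second (trans (sum-init-last r) (+-cong (proj₂ middle) final))) ⟩
    x ^ p + (⟦ p ⟧ * (x ^ suc q * y) + (⟦ p ⟧ * (y * y) * proj₁ middle + y ^ p))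
      ≈⟨ solve 4 (λ a b c d → a :+ (b :+ (c :+ d)) := a :+ b :+ c :+ d) refl _ _ _ _ ⟩
    x ^ p + ⟦ p ⟧ * (x ^ suc q * y) + ⟦ p ⟧ * (y * y) * proj₁ middle + y ^ p ∎)
    where
    open SetoidReasoning setoid
    t : Fin (suc p) → Carrier
    t = Binomial.binomialTerm commutativeSemiring y x p
    r : Fin (suc q) → Carrier
    r i = t (Fin.suc (Fin.suc i))

    first : t Fin.zero ≈ x ^ p
    first = trans (+-identityʳ _) (*-identityˡ _)

    second : t (Fin.suc Fin.zero) ≈ ⟦ p ⟧ * (x ^ suc q * y)
    second = trans (reflexive (≡.cong (_× (y ^ 1 * x ^ suc q)) (nC1≡n p)))
      (trans (×≈⟦⟧* p _) (*-congˡ (trans (*-congʳ (*-identityʳ y)) (*-comm y _))))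

    divisible : ∀ i → ⟦ p ⟧ * (y * y) ∣ r (inject₁ i)
    divisible i rewrite Fin.toℕ-inject₁ i with toℕ i in eq
    ... | k = ∣-respʳ (sym (×≈⟦⟧* (p C suc (suc k)) _))
      (∣-* (⟦⟧-∣ (prime∣C pr (suc k) (s≤s (s≤s (≡.subst (ℕ._< q) eq (Fin.toℕ<n i))))))
           (y ^ k * x ^ (q ∸ k) , solve 3 (λ y u v → y :* (y :* u) :* v := y :* y :* (u :* v)) refl _ _ _))

    middle : ⟦ p ⟧ * (y * y) ∣ sum (λ i → r (inject₁ i))
    middle = ∣-sum _ divisible

    final : r (fromℕ q) ≈ y ^ p
    final rewrite Fin.toℕ-fromℕ q | nCn≡1 p | ℕ.n∸n≡0 q = trans (+-identityʳ _) (*-identityʳ _)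

  binomial-mod-p : ∀ x y → (x + y) ^ p ≡ x ^ p + y ^ p [ ⟦ p ⟧ * y ]
  binomial-mod-p x y = let (h , e) = binomial-prime x y in x ^ suc q + y * h ,
    trans e (solve 6 (λ a s z y h b → a :+ s :* (z :* y) :+ s :* (y :* y) :* h :+ b
                                   := a :+ b :+ s :* y :* (z :+ y :* h)) refl
      (x ^ p) ⟦ p ⟧ (x ^ suc q) y h (y ^ p))

  -- The mixed terms of (y + γδ)^p carry pγ; in (γδ)^p one factor supplies p and another supplies γ.
  -- Hence each p-th power gains one p in the modulus.
  ≡-frobenius : ∀ {x y γ} → ⟦ p ⟧ ∣ γ → x ≡ y [ γ ] → x ^ p ≡ y ^ p [ ⟦ p ⟧ * γ ]
  ≡-frobenius {x} {y} {γ} p∣γ (δ , e) = begin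
    x ^ p                     ≈⟨ ≈⇒≡ (^-congˡ p e) ⟩
    (y + γ * δ) ^ p           ≈⟨ ≡-weaken (δ , sym (*-assoc _ _ _)) (binomial-mod-p y (γ * δ)) ⟩
    y ^ p + (γ * δ) ^ p       ≈⟨ ≡-+ (≈⇒≡ refl) (∣⇒≡0 (∣-* p∣γδ (∣-*ʳ ((γ * δ) ^ q) (δ , refl)))) ⟩
    y ^ p + 0#                ≈⟨ ≈⇒≡ (+-identityʳ _) ⟩
    y ^ p                     ∎
    where
    open SetoidReasoning (≡-setoid (⟦ p ⟧ * γ))
    p∣γδ : ⟦ p ⟧ ∣ γ * δ
    p∣γδ = ∣-*ʳ δ p∣γ

  fermat : ∀ n → ⟦ n ⟧ ^ p ≡ ⟦ n ⟧ [ ⟦ p ⟧ ]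
  fermat zero    = ≈⇒≡ (zeroˡ _)
  fermat (suc n) = ≡-trans (≡-weaken (⟦ n ⟧ , refl) (binomial-mod-p 1# ⟦ n ⟧))
    (≡-+ (≈⇒≡ (one p)) (fermat n))
    where
    one : ∀ k → 1# ^ k ≈ 1#
    one zero    = refl
    one (suc k) = trans (*-identityˡ _) (one k)

-- Coefficients of p-th powers of series; truncated exp and log

module ExpLog {c ℓ : Level} (R : CommutativeRing c ℓ) {q : ℕ} (pr : Prime (suc (suc q))) where
  open CommutativeRing R hiding (zero)
  open RingProperties ring using (-‿distribʳ-*; -‿distribˡ-*; -‿involutive)
  open Exponentiation commutativeSemiring
  open SemiringSolver commutativeSemiring using (solve; _:=_; _:*_)
  open Congruence R
  open Naturals R
  open PowerSeries R
  open SetoidReasoning setoid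

  p : ℕ
  p = suc (suc q)

  X : Series
  X = X· (const 1#)

  θ-^ : ∀ f n j → θ (f ^ˢ suc n) j ≈ suc n × (f ^ˢ n ⊛ θ f) j
  θ-^ f zero j = begin
    θ (f ⊛ const 1#) j          ≈⟨ ×-congʳ j (trans (⊛-comm f (const 1#) j) (trans (const-⊛ 1# f j) (*-identityˡ _))) ⟩
    θ f j                       ≈⟨ trans (const-⊛ 1# (θ f) j) (*-identityˡ _) ⟨
    (const 1# ⊛ θ f) j          ≈⟨ +-identityʳ _ ⟨
    1 × (const 1# ⊛ θ f) j      ∎
  θ-^ f (suc n) j = begin
    θ (f ⊛ (f ^ˢ suc n)) j
      ≈⟨ θ-⊛ f (f ^ˢ suc n) j ⟩
    (θ f ⊛ (f ^ˢ suc n)) j + (f ⊛ θ (f ^ˢ suc n)) j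
      ≈⟨ +-cong (⊛-comm (θ f) (f ^ˢ suc n) j)
           (⊛-cong-≤ j (λ _ _ → refl)
             (λ i _ → trans (θ-^ f n i) (sym (×-series (suc j) (suc n) (f ^ˢ n ⊛ θ f) i)))) ⟩
    (f ^ˢ suc n ⊛ θ f) j + (f ⊛ (suc n S.× (f ^ˢ n ⊛ θ f))) j
      ≈⟨ +-congˡ (trans (coeff (Multiplication.×-comm-* S.semiring (suc n) f (f ^ˢ n ⊛ θ f)) j ℕ.≤-refl)
           (×-series (suc j) (suc n) (f ⊛ (f ^ˢ n ⊛ θ f)) j)) ⟩
    (f ^ˢ suc n ⊛ θ f) j + suc n × (f ⊛ (f ^ˢ n ⊛ θ f)) j
      ≈⟨ +-congˡ (×-congʳ (suc n) (⊛-assoc f (f ^ˢ n) (θ f) j)) ⟨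
    suc (suc n) × (f ^ˢ suc n ⊛ θ f) j ∎
    where module S = Ring (suc j)

  const-^ : ∀ a n j → (const a ^ˢ n) j ≈ const (a ^ n) j
  const-^ a zero    j       = refl
  const-^ a (suc n) zero    = *-congˡ (const-^ a n 0)
  const-^ a (suc n) (suc j) = trans (const-⊛ a (const a ^ˢ n) (suc j)) (trans (*-congˡ (const-^ a n (suc j))) (zeroʳ a))

  X⊛ : ∀ g j → (X ⊛ g) j ≈ X· g j
  X⊛ g zero    = zeroˡ _
  X⊛ g (suc j) = trans (X·-⊛ (const 1#) g (suc j)) (trans (const-⊛ 1# g j) (*-identityˡ _))

  X^-⊛-below : ∀ n g j → j ℕ.< n → (X ^ˢ n ⊛ g) j ≈ 0#
  X^-⊛-below (suc n) g zero    _         = trans (*-congʳ (zeroˡ _)) (zeroˡ _)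
  X^-⊛-below (suc n) g (suc j) (s≤s j<n) = trans (⊛-assoc X (X ^ˢ n) g (suc j))
    (trans (X⊛ (X ^ˢ n ⊛ g) (suc j)) (X^-⊛-below n g j j<n))

  X^-⊛-+ : ∀ n g i → (X ^ˢ n ⊛ g) (n ℕ.+ i) ≈ g i
  X^-⊛-+ zero    g i = trans (const-⊛ 1# g i) (*-identityˡ _)
  X^-⊛-+ (suc n) g i = trans (⊛-assoc X (X ^ˢ n) g (suc n ℕ.+ i))
    (trans (X⊛ (X ^ˢ n ⊛ g) (suc n ℕ.+ i)) (X^-⊛-+ n g i))

  head-tail : ∀ f j → f j ≈ const (f 0) j + (X ⊛ tl f) j
  head-tail f zero    = sym (trans (+-congˡ (zeroˡ _)) (+-identityʳ _))
  head-tail f (suc j) = sym (trans (+-identityˡ _) (X⊛ (tl f) (suc j)))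

  private
    -- The binomial theorem modulo p, in the ring of truncated series, for the decomposition f =
    -- f(0) + X·tl f.
    ^p-split-ring : ∀ d f → ∃ λ δ → Ring._≈_ d (Ring._^_ d f p)
      ((Ring._^_ d (const (f 0)) p ⊞ (Ring._^_ d X p ⊛ Ring._^_ d (tl f) p)) ⊞ Ring._×_ d p δ)
    ^p-split-ring d f = (X ⊛ tl f) ⊛ proj₁ split , S.trans (S.^-congˡ p (below λ i _ → head-tail f i))
      (S.trans (proj₂ split) (S.+-cong (S.+-congˡ (S.^-distrib-* X (tl f) p))
        (S.trans (S.*-assoc _ _ _) (S.sym (N.×≈⟦⟧* p _)))))
      where
      module S = Ring d
      module N = Naturals (series d)
      split = Frobenius.binomial-mod-p (series d) pr (const (f 0)) (X ⊛ tl f)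

    ^p-split : ∀ f j → (f ^ˢ p) j ≡ const (f 0 ^ p) j + (X ^ˢ p ⊛ (tl f ^ˢ p)) j [ ⟦ p ⟧ ]
    ^p-split f j = proj₁ split j , (begin
      (f ^ˢ p) j
        ≡⟨ ≡.cong (λ s → s j) (^ˢ≡^ (suc j) f p) ⟩
      (Ring._^_ (suc j) f p) j
        ≈⟨ coeff (proj₂ split) j ℕ.≤-refl ⟩
      Ring._^_ (suc j) (const (f 0)) p j + (Ring._^_ (suc j) X p ⊛ Ring._^_ (suc j) (tl f) p) j + Ring._×_ (suc j) p (proj₁ split) j
        ≡⟨ ≡.cong₂ (λ s t → s j + t j + Ring._×_ (suc j) p (proj₁ split) j) (^ˢ≡^ (suc j) (const (f 0)) p)
             (≡.cong₂ _⊛_ (^ˢ≡^ (suc j) X p) (^ˢ≡^ (suc j) (tl f) p)) ⟨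
      (const (f 0) ^ˢ p) j + (X ^ˢ p ⊛ (tl f ^ˢ p)) j + Ring._×_ (suc j) p (proj₁ split) j
        ≈⟨ +-cong (+-congʳ (const-^ (f 0) p j)) (trans (×-series (suc j) p (proj₁ split) j) (×≈⟦⟧* p _)) ⟩
      const (f 0 ^ p) j + (X ^ˢ p ⊛ (tl f ^ˢ p)) j + ⟦ p ⟧ * proj₁ split j ∎)
      -- Truncation at degree j + 1 is just enough to see the coefficient of degree j.
      where split = ^p-split-ring (suc j) f

  ^ˢ-0 : ∀ f n → (f ^ˢ n) 0 ≈ f 0 ^ n
  ^ˢ-0 f zero    = refl
  ^ˢ-0 f (suc n) = *-congˡ (^ˢ-0 f n)

  ^p-coeff : ∀ f j → suc j ℕ.< p → ⟦ p ⟧ ∣ (f ^ˢ p) (suc j)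
  ^p-coeff f j j<p = ≡0⇒∣ (≡-trans (^p-split f (suc j))
    (≈⇒≡ (trans (+-identityˡ _) (X^-⊛-below p (tl f ^ˢ p) (suc j) j<p))))

  private
    -- Splitting off X^p moves the question p degrees down, so knowledge of p-th powers below degree
    -- p extends to degrees below 2p.
    ^p-shift : ∀ f i → (f ^ˢ p) (p ℕ.+ i) ≡ (tl f ^ˢ p) i [ ⟦ p ⟧ ]
    ^p-shift f i = ≡-trans (^p-split f (p ℕ.+ i))
      (≈⇒≡ (trans (+-identityˡ _) (X^-⊛-+ p (tl f ^ˢ p) i)))

  ^p-coeff-p : ∀ f → (f ^ˢ p) (p ℕ.+ 0) ≡ f 1 ^ p [ ⟦ p ⟧ ]
  ^p-coeff-p f = ≡-trans (^p-shift f 0) (≈⇒≡ (^ˢ-0 (tl f) p))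

  ^p-coeff-p+ : ∀ f j → suc j ℕ.< p → ⟦ p ⟧ ∣ (f ^ˢ p) (p ℕ.+ suc j)
  ^p-coeff-p+ f j j<p = ≡0⇒∣ (≡-trans (^p-shift f (suc j)) (∣⇒≡0 (^p-coeff (tl f) j j<p)))

  module Inverses (inv : ℕ → Carrier) (inv-eq : ∀ k → suc k ℕ.< p → ⟦ suc k ⟧ * inv k ≈ 1#) where

    invfact : Series
    invfact zero    = 1#
    invfact (suc k) = invfact k * inv k

    ×-cancel : ∀ k {x y γ} → suc k ℕ.< p → suc k × x ≡ suc k × y [ γ ] → x ≡ y [ γ ]
    ×-cancel k k<p e = ≡-trans (≈⇒≡ (undo _)) (≡-trans (≡-* (≈⇒≡ (refl {inv k})) e) (≈⇒≡ (sym (undo _))))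
      where
      undo : ∀ x → x ≈ inv k * (suc k × x)
      undo x = sym (begin
        inv k * (suc k × x)         ≈⟨ *-congˡ (×≈⟦⟧* (suc k) x) ⟩
        inv k * (⟦ suc k ⟧ * x)     ≈⟨ *-assoc _ _ _ ⟨
        inv k * ⟦ suc k ⟧ * x       ≈⟨ *-congʳ (trans (*-comm _ _) (inv-eq k k<p)) ⟩
        1# * x                      ≈⟨ *-identityˡ x ⟩
        x                           ∎)

    ×-cancel-≈ : ∀ k {x y} → suc k ℕ.< p → suc k × x ≈ suc k × y → x ≈ y
    ×-cancel-≈ k k<p e with ×-cancel k {γ = 0#} k<p (≈⇒≡ e)
    ... | δ , e′ = trans e′ (trans (+-congˡ (zeroˡ δ)) (+-identityʳ _))

    -- As G(0) = 0, degree j + 1 of θP = P·G expresses (j + 1)·P(j + 1) through the coefficients of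
    -- P up to j. The bound d ≤ p makes j + 1 invertible, so P(0) determines the rest.
    ode-unique : ∀ d (P Q G : Series) → d ℕ.≤ p → G 0 ≈ 0# → P 0 ≈ Q 0 →
                 θ P ≈[ d ] P ⊛ G → θ Q ≈[ d ] Q ⊛ G → P ≈[ d ] Q
    ode-unique d P Q G d≤p G0 P0 θP θQ = below λ j → upto j j ℕ.≤-refl
      where
      upto : ∀ n j → j ℕ.≤ n → j ℕ.< d → P j ≈ Q j
      upto n       zero    _         _   = P0
      upto (suc n) (suc j) (s≤s j≤n) j<d = ×-cancel-≈ j (ℕ.<-≤-trans j<d d≤p) (begin
        suc j × P (suc j)                 ≈⟨ coeff θP (suc j) j<d ⟩
        (P ⊛ G) (suc j)                   ≈⟨ drop P ⟩
        (P ⊛ tl G) j                      ≈⟨ ⊛-cong-≤ j (λ i i≤j → upto n i (ℕ.≤-trans i≤j j≤n)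
                                               (ℕ.≤-<-trans i≤j (ℕ.<-trans (ℕ.n<1+n j) j<d))) (λ _ _ → refl) ⟩
        (Q ⊛ tl G) j                      ≈⟨ drop Q ⟨
        (Q ⊛ G) (suc j)                   ≈⟨ coeff θQ (suc j) j<d ⟨
        suc j × Q (suc j)                 ∎)
        where
        drop : ∀ F → (F ⊛ G) (suc j) ≈ (F ⊛ tl G) j
        drop F = trans (⊛-suc F G j) (trans (+-congˡ (trans (*-congˡ G0) (zeroʳ _))) (+-identityʳ _))

    exp : Carrier → Series
    exp a j = a ^ j * invfact j

    invfact-suc : ∀ j → suc j ℕ.< p → suc j × invfact (suc j) ≈ invfact j
    invfact-suc j j<p = begin
      suc j × (invfact j * inv j)        ≈⟨ ×≈⟦⟧* (suc j) _ ⟩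
      ⟦ suc j ⟧ * (invfact j * inv j)    ≈⟨ solve 3 (λ n f i → n :* (f :* i) := f :* (n :* i)) refl _ _ _ ⟩
      invfact j * (⟦ suc j ⟧ * inv j)    ≈⟨ trans (*-congˡ (inv-eq j j<p)) (*-identityʳ _) ⟩
      invfact j                          ∎

    θ-exp : ∀ a → θ (exp a) ≈[ p ] exp a ⊛ X· (const a)
    θ-exp a = below λ where
      zero    _   → sym (zeroʳ _)
      (suc j) j<p → begin
        suc j × (a * a ^ j * invfact (suc j))
          ≈⟨ trans (×≈⟦⟧* (suc j) _) (solve 4 (λ n a u f → n :* (a :* u :* f) := a :* (u :* (n :* f))) refl _ _ _ _) ⟩
        a * (a ^ j * (⟦ suc j ⟧ * invfact (suc j)))
          ≈⟨ *-congˡ (*-congˡ (trans (sym (×≈⟦⟧* (suc j) _)) (invfact-suc j j<p))) ⟩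
        a * exp a j                        ≈⟨ const-⊛ a (exp a) j ⟨
        (const a ⊛ exp a) j                ≈⟨ X·-⊛ (const a) (exp a) (suc j) ⟨
        (X· (const a) ⊛ exp a) (suc j)     ≈⟨ ⊛-comm (X· (const a)) (exp a) (suc j) ⟩
        (exp a ⊛ X· (const a)) (suc j)     ∎

    -- Both sides have constant term 1 and logarithmic derivative (a + b)X, so no binomial sum is
    -- needed.
    exp-+ : ∀ a b → exp a ⊛ exp b ≈[ p ] exp (a + b)
    exp-+ a b = ode-unique p (exp a ⊛ exp b) (exp (a + b)) (X· (const a) ⊞ X· (const b)) ℕ.≤-refl
      (+-identityˡ 0#) (*-cong (*-identityʳ 1#) (*-identityʳ 1#)) product sum
      where
      module S = Ring p
      product : θ (exp a ⊛ exp b) ≈[ p ] (exp a ⊛ exp b) ⊛ (X· (const a) ⊞ X· (const b))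
      product = S.trans (below λ j _ → θ-⊛ (exp a) (exp b) j) (S.trans
        (S.+-cong
          (S.trans (S.*-congʳ (θ-exp a)) (S.trans (S.*-assoc _ _ _)
            (S.trans (S.*-congˡ (S.*-comm _ _)) (S.sym (S.*-assoc _ _ _)))))
          (S.trans (S.*-congˡ (θ-exp b)) (S.sym (S.*-assoc _ _ _))))
        (S.sym (S.distribˡ _ _ _)))
      sum : θ (exp (a + b)) ≈[ p ] exp (a + b) ⊛ (X· (const a) ⊞ X· (const b))
      sum = S.trans (θ-exp (a + b)) (S.*-congˡ (below λ where
        zero          _ → sym (+-identityˡ 0#)
        (suc zero)    _ → refl
        (suc (suc j)) _ → sym (+-identityˡ 0#)))

    exp-0 : ∀ j → exp 0# j ≈ const 1# j
    exp-0 zero    = *-identityˡ 1#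
    exp-0 (suc j) = trans (*-congʳ (zeroˡ _)) (zeroˡ _)

    exp-^ : ∀ n → exp 1# ^ˢ n ≈[ p ] exp ⟦ n ⟧
    exp-^ zero    = below λ j _ → sym (exp-0 j)
    exp-^ (suc n) = Ring.trans p (Ring.*-congˡ p (exp-^ n)) (exp-+ 1# ⟦ n ⟧)

    exp-1 : ∀ j → exp 1# j ≈ invfact j
    exp-1 j = trans (*-congʳ (1^ j)) (*-identityˡ _)
      where
      1^ : ∀ j → 1# ^ j ≈ 1#
      1^ zero    = refl
      1^ (suc j) = trans (*-identityˡ _) (1^ j)

    -- log (1 - X)
    log : Series
    log zero    = 0#
    log (suc k) = - inv k

    -- The partial sums of log^i / i!. Since log^i starts in degree i, the first p summands already
    -- give every coefficient below p.
    exp∘log : ℕ → Series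
    exp∘log zero    = λ _ → 0#
    exp∘log (suc n) = exp∘log n ⊞ (invfact n ◂ (log ^ˢ n))

    -- As for the exponential series itself, differentiation lowers the number of summands by one;
    -- the factor θ log comes from the chain rule for log^i.
    θ-exp∘log : ∀ n → suc n ℕ.≤ p → θ (exp∘log (suc n)) ≈[ p ] exp∘log n ⊛ θ log
    θ-exp∘log zero _ = below λ j j<p → trans (zeros j) (sym (0⊛ (θ log) j))
      where
      zeros : ∀ j → j × (0# + 1# * const 1# j) ≈ 0#
      zeros zero    = refl
      zeros (suc j) = trans (×-congʳ (suc j) (trans (+-identityˡ _) (*-identityˡ _))) (trans (×≈⟦⟧* (suc j) 0#) (zeroʳ _))
    θ-exp∘log (suc n) n<p = below λ j j<p → begin
      j × (exp∘log (suc n) j + invfact (suc n) * (log ^ˢ suc n) j)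
        ≈⟨ trans (×≈⟦⟧* j _) (trans (distribˡ _ _ _) (+-cong (sym (×≈⟦⟧* j _))
             (solve 3 (λ j f l → j :* (f :* l) := f :* (j :* l)) refl _ _ _))) ⟩
      θ (exp∘log (suc n)) j + invfact (suc n) * (⟦ j ⟧ * (log ^ˢ suc n) j)
        ≈⟨ +-cong (coeff (θ-exp∘log n (ℕ.<⇒≤ n<p)) j j<p)
             (*-congˡ (trans (sym (×≈⟦⟧* j _)) (trans (θ-^ log n j) (×≈⟦⟧* (suc n) _)))) ⟩
      (exp∘log n ⊛ θ log) j + invfact (suc n) * (⟦ suc n ⟧ * (log ^ˢ n ⊛ θ log) j)
        ≈⟨ +-congˡ (trans (solve 3 (λ f n l → f :* (n :* l) := (n :* f) :* l) refl _ _ _)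
             (*-congʳ (trans (sym (×≈⟦⟧* (suc n) _)) (invfact-suc n n<p)))) ⟩
      (exp∘log n ⊛ θ log) j + invfact n * (log ^ˢ n ⊛ θ log) j
        ≈⟨ +-congˡ (◂-⊛ (invfact n) (log ^ˢ n) (θ log) j) ⟨
      (exp∘log n ⊛ θ log) j + ((invfact n ◂ (log ^ˢ n)) ⊛ θ log) j
        ≈⟨ ⊛-distribʳ (θ log) (exp∘log n) (invfact n ◂ (log ^ˢ n)) j ⟨
      (exp∘log (suc n) ⊛ θ log) j ∎

    ⊛-order : ∀ n f g → (∀ j → j ℕ.< n → f j ≈ 0#) → g 0 ≈ 0# → ∀ j → j ℕ.< suc n → (f ⊛ g) j ≈ 0#
    ⊛-order n f g f0 g0 zero    _         = trans (*-congˡ g0) (zeroʳ _)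
    ⊛-order n f g f0 g0 (suc j) (s≤s j<n) = trans (⊛-suc f g j) (trans (+-cong
      (trans (⊛-cong-≤ {f} {λ _ → 0#} j (λ i i≤j → f0 i (ℕ.≤-<-trans i≤j j<n)) (λ _ _ → refl)) (0⊛ (tl g) j))
      (trans (*-congˡ g0) (zeroʳ _))) (+-identityˡ 0#))

    log^-order : ∀ n j → j ℕ.< n → (log ^ˢ n) j ≈ 0#
    log^-order (suc n) j j<n = trans (⊛-comm log (log ^ˢ n) j) (⊛-order n (log ^ˢ n) log (log^-order n) refl j j<n)

    -- Both sides solve θP = P·θ log with P(0) = 1. For the partial sum the equation lacks the term
    -- log^(p-1)·θ log, which starts in degree p. For 1 - X it is the telescoping of (1 - X)(-X - X²
    -- - ...) to -X.
    exp∘log≈1-X : exp∘log p ≈[ p ] const 1# ⊞ X· (const (- 1#))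
    exp∘log≈1-X = ode-unique p (exp∘log p) (const 1# ⊞ X· (const (- 1#))) (θ log) ℕ.≤-refl refl
      (trans (head p (s≤s z≤n)) (sym (+-identityʳ 1#))) lhs rhs
      where
      head : ∀ n → 0 ℕ.< n → exp∘log n 0 ≈ 1#
      head (suc zero)    _ = trans (+-identityˡ _) (*-identityˡ 1#)
      head (suc (suc n)) _ = trans (+-cong (head (suc n) (s≤s z≤n)) (trans (*-congˡ (zeroˡ _)) (zeroʳ _))) (+-identityʳ 1#)
      lhs : θ (exp∘log p) ≈[ p ] exp∘log p ⊛ θ log
      lhs = below λ j j<p → trans (coeff (θ-exp∘log (suc q) ℕ.≤-refl) j j<p)
        (sym (trans (⊛-distribʳ (θ log) (exp∘log (suc q)) (invfact (suc q) ◂ (log ^ˢ suc q)) j)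
          (trans (+-congˡ (trans (◂-⊛ (invfact (suc q)) (log ^ˢ suc q) (θ log) j)
            (trans (*-congˡ (⊛-order (suc q) (log ^ˢ suc q) (θ log) (log^-order (suc q)) refl j j<p)) (zeroʳ _))))
            (+-identityʳ _))))
      θ-log : ∀ k → suc k ℕ.< p → θ log (suc k) ≈ - 1#
      θ-log k k<p = trans (×≈⟦⟧* (suc k) _) (trans (sym (-‿distribʳ-* ⟦ suc k ⟧ (inv k))) (-‿cong (inv-eq k k<p)))
      expand : ∀ j → ((const 1# ⊞ X· (const (- 1#))) ⊛ θ log) j ≈ θ log j + X· (const (- 1#) ⊛ θ log) j
      expand j = trans (⊛-distribʳ (θ log) (const 1#) (X· (const (- 1#))) j)
        (+-cong (trans (const-⊛ 1# (θ log) j) (*-identityˡ _)) (X·-⊛ (const (- 1#)) (θ log) j))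
      rhs : θ (const 1# ⊞ X· (const (- 1#))) ≈[ p ] (const 1# ⊞ X· (const (- 1#))) ⊛ θ log
      rhs = below λ j j<p → trans (values j j<p) (sym (expand j))
        where
        values : ∀ j → j ℕ.< p → θ (const 1# ⊞ X· (const (- 1#))) j ≈ θ log j + X· (const (- 1#) ⊛ θ log) j
        values zero          _   = sym (+-identityˡ 0#)
        values (suc zero)    j<p = trans (trans (+-identityʳ _) (+-identityˡ _))
          (sym (trans (+-cong (θ-log 0 j<p) (zeroʳ _)) (+-identityʳ _)))
        values (suc (suc j)) j<p = trans (trans (×≈⟦⟧* (suc (suc j)) _) (trans (*-congˡ (+-identityˡ 0#)) (zeroʳ _)))
          (sym (trans (+-cong (θ-log (suc j) j<p) (trans (const-⊛ (- 1#) (θ log) (suc j))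
            (trans (*-congˡ (θ-log j (ℕ.<-trans (ℕ.n<1+n (suc j)) j<p)))
              (trans (sym (-‿distribˡ-* 1# (- 1#))) (trans (-‿cong (*-identityˡ _)) (-‿involutive 1#))))))
            (-‿inverseˡ 1#)))

    -- Evaluating log first and then taking powers agrees with taking powers of the series and then
    -- evaluating, up to x^p in each summand. So the polynomial identity follows from the identity
    -- of series.
    exp-log : ∀ x → ev p invfact (ev p log x) ≡ 1# + - x [ x ^ p ]
    exp-log x = ≡-trans (≡-sym (partial p)) (≈⇒≡ (trans (ev-cong p x exp∘log≈1-X)
      (trans (ev-⊞ p (const 1#) (X· (const (- 1#))) x) (+-cong (ev-const p 1# x)
        (trans (+-identityˡ _) (trans (*-congˡ (ev-const (suc q) (- 1#) x))
          (trans (sym (-‿distribʳ-* x 1#)) (-‿cong (*-identityʳ x)))))))))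
      where
      partial : ∀ n → ev p (exp∘log n) x ≡ ev n invfact (ev p log x) [ x ^ p ]
      partial zero    = ≈⇒≡ (ev-0 p x)
      partial (suc n) = ≡-trans (≈⇒≡ (trans (ev-⊞ p (exp∘log n) (invfact n ◂ (log ^ˢ n)) x) (+-congˡ (ev-◂ p (invfact n) (log ^ˢ n) x))))
        (≡-trans (≡-+ (partial n) (≡-* (≈⇒≡ (refl {invfact n})) (≡-sym (ev-^ p log x n))))
          (≈⇒≡ (sym (ev-snoc n invfact (ev p log x)))))

-- Congruences for π and for powers of ζ^a - 1, over an abstract ring

module LocalCyclotomic {c ℓ : Level} (R : CommutativeRing c ℓ) {q : ℕ} (pr : Prime (suc (suc q))) where
  open CommutativeRing R hiding (zero)
  open Exponentiation commutativeSemiring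
  open RingProperties ring using (-‿distribʳ-*; -‿distribˡ-*; -‿involutive; -0#≈0#)
  open SemiringSolver commutativeSemiring using (solve; _:=_; _:+_; _:*_)
  open Congruence R
  open Naturals R
  open PowerSeries R
  open ExpLog R pr
  open Frobenius R pr using (binomial-prime; binomial-mod-p; ≡-frobenius; fermat)

  -- All that is required of ℤ_(p)[ζ], with `ƛ` for 1 - ζ. Neither irreducibility of the cyclotomic
  -- polynomial nor a valuation is assumed.
  record Uniformizer : Set (c ⊔ ℓ) where
    field
      inv       : ℕ → Carrier
      inv-eq    : ∀ k → suc k ℕ.< p → ⟦ suc k ⟧ * inv k ≈ 1#
      unit      : ∀ v → ∃ λ u → (1# + ⟦ p ⟧ * v) * u ≈ 1#
      ƛ         : Carrier
      ƛ-regular : ∀ z → ƛ * z ≈ 0# → z ≈ 0#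
      [1-ƛ]^p   : (1# + - ƛ) ^ p ≈ 1#

  module Consequences (uniformizer : Uniformizer) where
    open Uniformizer uniformizer
    open Inverses inv inv-eq

    P ζ π : Carrier
    P = ⟦ p ⟧
    ζ = 1# + - ƛ
    π = ev p log ƛ

    exponential : Carrier → Carrier
    exponential = ev p invfact

    1^ : ∀ n → 1# ^ n ≈ 1#
    1^ zero    = refl
    1^ (suc n) = trans (*-identityˡ _) (1^ n)

    0≈⇒≈- : ∀ {x y} → x + y ≈ 0# → x ≈ - y
    0≈⇒≈- {x} {y} e = trans (sym (cancel-sum x y)) (trans (+-congʳ e) (+-identityˡ _))

    -- Expanding (1 - ƛ)^p = 1 modulo p(-ƛ) gives (-ƛ)^p + p(-ƛ)δ = 0, from which `ƛ` can be
    -- cancelled.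
    P∣ƛ^[p-1] : P ∣ ƛ ^ suc q
    P∣ƛ^[p-1] = ∣-trans P∣[-ƛ] (∣-^ (suc q) (- 1# ,
        sym (trans (sym (-‿distribˡ-* ƛ (- 1#))) (trans (-‿cong (sym (-‿distribʳ-* ƛ 1#)))
          (trans (-‿involutive _) (*-identityʳ ƛ))))))
      where
      open SetoidReasoning setoid
      expansion = binomial-mod-p 1# (- ƛ)
      δ = proj₁ expansion
      annihilated : - ƛ * ((- ƛ) ^ suc q + P * δ) ≈ 0#
      annihilated = begin
        - ƛ * ((- ƛ) ^ suc q + P * δ)
          ≈⟨ solve 4 (λ l m p d → l :* (m :+ p :* d) := l :* m :+ p :* l :* d) refl _ _ _ _ ⟩
        (- ƛ) ^ p + P * - ƛ * δ
          ≈⟨ cancel-sum _ 1# ⟨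
        (- ƛ) ^ p + P * - ƛ * δ + 1# + - 1#
          ≈⟨ +-congʳ (trans (solve 3 (λ a b o → a :+ b :+ o := o :+ a :+ b) refl _ _ 1#) (+-congʳ (+-congʳ (sym (1^ p))))) ⟩
        1# ^ p + (- ƛ) ^ p + P * - ƛ * δ + - 1#
          ≈⟨ +-congʳ (trans (sym (proj₂ expansion)) [1-ƛ]^p) ⟩
        1# + - 1#
          ≈⟨ -‿inverseʳ 1# ⟩
        0# ∎
      P∣[-ƛ] : P ∣ (- ƛ) ^ suc q
      P∣[-ƛ] = - δ , trans (0≈⇒≈- (ƛ-regular _ (trans (sym (-‿involutive _))
        (trans (-‿cong (trans (-‿distribˡ-* ƛ _) annihilated)) -0#≈0#)))) (-‿distribʳ-* P δ)

    ƛ∣π : ƛ ∣ π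
    ƛ∣π = ev (suc q) (tl log) ƛ , +-identityˡ _

    exponential-π-mod-ƛ : exponential π ≡ ζ [ P * ƛ ]
    exponential-π-mod-ƛ = ≡-weaken (∣-respˡ (*-comm ƛ P) (∣-* ∣-refl P∣ƛ^[p-1])) (exp-log ƛ)

    -- Write exp π = 1 + πU. The congruence exp π ≡ 1 - ƛ modulo pƛ becomes ƛ(1 + pw) = -πU, and 1 +
    -- pw is a unit.
    π∣ƛ : π ∣ ƛ
    π∣ƛ = - (U * u) , (begin
      ƛ                                 ≈⟨ *-identityʳ ƛ ⟨
      ƛ * 1#                            ≈⟨ *-congˡ u-inv ⟨
      ƛ * ((1# + P * w) * u)            ≈⟨ solve 4 (λ l o x u → l :* ((o :+ x) :* u) := (l :* o :+ x :* l) :* u) refl ƛ 1# (P * w) u ⟩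
      (ƛ * 1# + P * w * ƛ) * u          ≈⟨ *-congʳ (+-cong (*-identityʳ ƛ) (solve 3 (λ p w l → p :* w :* l := p :* l :* w) refl P w ƛ)) ⟩
      (ƛ + P * ƛ * w) * u               ≈⟨ *-congʳ (0≈⇒≈- sum-zero) ⟩
      - (π * U) * u                     ≈⟨ trans (sym (-‿distribˡ-* _ u)) (trans (-‿cong (*-assoc π U u)) (-‿distribʳ-* π _)) ⟩
      π * - (U * u)                     ∎)
      where
      open SetoidReasoning setoid
      U = ev (suc q) (tl invfact) π
      w = proj₁ (≡-sym exponential-π-mod-ƛ)
      u = proj₁ (unit w)
      u-inv = proj₂ (unit w)
      sum-zero : ƛ + P * ƛ * w + π * U ≈ 0#
      sum-zero = begin
        ƛ + P * ƛ * w + π * U            ≈⟨ cancel-sum _ 1# ⟨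
        ƛ + P * ƛ * w + π * U + 1# + - 1# ≈⟨ +-congʳ (solve 4 (λ l x y o → l :+ x :+ y :+ o := l :+ (o :+ y :+ x)) refl _ _ _ _) ⟩
        ƛ + (exponential π + P * ƛ * w) + - 1# ≈⟨ +-congʳ (+-congˡ (sym (proj₂ (≡-sym exponential-π-mod-ƛ)))) ⟩
        ƛ + (1# + - ƛ) + - 1#            ≈⟨ solve 4 (λ l o m n → l :+ (o :+ m) :+ n := (l :+ m) :+ (o :+ n)) refl _ _ _ _ ⟩
        (ƛ + - ƛ) + (1# + - 1#)          ≈⟨ +-cong (-‿inverseʳ ƛ) (-‿inverseʳ 1#) ⟩
        0# + 0#                          ≈⟨ +-identityˡ 0# ⟩
        0#                               ∎

    π-regular : ∀ z → π * z ≈ 0# → z ≈ 0#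
    π-regular z e = ƛ-regular z (trans (*-congʳ (proj₂ π∣ƛ)) (trans (solve 3 (λ a b z → a :* b :* z := b :* (a :* z)) refl _ _ _)
      (trans (*-congˡ e) (zeroʳ _))))

    P∣π^[p-1] : P ∣ π ^ suc q
    P∣π^[p-1] = ∣-trans P∣ƛ^[p-1] (∣-^ (suc q) ƛ∣π)

    Pπ∣π^p : P * π ∣ π ^ p
    Pπ∣π^p = ∣-respˡ (*-comm π P) (∣-* ∣-refl P∣π^[p-1])

    exponential-π : exponential π ≡ ζ [ P * π ]
    exponential-π = ≡-weaken (∣-* ∣-refl π∣ƛ) exponential-π-mod-ƛ

    ζ^n : ∀ n → ζ ^ n ≡ ev p (exp ⟦ n ⟧) π [ P * π ]
    ζ^n zero    = ≈⇒≡ (sym (trans (ev-cong p π (below λ j _ → exp-0 j)) (ev-const p 1# π)))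
    ζ^n (suc n) = begin
      ζ * ζ ^ n                                 ≈⟨ ≡-* (≡-sym exponential-π) (ζ^n n) ⟩
      exponential π * ev p (exp ⟦ n ⟧) π        ≈⟨ ≡-* (≈⇒≡ (ev-cong p π (below λ j _ → sym (exp-1 j)))) (≈⇒≡ refl) ⟩
      ev p (exp 1#) π * ev p (exp ⟦ n ⟧) π      ≈⟨ ≡-weaken Pπ∣π^p (ev-⊛ p (exp 1#) (exp ⟦ n ⟧) π) ⟩
      ev p (exp 1# ⊛ exp ⟦ n ⟧) π               ≈⟨ ≈⇒≡ (ev-cong p π (exp-+ 1# ⟦ n ⟧)) ⟩
      ev p (exp ⟦ suc n ⟧) π                    ∎
      where open SetoidReasoning (≡-setoid (P * π))

    -- `ev-^p` evaluates below degree 2p, whereas `invfact` has a meaning only below degree p; the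
    -- undefined coefficients are replaced by zeros.
    trunc : ℕ → Series → Series
    trunc zero    f j       = 0#
    trunc (suc d) f zero    = f 0
    trunc (suc d) f (suc j) = trunc d (tl f) j

    trunc-coeff : ∀ d f j → j ℕ.< d → trunc d f j ≈ f j
    trunc-coeff (suc d) f zero    _         = refl
    trunc-coeff (suc d) f (suc j) (s≤s j<d) = trunc-coeff d (tl f) j j<d

    ev-trunc : ∀ d {n} f x → d ℕ.≤ n → ev n (trunc d f) x ≈ ev d f x
    ev-trunc zero    {n} f x _         = ev-0 n x
    ev-trunc (suc d) f x (s≤s d≤n) = +-congˡ (*-congˡ (ev-trunc d (tl f) x d≤n))

    ^ˢ-cong : ∀ {f g} d n → f ≈[ d ] g → f ^ˢ n ≈[ d ] g ^ˢ n
    ^ˢ-cong d zero    _ = Ring.refl d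
    ^ˢ-cong d (suc n) e = ⊛-cong d e (^ˢ-cong d n e)

    -- The p-th power is p-divisible at every degree below 2p except 0 and p.
    ev-^p : ∀ g x ν → P ∣ ν → ν ∣ x ^ p →
            ev (p ℕ.+ p) g x ^ p ≡ ev p (g ^ˢ p) x + x ^ p * g 1 ^ p [ P * ν ]
    ev-^p g x ν P∣ν ν∣x^p = begin
      ev (p ℕ.+ p) g x ^ p
        ≈⟨ ≡-weaken (∣-respʳ (sym (^-homo-* x p p)) (∣-* (∣-trans P∣ν ν∣x^p) ν∣x^p)) (ev-^ (p ℕ.+ p) g x p) ⟩
      ev (p ℕ.+ p) (g ^ˢ p) x
        ≈⟨ ≈⇒≡ (ev-+ p p (g ^ˢ p) x) ⟩
      ev p (g ^ˢ p) x + x ^ p * ev p (λ j → (g ^ˢ p) (p ℕ.+ j)) x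
        ≈⟨ ≡-+ (≈⇒≡ refl) (≡-weaken (∣-respˡ (*-comm ν P) (∣-* ν∣x^p ∣-refl)) (≡-scale (x ^ p) upper)) ⟩
      ev p (g ^ˢ p) x + x ^ p * g 1 ^ p ∎
      where
      open SetoidReasoning (≡-setoid (P * ν))
      upper : ev p (λ j → (g ^ˢ p) (p ℕ.+ j)) x ≡ g 1 ^ p [ P ]
      upper = ≡-trans (≡-+ (^p-coeff-p g)
          (∣⇒≡0 (∣-*ˡ x (∣-ev (suc q) _ x (λ j j<p → ^p-coeff-p+ g j (s≤s j<p))))))
        (≈⇒≡ (+-identityʳ _))

    invfact-1 : invfact 1 ≈ 1#
    invfact-1 = trans (sym (+-identityʳ _)) (invfact-suc 0 (s≤s (s≤s z≤n)))

    Pπ+π^p : 1# ≡ 1# + (P * π + π ^ p) [ P * (P * π) ]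
    Pπ+π^p = begin
      1#                                 ≈⟨ ≈⇒≡ (sym [1-ƛ]^p) ⟩
      ζ ^ p                              ≈⟨ ≡-frobenius (∣-*ʳ π ∣-refl) (≡-sym exponential-π) ⟩
      exponential π ^ p                  ≈⟨ ≈⇒≡ (^-congˡ p (sym (ev-trunc p {p ℕ.+ p} invfact π (ℕ.m≤m+n p p)))) ⟩
      ev (p ℕ.+ p) g π ^ p               ≈⟨ ev-^p g π (P * π) (∣-*ʳ π ∣-refl) Pπ∣π^p ⟩
      ev p (g ^ˢ p) π + π ^ p * g 1 ^ p  ≈⟨ ≡-+ (≈⇒≡ (ev-cong p π lower))
                                              (≈⇒≡ (trans (*-congˡ (trans (^-congˡ p invfact-1) (1^ p))) (*-identityʳ _))) ⟩
      -- Below degree p the p-th power of exp is exp(pX). Its terms from degree 2 on carry p²π², so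
      -- only 1 + pπ survives.
      ev p (exp P) π + π ^ p             ≈⟨ ≡-+ linear (≈⇒≡ refl) ⟩
      1# + P * π + π ^ p                 ≈⟨ ≈⇒≡ (+-assoc _ _ _) ⟩
      1# + (P * π + π ^ p)               ∎
      where
      open SetoidReasoning (≡-setoid (P * (P * π)))
      g = trunc p invfact
      lower : g ^ˢ p ≈[ p ] exp P
      lower = Ring.trans p (^ˢ-cong p p (below λ j j<p → trans (trunc-coeff p invfact j j<p) (sym (exp-1 j)))) (exp-^ p)
      linear : ev p (exp P) π ≡ 1# + P * π [ P * (P * π) ]
      linear = ≡-trans (≈⇒≡ (solve 4 (λ a x b e → a :+ x :* (b :+ x :* e) := a :+ b :* x :+ x :* x :* e) refl
             (1# * 1#) π (P * 1# * invfact 1) (ev q (λ j → exp P (suc (suc j))) π)))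
        (≡-trans (≡-+ (≈⇒≡ (+-cong (*-identityˡ 1#) (*-congʳ (trans (*-cong (*-identityʳ P) invfact-1) (*-identityʳ P)))))
            (∣⇒≡0 (∣-respˡ (solve 2 (λ p x → x :* (p :* p) := p :* (p :* x)) refl P π)
              (∣-* (∣-*ʳ π ∣-refl) (∣-ev q _ π (λ j _ →
                P ^ j * invfact (suc (suc j)) , solve 3 (λ p u f → p :* (p :* u) :* f := p :* p :* (u :* f)) refl _ _ _))))))
          (≈⇒≡ (+-identityʳ _)))

    π^[p-1] : π ^ suc q ≡ - P [ P * P ]
    π^[p-1] = proj₁ congruence , (begin
      π ^ suc q                          ≈⟨ cancel-sum _ _ ⟨
      π ^ suc q + (P + - (P * P * δ)) + - (P + - (P * P * δ))
                                         ≈⟨ trans (+-congʳ vanishing) (+-identityˡ _) ⟩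
      - (P + - (P * P * δ))              ≈⟨ sym (-‿+-comm P _) ⟩
      - P + - - (P * P * δ)              ≈⟨ +-congˡ (-‿involutive _) ⟩
      - P + P * P * δ                    ∎)
      where
      open RingProperties ring using (-‿+-comm)
      open SetoidReasoning setoid
      congruence : ∃ λ δ → 1# + (P * π + π ^ p) ≈ 1# + P * (P * π) * δ
      congruence = ≡-sym Pπ+π^p
      δ = proj₁ congruence
      vanishing : π ^ suc q + (P + - (P * P * δ)) ≈ 0#
      vanishing = π-regular _ (begin
        π * (π ^ suc q + (P + - (P * P * δ)))
          ≈⟨ trans (distribˡ _ _ _) (+-congˡ (trans (distribˡ _ _ _) (+-congˡ (sym (-‿distribʳ-* π _))))) ⟩
        π ^ p + (π * P + - (π * (P * P * δ)))
          ≈⟨ solve 3 (λ a b c → a :+ (b :+ c) := b :+ a :+ c) refl _ _ _ ⟩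
        π * P + π ^ p + - (π * (P * P * δ))
          ≈⟨ +-cong (+-congʳ (*-comm π P)) (-‿cong (solve 3 (λ x p d → x :* (p :* p :* d) := p :* (p :* x) :* d) refl π P δ)) ⟩
        P * π + π ^ p + - (P * (P * π) * δ)
          ≈⟨ +-congʳ (trans (sym (cancel-sum _ 1#)) (trans (+-congʳ (trans (+-comm _ _) (trans (proj₂ congruence) (+-comm _ _)))) (cancel-sum _ 1#))) ⟩
        P * (P * π) * δ + - (P * (P * π) * δ)
          ≈⟨ -‿inverseʳ _ ⟩
        0# ∎)

    -- Powers of ζ^a - 1 through U = u(aπ), where α stands for a and k for its residue modulo p

    module Powers {α k} (α≡k : α ≡ ⟦ k ⟧ [ P ]) where

      x U : Carrier
      x = α * π
      U = ev (suc q) (tl invfact) x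

      P∣x^[p-1] : P ∣ x ^ suc q
      P∣x^[p-1] = ∣-respʳ (sym (^-distrib-* α π (suc q))) (∣-*ˡ (α ^ suc q) P∣π^[p-1])

      ζ^k : ζ ^ k ≡ exponential x [ P * π ]
      ζ^k = begin
        ζ ^ k                    ≈⟨ ζ^n k ⟩
        ev p (exp ⟦ k ⟧) π       ≈⟨ ≈⇒≡ (ev-scale p ⟦ k ⟧ invfact π) ⟨
        -- As α - k is a multiple of p, the two arguments differ by a multiple of pπ.
        exponential (⟦ k ⟧ * π)  ≈⟨ ev-arg-cong p invfact
                                      (≡-trans (≈⇒≡ (*-comm α π)) (≡-trans
                                        (≡-weaken (∣-respˡ (*-comm π P) ∣-refl) (≡-scale π α≡k)) (≈⇒≡ (*-comm π _)))) ⟨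
        exponential x            ∎
        where open SetoidReasoning (≡-setoid (P * π))

      -- Here exp x = 1 + xU. Only π is taken out, not x = απ: the error pπV of the congruence need
      -- not contain α.
      ζ^k-1 : ∃ λ V → ζ ^ k + - 1# ≈ π * (α * U + P * V)
      ζ^k-1 = V , trans (+-congʳ (proj₂ ζ^k))
        (trans (+-congʳ (solve 6 (λ o a p u b v → o :+ a :* p :* u :+ b :* p :* v := p :* (a :* u :+ b :* v) :+ o) refl 1# α π U P V))
          (cancel-sum _ 1#))
        where V = proj₁ ζ^k

      [ζ^k-1]^n : ∀ n {y γ} → (α * U + P * proj₁ ζ^k-1) ^ n ≡ y [ γ ] → (ζ ^ k + - 1#) ^ n ≡ π ^ n * y [ π ^ n * γ ]
      [ζ^k-1]^n n e = ≡-trans (≈⇒≡ (trans (^-congˡ n (proj₂ ζ^k-1)) (^-distrib-* π _ n))) (≡-scale (π ^ n) e)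

      U≡1+ : U ≈ 1# + x * ev q (tl (tl invfact)) x
      U≡1+ = +-congʳ invfact-1

      -- U = 1 + xe, and the p-th power of xe is divisible by x^p, hence by p.
      U^p : U ^ p ≡ 1# [ P ]
      U^p = begin
        U ^ p                  ≈⟨ ≈⇒≡ (^-congˡ p U≡1+) ⟩
        (1# + x * e) ^ p       ≈⟨ ≡-weaken (∣-*ʳ (x * e) ∣-refl) (binomial-mod-p 1# (x * e)) ⟩
        1# ^ p + (x * e) ^ p   ≈⟨ ≡-+ (≈⇒≡ (1^ p)) (∣⇒≡0 (∣-respʳ (sym (^-distrib-* x e p))
                                    (∣-*ʳ (e ^ p) (∣-*ˡ x P∣x^[p-1])))) ⟩
        1# + 0#                ≈⟨ ≈⇒≡ (+-identityʳ 1#) ⟩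
        1#                     ∎
        where
        open SetoidReasoning (≡-setoid P)
        e = ev q (tl (tl invfact)) x

      αU+PV : ∀ V → α * U + P * V ≡ α * U [ P ]
      αU+PV V = V , refl

      -- `w` stands for X/(e^X - 1), the series of the B_j/j!, known below degree p - 1 by being the
      -- inverse of u.
      module Reciprocal (w : Series) (U⊛w : tl invfact ⊛ w ≈[ suc q ] const 1#) where

        ω : Carrier
        ω = ev (suc q) w x

        Uω : U * ω ≡ 1# [ P ]
        Uω = ≡-trans (≡-weaken P∣x^[p-1] (ev-⊛ (suc q) (tl invfact) w x))
          (≈⇒≡ (trans (ev-cong (suc q) x U⊛w) (ev-const (suc q) 1# x)))

        -- Since Uω ≡ 1, U^n ≡ U^n (Uω)^m = U^(m+n) ω^m, and U^(m+n) ≡ 1 because p divides m + n.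
        -- This is where m ≡ -n enters and where ω^m brings in the Bernoulli numbers of order m.
        U^n : ∀ n m → p ℕ∣.∣ m ℕ.+ n → U ^ n ≡ ev (suc q) (w ^ˢ m) x [ P ]
        U^n n m (divides t m+n≡tp) = begin
          U ^ n                            ≈⟨ ≈⇒≡ (trans (*-congˡ (1^ m)) (*-identityʳ _)) ⟨
          U ^ n * 1# ^ m                   ≈⟨ ≡-* (≈⇒≡ refl) (≡-^ m Uω) ⟨
          U ^ n * (U * ω) ^ m              ≈⟨ ≈⇒≡ (trans (*-congˡ (^-distrib-* U ω m))
                                                (trans (solve 3 (λ a b c → a :* (b :* c) := b :* a :* c) refl _ _ _)
                                                  (*-congʳ (sym (^-homo-* U m n))))) ⟩
          U ^ (m ℕ.+ n) * ω ^ m            ≈⟨ ≡-* U^[m+n] (≡-weaken P∣x^[p-1] (ev-^ (suc q) w x m)) ⟩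
          1# * ev (suc q) (w ^ˢ m) x       ≈⟨ ≈⇒≡ (*-identityˡ _) ⟩
          ev (suc q) (w ^ˢ m) x            ∎
          where
          open SetoidReasoning (≡-setoid P)
          U^[m+n] : U ^ (m ℕ.+ n) ≡ 1# [ P ]
          U^[m+n] = ≡-trans (≈⇒≡ (trans (reflexive (≡.cong (U ^_) (≡.trans m+n≡tp (ℕ.*-comm t p)))) (sym (^-assocʳ U p t))))
            (≡-trans (≡-^ t U^p) (≈⇒≡ (1^ t)))

        power-congruence : ∀ n m → p ℕ∣.∣ m ℕ.+ n →
          (ζ ^ k + - 1#) ^ n ≡ x ^ n * ev (suc q) (w ^ˢ m) x [ P * π ^ n ]
        power-congruence n m d = ≡-weaken (∣-respˡ (*-comm _ P) ∣-refl) (≡-trans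
          ([ζ^k-1]^n n (≡-trans (≡-^ n (αU+PV _)) (≡-trans (≈⇒≡ (^-distrib-* α U n)) (≡-* (≈⇒≡ (refl {α ^ n})) (U^n n m d)))))
          (≈⇒≡ (trans (solve 3 (λ a b c → a :* (b :* c) := b :* a :* c) refl _ _ _) (*-congʳ (sym (^-distrib-* α π n))))))

        -- The p-th power of u modulo p²

        F : Series
        F = tl invfact ^ˢ p

        ⊛-≡ : ∀ {f f′ γ} g j → (∀ i → i ℕ.≤ j → f i ≡ f′ i [ γ ]) → (f ⊛ g) j ≡ (f′ ⊛ g) j [ γ ]
        ⊛-≡ g zero    e = ≡-* (e 0 z≤n) (≈⇒≡ refl)
        ⊛-≡ g (suc j) e = ≡-+ (≡-* (e 0 z≤n) (≈⇒≡ refl)) (⊛-≡ g j (λ i i≤j → e (suc i) (s≤s i≤j)))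

        F-0 : F 0 ≈ 1#
        F-0 = trans (^ˢ-0 (tl invfact) p) (trans (^-congˡ p invfact-1) (1^ p))

        F≡1 : ∀ i → i ℕ.< p → F i ≡ const 1# i [ P ]
        F≡1 zero    _   = ≈⇒≡ F-0
        F≡1 (suc i) i<p = ∣⇒≡0 (^p-coeff (tl invfact) i i<p)

        -- With u = (eˣ - 1)/X one has u + θu = eˣ = 1 + Xu, so the logarithmic derivative θu/u is w + X - 1.
        logarithmic-derivative : const 1# ⊞ (w ⊛ θ (tl invfact)) ≈[ suc q ] w ⊞ X
        logarithmic-derivative = begin
          const 1# ⊞ (w ⊛ θ u)     ≈⟨ S.+-congʳ (S.trans (S.*-comm w u) U⊛w) ⟨
          (w ⊛ u) ⊞ (w ⊛ θ u)      ≈⟨ S.distribˡ w u (θ u) ⟨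
          w ⊛ (u ⊞ θ u)            ≈⟨ S.*-congˡ u+θu ⟩
          w ⊛ (const 1# ⊞ (X ⊛ u)) ≈⟨ S.distribˡ w (const 1#) (X ⊛ u) ⟩
          (w ⊛ const 1#) ⊞ (w ⊛ (X ⊛ u))
                                   ≈⟨ S.+-cong (S.*-identityʳ w) (S.trans (S.*-comm w (X ⊛ u)) (S.trans (S.*-assoc X u w)
                                        (S.trans (S.*-congˡ U⊛w) (S.*-identityʳ X)))) ⟩
          w ⊞ X                    ∎
          where
          module S = Ring (suc q)
          open SetoidReasoning S.setoid
          u = tl invfact
          u+θu : u ⊞ θ u ≈[ suc q ] const 1# ⊞ (X ⊛ u)
          u+θu = below λ j j<p-1 → trans (invfact-suc j (s≤s j<p-1)) (trans (split j) (+-congˡ (sym (X⊛ u j))))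
            where
            split : ∀ j → invfact j ≈ const 1# j + X· u j
            split zero    = sym (+-identityʳ 1#)
            split (suc j) = sym (+-identityˡ _)

        -- θ(u^p) = p u^(p-1) θu, and inserting u·w = 1 turns u^(p-1) θu into F times the
        -- logarithmic derivative of u.
        θF : θ F ≈[ suc q ] Ring._×_ (suc q) p (F ⊛ (w ⊛ θ (tl invfact)))
        θF = below λ j j<p-1 → trans (θ-^ u (suc q) j) (trans (×-congʳ p (coeff insert j j<p-1))
          (sym (×-series (suc q) p (F ⊛ (w ⊛ θ u)) j)))
          where
          module S = Ring (suc q)
          u = tl invfact
          insert : u ^ˢ suc q ⊛ θ u ≈[ suc q ] F ⊛ (w ⊛ θ u)
          insert = S.sym (S.trans (S.*-congʳ (S.*-comm u (u ^ˢ suc q))) (S.trans (S.*-assoc (u ^ˢ suc q) u (w ⊛ θ u))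
            (S.*-congˡ (S.trans (S.sym (S.*-assoc u w (θ u))) (S.trans (S.*-congʳ U⊛w) (S.*-identityˡ (θ u)))))))

        -- θF = pF·D with D = θu/u. The factor p allows F to be replaced by its value 1 modulo p,
        -- which leaves pD modulo p²; then j + 1 is divided out.
        F-suc : ∀ j {d} → suc j ℕ.< suc q → (w ⊛ θ (tl invfact)) (suc j) ≈ suc j × d → F (suc j) ≡ P * d [ P * P ]
        F-suc j {d} j<p-1 e = ×-cancel j (s≤s (ℕ.<⇒≤ j<p-1)) (begin
          suc j × F (suc j)         ≈⟨ ≈⇒≡ (trans (coeff θF (suc j) j<p-1) (trans (×-series (suc q) p (F ⊛ D) (suc j)) (×≈⟦⟧* p _))) ⟩
          P * (F ⊛ D) (suc j)       ≈⟨ ≡-scale P (⊛-≡ D (suc j) (λ i i≤j → F≡1 i (s≤s (ℕ.≤-trans i≤j (ℕ.<⇒≤ j<p-1))))) ⟩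
          P * (const 1# ⊛ D) (suc j)
                                    ≈⟨ ≈⇒≡ (trans (*-congˡ (trans (const-⊛ 1# D (suc j)) (trans (*-identityˡ _) (trans e (×≈⟦⟧* (suc j) d)))))
                                         (trans (solve 3 (λ p j d → p :* (j :* d) := j :* (p :* d)) refl _ _ _) (sym (×≈⟦⟧* (suc j) _)))) ⟩
          suc j × (P * d)           ∎)
          where
          open SetoidReasoning (≡-setoid (P * P))
          D = w ⊛ θ (tl invfact)

        -- `inv (suc i)` is 1/(i + 2), so with k = i + 2 the product x²T is the sum of B_k/(k!
        -- k)·x^k over 1 < k < p - 1. For odd p this is log u(x) below degree p - 1, without its
        -- linear term x/2.
        T : Carrier
        T = ev (q ∸ 1) (λ i → w (suc (suc i)) * inv (suc i)) x

        F-≥2 : ∀ i → suc (suc i) ℕ.< suc q → F (suc (suc i)) ≡ P * (w (suc (suc i)) * inv (suc i)) [ P * P ]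
        F-≥2 i i<p-1 = F-suc (suc i) i<p-1 (begin
          D (suc (suc i))                  ≈⟨ +-identityˡ _ ⟨
          0# + D (suc (suc i))             ≈⟨ coeff logarithmic-derivative (suc (suc i)) i<p-1 ⟩
          w (suc (suc i)) + 0#             ≈⟨ +-identityʳ _ ⟩
          w (suc (suc i))                  ≈⟨ trans (*-congˡ (inv-eq (suc i) (s≤s (ℕ.<⇒≤ i<p-1)))) (*-identityʳ _) ⟨
          w (suc (suc i)) * (⟦ suc (suc i) ⟧ * inv (suc i))
                                           ≈⟨ trans (solve 3 (λ w n i → w :* (n :* i) := n :* (w :* i)) refl _ _ _) (sym (×≈⟦⟧* (suc (suc i)) _)) ⟩
          suc (suc i) × (w (suc (suc i)) * inv (suc i)) ∎)
          where
          open SetoidReasoning setoid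
          D = w ⊛ θ (tl invfact)

        M : Carrier
        M = x * x * T

        P∣x^p : P ∣ x ^ p
        P∣x^p = ∣-*ˡ x P∣x^[p-1]

        α^p : α ^ p ≡ α [ P ]
        α^p = ≡-trans (≡-^ p α≡k) (≡-trans (fermat k) (≡-sym α≡k))

        -- α^p ≡ α modulo p and π^(p-1) ≡ -p modulo p² combine. This is the form in which (i)
        -- removes the linear term of log u.
        x^p : x ^ p + P * x ≡ 0# [ P * P ]
        x^p = begin
          x ^ p + P * (α * π)
            ≈⟨ ≡-+ (≈⇒≡ (^-distrib-* α π p)) (≡-trans (≈⇒≡ (sym (*-assoc P α π))) (≡-* (≡-scale P (≡-sym α^p)) (≈⇒≡ refl))) ⟩
          α ^ p * (π * π ^ suc q) + P * α ^ p * π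
            ≈⟨ ≈⇒≡ (solve 4 (λ a x y p → a :* (x :* y) :+ p :* a :* x := a :* (x :* (y :+ p))) refl _ _ _ _) ⟩
          α ^ p * (π * (π ^ suc q + P))
            ≈⟨ ≡-* (≈⇒≡ refl) (≡-* (≈⇒≡ refl) (≡-+ π^[p-1] (≈⇒≡ refl))) ⟩
          α ^ p * (π * (- P + P))
            ≈⟨ ≈⇒≡ (trans (*-congˡ (trans (*-congˡ (-‿inverseˡ P)) (zeroʳ π))) (zeroʳ _)) ⟩
          0# ∎
          where open SetoidReasoning (≡-setoid (P * P))

        -- Modulo p², u^p has coefficients 1, p/2 and pB_k/(k! k) below degree p - 1, and
        -- contributes x^p/2 from degree p. The two terms with 1/2 annihilate each other.
        U^p-odd : ∀ {q′} → q ≡ suc q′ → U ^ p ≡ 1# + P * M [ P * P ]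
        U^p-odd {q′} q≡ = begin
          U ^ p
            ≈⟨ ≈⇒≡ (^-congˡ p (sym (ev-trunc (suc q) u x (ℕ.≤-trans (ℕ.n≤1+n (suc q)) (ℕ.m≤m+n p p))))) ⟩
          ev (p ℕ.+ p) g x ^ p
            ≈⟨ ev-^p g x P ∣-refl P∣x^p ⟩
          ev p (g ^ˢ p) x + x ^ p * g 1 ^ p
            -- Degree p - 1 lies outside the formula for F, as u would need 1/p! there. It is enough
            -- that p divides both the coefficient of `g ^ˢ p` and x^(p-1).
            ≈⟨ ≡-+ (≡-trans (≈⇒≡ (ev-snoc (suc q) (g ^ˢ p) x))
                     (≡-+ (≈⇒≡ (ev-cong (suc q) x (^ˢ-cong (suc q) p (below (trunc-coeff (suc q) u)))))
                       (∣⇒≡0 (∣-* (^p-coeff g q ℕ.≤-refl) P∣x^[p-1]))))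
                   (≡-weaken (∣-* P∣x^p ∣-refl) (≡-scale (x ^ p) g1^p)) ⟩
          ev (suc q) F x + 0# + x ^ p * half
            ≈⟨ ≡-+ (≡-trans (≈⇒≡ (+-identityʳ _)) (≡-trans (ev-≡ (suc q) x F≡F′) (≈⇒≡ ev-F′))) (≈⇒≡ refl) ⟩
          1# + P * M + P * half * x + x ^ p * half
            -- The linear term and the term of degree p are collected into (x^p + px)/2, which `x^p`
            -- annihilates.
            ≈⟨ ≈⇒≡ (solve 6 (λ o m p h x y → o :+ p :* m :+ p :* h :* x :+ y :* h := o :+ p :* m :+ (y :+ p :* x) :* h) refl
                 1# M P half x (x ^ p)) ⟩
          1# + P * M + (x ^ p + P * x) * half
            ≈⟨ ≡-+ (≈⇒≡ refl) (≡-* x^p (≈⇒≡ refl)) ⟩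
          1# + P * M + 0# * half
            ≈⟨ ≈⇒≡ (trans (+-congˡ (zeroˡ half)) (+-identityʳ _)) ⟩
          1# + P * M ∎
          where
          open SetoidReasoning (≡-setoid (P * P))
          u g F′ : Series
          u = tl invfact
          g = trunc (suc q) u
          half : Carrier
          half = u 1

          F′ zero          = 1#
          F′ (suc zero)    = P * half
          F′ (suc (suc i)) = P * (w (suc (suc i)) * inv (suc i))

          1<p-1 : 1 ℕ.< suc q
          1<p-1 = s≤s (≡.subst (1 ℕ.≤_) (≡.sym q≡) (s≤s z≤n))

          2half : 2 × half ≈ 1#
          2half = trans (invfact-suc 1 (s≤s 1<p-1)) invfact-1

          -- 1/2 is not a numeral, so `fermat` is applied to 2 instead: 2·half^p ≡ 2^p·half^p = 1 =
          -- 2·half, and 2 is cancelled.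
          half^p : half ^ p ≡ half [ P ]
          half^p = ×-cancel 1 (s≤s 1<p-1) (≡-trans (≈⇒≡ (×≈⟦⟧* 2 _)) (≡-trans (≡-* (≡-sym (fermat 2)) (≈⇒≡ refl))
            (≈⇒≡ (trans (sym (^-distrib-* ⟦ 2 ⟧ half p)) (trans (^-congˡ p (trans (sym (×≈⟦⟧* 2 half)) 2half))
              (trans (1^ p) (sym 2half)))))))

          g1^p : g 1 ^ p ≡ half [ P ]
          g1^p = ≡-trans (≈⇒≡ (^-congˡ p (trunc-coeff (suc q) u 1 1<p-1))) half^p

          w-0 : w 0 ≈ 1#
          w-0 = trans (sym (*-identityˡ _)) (trans (*-congʳ (sym invfact-1)) (coeff U⊛w 0 (s≤s z≤n)))

          -- This is B_1 = -1/2, read off from degree 1 of u·w = 1; it makes the linear term of log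
          -- u equal to x/2.
          w-1 : w 1 + 1# ≈ half
          w-1 = trans (+-congˡ (trans (sym 2half) (+-congˡ (+-identityʳ half)))) (trans
            (solve 2 (λ a h → a :+ (h :+ h) := (a :+ h) :+ h) refl (w 1) half)
            (trans (+-congʳ (trans (+-cong (sym (trans (*-congʳ invfact-1) (*-identityˡ _)))
                                           (sym (trans (*-congˡ w-0) (*-identityʳ _))))
                                   (coeff U⊛w 1 1<p-1)))
              (+-identityˡ half)))
          w-1-half : (w ⊛ θ u) 1 ≈ 1 × half
          w-1-half = trans (sym (+-identityˡ _)) (trans (coeff logarithmic-derivative 1 1<p-1) (trans w-1 (sym (+-identityʳ half))))

          F≡F′ : ∀ j → j ℕ.< suc q → F j ≡ F′ j [ P * P ]
          F≡F′ zero          _     = ≈⇒≡ F-0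
          F≡F′ (suc zero)    1<p-1 = F-suc 0 1<p-1 w-1-half
          F≡F′ (suc (suc i)) i<p-1 = F-≥2 i i<p-1

          ev-F′ : ev (suc q) F′ x ≈ 1# + P * M + P * half * x
          ev-F′ = trans (reflexive (≡.cong (λ n → ev (suc n) F′ x) q≡))
            (trans (+-congˡ (*-congˡ (+-congˡ (*-congˡ (trans (ev-◂ q′ P (λ i → w (suc (suc i)) * inv (suc i)) x)
                (*-congˡ (reflexive (≡.cong (λ n → ev (n ∸ 1) (λ i → w (suc (suc i)) * inv (suc i)) x) (≡.sym q≡)))))))))
              (solve 5 (λ o x p h t → o :+ x :* (p :* h :+ x :* (p :* t)) := o :+ p :* (x :* x :* t) :+ p :* h :* x) refl
                1# x P half T))

        -- Raising to the powers p^b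

        -- One factor p is gained by `≡-frobenius` at each step. Its use is to discard pV from (αU +
        -- pV)^(p^b).
        lift-exponent : ∀ {z w} b → z ≡ w [ P ] → z ^ (p ℕ.^ b) ≡ w ^ (p ℕ.^ b) [ P ^ suc b ]
        lift-exponent zero    e = ≡-weaken (∣-respˡ (sym (*-identityʳ P)) ∣-refl) (≡-^ 1 e)
        lift-exponent {z} {w} (suc b) e = ≡-trans (≈⇒≡ (swap z)) (≡-trans
          (≡-frobenius (∣-*ʳ (P ^ b) ∣-refl) (lift-exponent b e)) (≈⇒≡ (sym (swap w))))
          where
          swap : ∀ z → z ^ (p ℕ.* p ℕ.^ b) ≈ (z ^ (p ℕ.^ b)) ^ p
          swap z = trans (^-congʳ z (ℕ.*-comm p (p ℕ.^ b))) (sym (^-assocʳ z (p ℕ.^ b) p))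

        -- In (1 + y)^p with y = p^(b+1)M the linear term py is the new main term; p·y² and y^p are
        -- divisible by p^(b+3).
        U^p^b-odd : ∀ {q′} → q ≡ suc q′ → ∀ b → U ^ (p ℕ.^ suc b) ≡ 1# + P ^ suc b * M [ P ^ suc (suc b) ]
        U^p^b-odd q≡ zero = ≡-trans (≈⇒≡ (^-congʳ U (ℕ.*-identityʳ p)))
          (≡-weaken (∣-respˡ (*-congˡ (sym (*-identityʳ P))) ∣-refl)
            (≡-trans (U^p-odd q≡) (≈⇒≡ (+-congˡ (*-congʳ (sym (*-identityʳ P)))))))
        U^p^b-odd {q′} q≡ (suc b) = begin
          U ^ (p ℕ.^ suc (suc b))
            ≈⟨ ≈⇒≡ (trans (^-congʳ U (ℕ.*-comm p (p ℕ.^ suc b))) (sym (^-assocʳ U (p ℕ.^ suc b) p))) ⟩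
          (U ^ (p ℕ.^ suc b)) ^ p
            ≈⟨ ≡-frobenius (∣-*ʳ (P ^ suc b) ∣-refl) (U^p^b-odd q≡ b) ⟩
          (1# + y) ^ p
            ≈⟨ ≈⇒≡ (proj₂ (binomial-prime 1# y)) ⟩
          1# ^ p + P * (1# ^ suc q * y) + P * (y * y) * proj₁ (binomial-prime 1# y) + y ^ p
            ≈⟨ ≡-+ (≡-+ (≈⇒≡ (+-cong (1^ p) (*-congˡ (trans (*-congʳ (1^ (suc q))) (*-identityˡ y)))))
                 (∣⇒≡0 (∣-*ʳ _ (∣-* ∣-refl yy)))) (∣⇒≡0 yyy) ⟩
          1# + P * y + 0# + 0#
            ≈⟨ ≈⇒≡ (trans (+-identityʳ _) (trans (+-identityʳ _) (+-congˡ (sym (*-assoc P _ M))))) ⟩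
          1# + P ^ suc (suc b) * M ∎
          where
          open SetoidReasoning (≡-setoid (P ^ suc (suc (suc b))))
          y = P ^ suc b * M
          B∣y : P ^ suc b ∣ y
          B∣y = ∣-*ʳ M ∣-refl
          B : ℕ
          B = suc b
          yy : P ^ suc B ∣ y * y
          yy = ∣-trans (∣-^-≤ P (s≤s (ℕ.m≤n+m (suc b) b)))
            (∣-respˡ (sym (^-homo-* P B B)) (∣-* B∣y B∣y))
          -- Three factors y are used, which exist as p is odd. Two would give only p^(2b+2), too
          -- little for b = 0.
          yyy : P ^ suc (suc B) ∣ y ^ p
          yyy = ∣-trans (∣-^-≤ P {suc (suc B)} {B ℕ.+ (B ℕ.+ B)}
                (s≤s (ℕ.≤-trans (ℕ.≤-reflexive (≡.sym (ℕ.+-comm b 2))) (ℕ.+-monoʳ-≤ b (ℕ.+-mono-≤ (s≤s (z≤n {b})) (s≤s (z≤n {b})))))))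
            (∣-respˡ (sym (trans (^-homo-* P B (B ℕ.+ B)) (*-congˡ (^-homo-* P B B))))
              (∣-respʳ (reflexive (≡.cong (λ n → y * (y * y ^ n)) (≡.sym q≡)))
                (∣-* B∣y (∣-* B∣y (∣-*ʳ (y ^ q′) B∣y)))))

        U^p^b : ∀ b → U ^ (p ℕ.^ suc b) ≡ 1# + P ^ suc b * M [ P ^ suc (suc b) ]
        U^p^b b = cases q ≡.refl
          where
          cases : ∀ r → q ≡ r → U ^ (p ℕ.^ suc b) ≡ 1# + P ^ suc b * M [ P ^ suc (suc b) ]
          cases (suc r) q≡ = U^p^b-odd q≡ b
          -- For p = 2 the truncation below degree p - 1 = 1 leaves U = 1, and the sum T is empty.
          cases zero    q≡ = ≈⇒≡ (trans (trans (^-congˡ (p ℕ.^ suc b) U≈1) (1^ (p ℕ.^ suc b)))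
            (sym (trans (+-congˡ (trans (*-congˡ (trans (*-congˡ T≈0) (zeroʳ _))) (zeroʳ _))) (+-identityʳ 1#))))
            where
            U≈1 : U ≈ 1#
            U≈1 = trans U≡1+ (trans (+-congˡ (trans (*-congˡ (reflexive (≡.cong (λ n → ev n (tl (tl invfact)) x) q≡))) (zeroʳ x))) (+-identityʳ 1#))
            T≈0 : T ≈ 0#
            T≈0 = reflexive (≡.cong (λ n → ev (n ∸ 1) (λ i → w (suc (suc i)) * inv (suc i)) x) q≡)

        -- First-order binomial expansion, named after Bernoulli's inequality; it has nothing to do
        -- with the Bernoulli numbers.
        bernoulli : ∀ n y → (1# + y) ^ n ≡ 1# + ⟦ n ⟧ * y [ y * y ]
        bernoulli zero    y = ≈⇒≡ (sym (trans (+-congˡ (zeroˡ y)) (+-identityʳ 1#)))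
        bernoulli (suc n) y = ≡-trans (≡-* (≈⇒≡ refl) (bernoulli n y)) (⟦ n ⟧ ,
          trans (trans (distribʳ _ 1# y) (+-congʳ (*-identityˡ _))) (trans (+-congˡ (trans (distribˡ y 1# _) (+-congʳ (*-identityʳ y))))
            (trans (solve 3 (λ o n y → (o :+ n :* y) :+ (y :+ y :* (n :* y)) := o :+ (y :+ n :* y) :+ y :* y :* n) refl 1# ⟦ n ⟧ y)
              (+-congʳ (+-congˡ (sym (trans (distribʳ y 1# ⟦ n ⟧) (+-congʳ (*-identityˡ y)))))))))

        -- The exponent of p is b + 1. First pV is discarded, then U^(p^(b+1)) ≡ 1 + p^(b+1)M is
        -- raised to the n-th power to first order, the square of p^(b+1)M being 0 modulo p^(b+2).
        -- Finally α^N and π^N join to x^N.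
        p-power-congruence : ∀ b n → let N = p ℕ.^ suc b ℕ.* n in
          (ζ ^ k + - 1#) ^ N ≡ x ^ N + ⟦ N ⟧ * (x ^ N * M) [ P ^ suc (suc b) * π ^ N ]
        p-power-congruence b n = ≡-weaken (∣-respˡ (*-comm _ _) ∣-refl) (≡-trans
          ([ζ^k-1]^n N (begin
            (α * U + P * V) ^ N                   ≈⟨ ≈⇒≡ (^-assocʳ _ B n) ⟨
            ((α * U + P * V) ^ B) ^ n             ≈⟨ ≡-^ n (lift-exponent (suc b) (αU+PV V)) ⟩
            ((α * U) ^ B) ^ n                     ≈⟨ ≈⇒≡ (trans (^-congˡ n (^-distrib-* α U B)) (trans (^-distrib-* _ _ n) (*-congʳ (^-assocʳ α B n)))) ⟩
            α ^ N * (U ^ B) ^ n                   ≈⟨ ≡-* (≈⇒≡ refl) (≡-^ n (U^p^b b)) ⟩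
            α ^ N * (1# + P ^ suc b * M) ^ n      ≈⟨ ≡-* (≈⇒≡ refl) (≡-weaken square (bernoulli n (P ^ suc b * M))) ⟩
            α ^ N * (1# + ⟦ n ⟧ * (P ^ suc b * M)) ∎))
          (≈⇒≡ (trans (trans (sym (*-assoc _ _ _)) (*-congʳ (trans (*-comm _ _) (sym (^-distrib-* α π N)))))
            (trans (distribˡ _ 1# _) (+-cong (*-identityʳ _) (trans
              (solve 4 (λ x n b m → x :* (n :* (b :* m)) := b :* n :* (x :* m)) refl _ _ _ _)
              (*-congʳ (sym (trans (×1-homo-* B n) (*-congʳ (⟦⟧-^ p (suc b))))))))))))
          where
          open SetoidReasoning (≡-setoid (P ^ suc (suc b)))
          B N : ℕ
          B = p ℕ.^ suc b
          N = B ℕ.* n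
          V = proj₁ ζ^k-1
          square : P ^ suc (suc b) ∣ P ^ suc b * M * (P ^ suc b * M)
          square = ∣-trans (∣-^-≤ P (s≤s (ℕ.m≤n+m (suc b) b)))
            (∣-respˡ (sym (^-homo-* P (suc b) (suc b))) (∣-* (∣-*ʳ M ∣-refl) (∣-*ʳ M ∣-refl)))

-- Fractions in ℚ

open import Defs

module ℚΣ = Summation (CommutativeRing.semiring ℚ.+-*-commutativeRing)

/1-homo-+ : ∀ i j → (i ℤ.+ j) / 1 ≡ (i / 1) ℚ.+ (j / 1)
/1-homo-+ i j = ℚ.toℚᵘ-injective (begin
  ℚ.toℚᵘ ((i ℤ.+ j) / 1)                     ≈⟨ ℚ.toℚᵘ-fromℚᵘ (ℚᵘ.mkℚᵘ (i ℤ.+ j) 0) ⟩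
  ℚᵘ.mkℚᵘ (i ℤ.+ j) 0                        ≈⟨ ℚᵘ.*≡* (solve 2 (λ i j → (i :+ j) :* con (+ 1)
                                                  := (i :* con (+ 1) :+ j :* con (+ 1)) :* con (+ 1)) ≡.refl i j) ⟩
  ℚᵘ.mkℚᵘ i 0 ℚᵘ.+ ℚᵘ.mkℚᵘ j 0               ≈⟨ ℚᵘ.+-cong (ℚ.toℚᵘ-fromℚᵘ (ℚᵘ.mkℚᵘ i 0)) (ℚ.toℚᵘ-fromℚᵘ (ℚᵘ.mkℚᵘ j 0)) ⟨
  ℚ.toℚᵘ (i / 1) ℚᵘ.+ ℚ.toℚᵘ (j / 1)         ≈⟨ ℚ.toℚᵘ-homo-+ (i / 1) (j / 1) ⟨
  ℚ.toℚᵘ ((i / 1) ℚ.+ (j / 1))               ∎)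
  where
  open SetoidReasoning ℚᵘ.≃-setoid
  open ℤ-Solver

/-* : ∀ i m j n .{{_ : NonZero m}} .{{_ : NonZero n}} .{{_ : NonZero (m ℕ.* n)}} →
      (i / m) ℚ.* (j / n) ≡ (i ℤ.* j) / (m ℕ.* n)
/-* i (suc m) j (suc n) = ℚ.toℚᵘ-injective (begin
  ℚ.toℚᵘ ((i / suc m) ℚ.* (j / suc n))          ≈⟨ ℚ.toℚᵘ-homo-* (i / suc m) (j / suc n) ⟩
  ℚ.toℚᵘ (i / suc m) ℚᵘ.* ℚ.toℚᵘ (j / suc n)    ≈⟨ ℚᵘ.*-cong (ℚ.toℚᵘ-fromℚᵘ (ℚᵘ.mkℚᵘ i m)) (ℚ.toℚᵘ-fromℚᵘ (ℚᵘ.mkℚᵘ j n)) ⟩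
  ℚᵘ.mkℚᵘ i m ℚᵘ.* ℚᵘ.mkℚᵘ j n                  ≈⟨ ℚ.toℚᵘ-fromℚᵘ (ℚᵘ.mkℚᵘ i m ℚᵘ.* ℚᵘ.mkℚᵘ j n) ⟨
  ℚ.toℚᵘ ((i ℤ.* j) / (suc m ℕ.* suc n))        ∎)
  where open SetoidReasoning ℚᵘ.≃-setoid

/-cancel : ∀ i n .{{_ : NonZero n}} → (i ℤ.* + n) / n ≡ i / 1
/-cancel i (suc n) = ℚ.fromℚᵘ-cong {ℚᵘ.mkℚᵘ (i ℤ.* + suc n) n} {ℚᵘ.mkℚᵘ i 0} (ℚᵘ.*≡* (ℤ.*-identityʳ (i ℤ.* + suc n)))

fromℕℚ-suc : ∀ n → fromℕℚ (suc n) ≡ 1ℚ ℚ.+ fromℕℚ n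
fromℕℚ-suc n = /1-homo-+ (+ 1) (+ n)

fromℕℚ-*-inverse : ∀ n → fromℕℚ (suc n) ℚ.* (+ 1 / suc n) ≡ 1ℚ
fromℕℚ-*-inverse n = ≡.trans (/-* (+ suc n) 1 (+ 1) (suc n) {{_}} {{_}} {{_}})
  (≡.trans (≡.cong (λ m → (+ suc n ℤ.* + 1) / suc m) (ℕ.+-identityʳ n))
    (≡.trans (≡.cong (_/ suc n) (ℤ.*-comm (+ suc n) (+ 1))) (/-cancel (+ 1) (suc n))))

-- Rationals with denominator prime to p, and linear systems over them

module Integrality {q : ℕ} (pr : Prime (suc (suc q))) where
  p : ℕ
  p = suc (suc q)

  record Integral (x : ℚ) : Set where
    constructor integral
    field p∤denominator : IsPIntegral p x
  open Integral public

  -- Fitted to the shape of `ℚ.↧-/`, `ℚ.↧-+` and `ℚ.↧-*`: reduced denominator times cancelled factor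
  -- `d` equals unreduced denominator.
  denominator-∣-product : ∀ {a b d n} → + a ℤ.* d ≡ + n → n ≡ b → a ℕ∣.∣ b
  denominator-∣-product {a} {d = d} e ≡.refl =
    divides ∣ d ∣ (≡.trans (≡.sym (≡.cong ∣_∣ e)) (≡.trans (ℤ.abs-* (+ a) d) (ℕ.*-comm a ∣ d ∣)))

  integral-/ : ∀ i n .{{_ : NonZero n}} → ¬ (p ℕ∣.∣ n) → Integral (i / n)
  integral-/ i n p∤n = integral λ p∣d → p∤n (ℕ∣.∣-trans p∣d (denominator-∣-product (ℚ.↧-/ i n) ≡.refl))

  private
    ∤-* : ∀ {m n} → ¬ (p ℕ∣.∣ m) → ¬ (p ℕ∣.∣ n) → ¬ (p ℕ∣.∣ m ℕ.* n)
    ∤-* {m} {n} p∤m p∤n d with euclidsLemma m n pr d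
    ... | inj₁ p∣m = p∤m p∣m
    ... | inj₂ p∣n = p∤n p∣n

  integral-+ : ∀ {x y} → Integral x → Integral y → Integral (x ℚ.+ y)
  integral-+ {x@record{}} {y@record{}} (integral ix) (integral iy) = integral λ p∣d →
    ∤-* ix iy (ℕ∣.∣-trans p∣d (denominator-∣-product (ℚ.↧-+ x y) ≡.refl))

  integral-* : ∀ {x y} → Integral x → Integral y → Integral (x ℚ.* y)
  integral-* {x@record{}} {y@record{}} (integral ix) (integral iy) = integral λ p∣d →
    ∤-* ix iy (ℕ∣.∣-trans p∣d (denominator-∣-product (ℚ.↧-* x y) ≡.refl))

  integral-neg : ∀ {x} → Integral x → Integral (ℚ.- x)
  integral-neg {x} (integral ix) = integral λ p∣d → ix (≡.subst (p ℕ∣.∣_) (ℤ.+-injective (ℚ.↧-neg x)) p∣d)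

  p∤1 : ¬ (p ℕ∣.∣ 1)
  p∤1 d with ℕ∣.∣⇒≤ d
  ... | s≤s ()

  p∤suc : ∀ k → suc k ℕ.< p → ¬ (p ℕ∣.∣ suc k)
  p∤suc k k<p d = ℕ.<⇒≱ k<p (ℕ∣.∣⇒≤ d)

  integral-/1 : ∀ i → Integral (i / 1)
  integral-/1 i = integral-/ i 1 p∤1

  integral-0 : Integral 0ℚ
  integral-0 = integral-/1 (+ 0)

  integral-1 : Integral 1ℚ
  integral-1 = integral-/1 (+ 1)

  integral-sum : ∀ {n} (t : Fin n → ℚ) → (∀ i → Integral (t i)) → Integral (ℚΣ.sum t)
  integral-sum {zero}  t it = integral-0
  integral-sum {suc n} t it = integral-+ (it Fin.zero) (integral-sum (λ i → t (Fin.suc i)) (λ i → it (Fin.suc i)))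

  P : ℚ
  P = fromℕℚ p

  -- For m = r/s one has 1 + pm = N/s with N = s + pr, and p does not divide N. The inverse s/N is
  -- written N·s/N², because N may be negative while a denominator has to be a positive natural
  -- number.
  integral-inverse : ∀ m → Integral m → ∃ λ d → Integral d Σ.× (1ℚ ℚ.+ P ℚ.* m) ℚ.* d ≡ 1ℚ
  integral-inverse m@(ℚ.mkℚ r s-1 _) (integral p∤s) = d , d-integral , (begin
    (1ℚ ℚ.+ P ℚ.* m) ℚ.* (N′ ℚ.* S ℚ.* i)    ≡⟨ solve 5 (λ p m n s i → (con 1ℚ :+ p :* m) :* (n :* s :* i)
                                                   := n :* (s :+ p :* (m :* s)) :* i) ≡.refl P m N′ S i ⟩
    N′ ℚ.* (S ℚ.+ P ℚ.* (m ℚ.* S)) ℚ.* i     ≡⟨ ≡.cong (λ y → N′ ℚ.* (S ℚ.+ P ℚ.* y) ℚ.* i) mS ⟩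
    N′ ℚ.* (S ℚ.+ P ℚ.* (r / 1)) ℚ.* i       ≡⟨ ≡.cong (λ y → N′ ℚ.* y ℚ.* i) N′≡ ⟨
    N′ ℚ.* N′ ℚ.* i                          ≡⟨ ≡.cong (ℚ._* i) N′N′ ⟩
    fromℕℚ (suc k) ℚ.* i                     ≡⟨ fromℕℚ-*-inverse k ⟩
    1ℚ                                       ∎)
    where
    open ≡.≡-Reasoning
    open ℚ-Solver
    s = suc s-1
    S = + s / 1
    N = + s ℤ.+ + p ℤ.* r
    N′ = N / 1
    p∤N : ¬ (p ℕ∣.∣ ∣ N ∣)
    p∤N p∣N = p∤s (ℤ∣.∣⇒∣ᵤ {+ p} {+ s} (ℤ∣.∣m+n∣n⇒∣m {+ p} {+ s} (ℤ∣.∣ᵤ⇒∣ p∣N) (ℤ∣.∣m⇒∣m*n {+ p} r ℤ∣.∣-refl)))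
    positive : ∀ n → ¬ (p ℕ∣.∣ n) → ∃ λ k → n ℕ.* n ≡ suc k
    positive zero    p∤0 = contradiction (p ℕ∣.∣0) p∤0
    positive (suc n) _   = _ , ≡.refl
    k = proj₁ (positive ∣ N ∣ p∤N)
    k-eq = proj₂ (positive ∣ N ∣ p∤N)
    i = + 1 / suc k
    d = N′ ℚ.* S ℚ.* i
    d-integral : Integral d
    d-integral = integral-* (integral-* (integral-/1 N) (integral-/1 (+ s)))
      (integral-/ (+ 1) (suc k) (≡.subst (λ n → ¬ (p ℕ∣.∣ n)) k-eq (∤-* p∤N p∤N)))
    mS : m ℚ.* S ≡ r / 1
    mS = ≡.trans (≡.cong (ℚ._* S) (≡.sym (ℚ.↥p/↧p≡p m))) (≡.trans (/-* r s (+ s) 1 {{_}} {{_}} {{_}})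
      (≡.trans (ℚ./-cong {r ℤ.* + s} {s ℕ.* 1} {r ℤ.* + s} {s} ≡.refl (ℕ.*-identityʳ s)) (/-cancel r s)))
    N′≡ : N′ ≡ S ℚ.+ P ℚ.* (r / 1)
    N′≡ = ≡.trans (/1-homo-+ (+ s) (+ p ℤ.* r)) (≡.cong (S ℚ.+_) (≡.sym (/-* (+ p) 1 r 1)))
    square : ∀ N → N ℤ.* N ≡ + (∣ N ∣ ℕ.* ∣ N ∣)
    square (+ n)    = ≡.sym (ℤ.pos-* n n)
    square -[1+ n ] = ≡.refl
    N′N′ : N′ ℚ.* N′ ≡ fromℕℚ (suc k)
    N′N′ = ≡.trans (/-* N 1 N 1) (≡.cong (_/ 1) (≡.trans (square N) (≡.cong +_ k-eq)))

  open ℚΣ using (sum)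

  sum-eliminate : ∀ {n} (f g u : Fin n → ℚ) c →
    sum (λ j → (f j ℚ.+ c ℚ.* g j) ℚ.* u j) ≡ sum (λ j → f j ℚ.* u j) ℚ.+ c ℚ.* sum (λ j → g j ℚ.* u j)
  sum-eliminate f g u c = ≡.trans
    (ℚΣ.sum-cong-≗ (λ j → ℚ-Solver.solve 4 (λ f c g u → (f :+ c :* g) :* u := f :* u :+ c :* (g :* u)) ≡.refl (f j) c (g j) (u j)))
    (≡.trans (ℚΣ.∑-distrib-+ (λ j → f j ℚ.* u j) (λ j → c ℚ.* (g j ℚ.* u j)))
      (≡.cong (sum (λ j → f j ℚ.* u j) ℚ.+_) (≡.sym (ℚΣ.*-distribˡ-sum c (λ j → g j ℚ.* u j)))))
    where open ℚ-Solver

  -- Gaussian elimination: every pivot is ≡ 1 mod p.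
  solve-1+pM : ∀ n (M : Fin n → Fin n → ℚ) (e : Fin n → ℚ) →
    (∀ i j → Integral (M i j)) → (∀ i → Integral (e i)) →
    ∃ λ (u : Fin n → ℚ) → (∀ i → Integral (u i)) Σ.× (∀ i → u i ℚ.+ P ℚ.* sum (λ j → M i j ℚ.* u j) ≡ e i)
  solve-1+pM zero    M e iM ie = (λ ()) , (λ ()) , λ ()
  solve-1+pM (suc n) M e iM ie = u , u-integral , u-solves
    where
    open ≡.≡-Reasoning
    open ℚ-Solver
    pivot = integral-inverse (M Fin.zero Fin.zero) (iM Fin.zero Fin.zero)
    d = proj₁ pivot
    id = proj₁ (proj₂ pivot)
    c : Fin n → ℚ
    c i = ℚ.- (P ℚ.* M (Fin.suc i) Fin.zero ℚ.* d)
    ic : ∀ i → Integral (c i)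
    ic i = integral-neg (integral-* (integral-* (integral-/1 (+ p)) (iM (Fin.suc i) Fin.zero)) id)
    M₀ : Fin n → ℚ
    M₀ j = M Fin.zero (Fin.suc j)
    reduced = solve-1+pM n
      (λ i j → M (Fin.suc i) (Fin.suc j) ℚ.+ c i ℚ.* M₀ j)
      (λ i → e (Fin.suc i) ℚ.+ c i ℚ.* e Fin.zero)
      (λ i j → integral-+ (iM (Fin.suc i) (Fin.suc j)) (integral-* (ic i) (iM Fin.zero (Fin.suc j))))
      (λ i → integral-+ (ie (Fin.suc i)) (integral-* (ic i) (ie Fin.zero)))
    v = proj₁ reduced
    iv = proj₁ (proj₂ reduced)
    s₀ : ℚ
    s₀ = sum (λ j → M₀ j ℚ.* v j)
    u₀ : ℚ
    u₀ = d ℚ.* (e Fin.zero ℚ.+ ℚ.- (P ℚ.* s₀))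
    u : Fin (suc n) → ℚ
    u Fin.zero    = u₀
    u (Fin.suc i) = v i
    u-integral : ∀ i → Integral (u i)
    u-integral Fin.zero    = integral-* id (integral-+ (ie Fin.zero) (integral-neg (integral-* (integral-/1 (+ p))
      (integral-sum _ (λ j → integral-* (iM Fin.zero (Fin.suc j)) (iv j))))))
    u-integral (Fin.suc i) = iv i
    u-solves : ∀ i → u i ℚ.+ P ℚ.* sum (λ j → M i j ℚ.* u j) ≡ e i
    u-solves Fin.zero = begin
      u₀ ℚ.+ P ℚ.* (m ℚ.* u₀ ℚ.+ s₀)
        ≡⟨ solve 5 (λ p m d e s → d :* (e :+ :- (p :* s)) :+ p :* (m :* (d :* (e :+ :- (p :* s))) :+ s)
             := ((con 1ℚ :+ p :* m) :* d) :* (e :+ :- (p :* s)) :+ p :* s) ≡.refl P m d (e Fin.zero) s₀ ⟩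
      (1ℚ ℚ.+ P ℚ.* m) ℚ.* d ℚ.* (e Fin.zero ℚ.+ ℚ.- (P ℚ.* s₀)) ℚ.+ P ℚ.* s₀
        ≡⟨ ≡.cong (λ y → y ℚ.* (e Fin.zero ℚ.+ ℚ.- (P ℚ.* s₀)) ℚ.+ P ℚ.* s₀) (proj₂ (proj₂ pivot)) ⟩
      1ℚ ℚ.* (e Fin.zero ℚ.+ ℚ.- (P ℚ.* s₀)) ℚ.+ P ℚ.* s₀
        ≡⟨ solve 2 (λ e s → con 1ℚ :* (e :+ :- s) :+ s := e) ≡.refl (e Fin.zero) (P ℚ.* s₀) ⟩
      e Fin.zero ∎
      where m = M Fin.zero Fin.zero
    u-solves (Fin.suc i) = begin
      v i ℚ.+ P ℚ.* (m ℚ.* u₀ ℚ.+ t)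
        ≡⟨ solve 7 (λ v p m d e s t → v :+ p :* (m :* (d :* (e :+ :- (p :* s))) :+ t)
             := (v :+ p :* (t :+ :- (p :* m :* d) :* s)) :+ (p :* m :* d) :* e) ≡.refl (v i) P m d (e Fin.zero) s₀ t ⟩
      v i ℚ.+ P ℚ.* (t ℚ.+ c i ℚ.* s₀) ℚ.+ P ℚ.* m ℚ.* d ℚ.* e Fin.zero
        ≡⟨ ≡.cong (λ y → v i ℚ.+ P ℚ.* y ℚ.+ P ℚ.* m ℚ.* d ℚ.* e Fin.zero)
             (sum-eliminate (λ j → M (Fin.suc i) (Fin.suc j)) M₀ v (c i)) ⟨
      v i ℚ.+ P ℚ.* sum (λ j → (M (Fin.suc i) (Fin.suc j) ℚ.+ c i ℚ.* M₀ j) ℚ.* v j) ℚ.+ P ℚ.* m ℚ.* d ℚ.* e Fin.zero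
        ≡⟨ ≡.cong (ℚ._+ P ℚ.* m ℚ.* d ℚ.* e Fin.zero) (proj₂ (proj₂ reduced) i) ⟩
      e (Fin.suc i) ℚ.+ c i ℚ.* e Fin.zero ℚ.+ P ℚ.* m ℚ.* d ℚ.* e Fin.zero
        ≡⟨ solve 3 (λ x a e → x :+ :- a :* e :+ a :* e := x) ≡.refl (e (Fin.suc i)) (P ℚ.* m ℚ.* d) (e Fin.zero) ⟩
      e (Fin.suc i) ∎
      where
      m = M (Fin.suc i) Fin.zero
      t = sum (λ j → M (Fin.suc i) (Fin.suc j) ℚ.* v j)

sumℚ-allFin : ∀ n (f : Fin n → ℚ) → sumℚ (map f (allFin n)) ≡ ℚΣ.sum f
sumℚ-allFin n f = ≡.trans (≡.cong sumℚ (map-tabulate (λ i → i) f)) (sumℚ-tabulate n f)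
  where
  sumℚ-tabulate : ∀ n (f : Fin n → ℚ) → sumℚ (tabulate f) ≡ ℚΣ.sum f
  sumℚ-tabulate zero    f = ≡.refl
  sumℚ-tabulate (suc n) f = ≡.cong (f Fin.zero ℚ.+_) (sumℚ-tabulate n (λ i → f (Fin.suc i)))

-- The group algebra of the cyclic group, modulo constant vectors

module CyclicGroupAlgebra (q : ℕ) where
  private
    p : ℕ
    p = suc (suc q)

  open ℚΣ using (sum)

  infix 4 _~_ _≋_

  record _~_ (m n : ℕ) : Set where
    constructor congruent
    field residues : m % p ≡ n % p
  open _~_ public

  ~-trans : ∀ {a b c} → a ~ b → b ~ c → a ~ c
  ~-trans (congruent e) (congruent e′) = congruent (≡.trans e e′)

  ~-sym : ∀ {a b} → a ~ b → b ~ a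
  ~-sym (congruent e) = congruent (≡.sym e)

  ≡⇒~ : ∀ {a b} → a ≡ b → a ~ b
  ≡⇒~ e = congruent (≡.cong (_% p) e)

  ~-+ : ∀ {a b} c → a ~ b → a ℕ.+ c ~ b ℕ.+ c
  ~-+ {a} {b} c (congruent e) = congruent (≡.trans (%-distribˡ-+ a c p)
    (≡.trans (≡.cong (λ u → (u ℕ.+ c % p) % p) e) (≡.sym (%-distribˡ-+ b c p))))

  toℕ-idx : ∀ n → toℕ (idx {p} n) ≡ n % p
  toℕ-idx n = Fin.toℕ-fromℕ< _

  toℕ-idx-~ : ∀ n → toℕ (idx {p} n) ~ n
  toℕ-idx-~ n = congruent (≡.trans (≡.cong (_% p) (toℕ-idx n)) (m%n%n≡m%n n p))

  idx-cong : ∀ {m n} → m ~ n → idx {p} m ≡ idx n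
  idx-cong {m} {n} (congruent e) = Fin.toℕ-injective (≡.trans (toℕ-idx m) (≡.trans e (≡.sym (toℕ-idx n))))

  idx-toℕ : ∀ (i : Fin p) → idx (toℕ i) ≡ i
  idx-toℕ i = Fin.toℕ-injective (≡.trans (toℕ-idx (toℕ i)) (m<n⇒m%n≡m (Fin.toℕ<n i)))

  -- The difference i - j in ℤ/p, spelled as in the convolution `_⊗_`.
  sub : Fin p → Fin p → Fin p
  sub i j = idx (toℕ i ℕ.+ (p ∸ toℕ j))

  +-∸-~ : ∀ n (j : Fin p) → n ℕ.+ toℕ j ℕ.+ (p ∸ toℕ j) ~ n
  +-∸-~ n j = ~-trans (≡⇒~ (≡.trans (ℕ.+-assoc n (toℕ j) (p ∸ toℕ j))
    (≡.cong (n ℕ.+_) (ℕ.m+[n∸m]≡n (ℕ.<⇒≤ (Fin.toℕ<n j)))))) (congruent ([m+n]%n≡m%n n p))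

  sub-+ : ∀ i j → toℕ (sub i j) ℕ.+ toℕ j ~ toℕ i
  sub-+ i j = ~-trans (~-+ (toℕ j) (toℕ-idx-~ (toℕ i ℕ.+ (p ∸ toℕ j))))
    (~-trans (≡⇒~ (≡.trans (ℕ.+-assoc (toℕ i) _ _) (≡.trans (≡.cong (toℕ i ℕ.+_) (ℕ.+-comm (p ∸ toℕ j) (toℕ j)))
      (≡.sym (ℕ.+-assoc (toℕ i) _ _))))) (+-∸-~ (toℕ i) j))

  -- Together with `sub-+` this characterises differences, so that identities between them follow
  -- without computing any residue.
  sub-unique : ∀ i j c → toℕ c ℕ.+ toℕ j ~ toℕ i → c ≡ sub i j
  sub-unique i j c e = ≡.trans (≡.sym (idx-toℕ c)) (idx-cong (~-trans (~-sym (+-∸-~ (toℕ c) j)) (~-+ (p ∸ toℕ j) e)))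

  sub-involutive : ∀ i j → sub i (sub i j) ≡ j
  sub-involutive i j = ≡.sym (sub-unique i (sub i j) j
    (~-trans (≡⇒~ (ℕ.+-comm (toℕ j) (toℕ (sub i j)))) (sub-+ i j)))

  sub-sub : ∀ i j k → sub (sub i k) (sub j k) ≡ sub i j
  sub-sub i j k = sub-unique i j c (~-trans
    (~-trans (≡⇒~ (ℕ.+-comm (toℕ c) (toℕ j))) (~-+ (toℕ c) (~-sym (sub-+ j k))))
    (~-trans (≡⇒~ (+-*-Solver.solve 3 (λ d k c → d :+ k :+ c := c :+ d :+ k) ≡.refl (toℕ (sub j k)) (toℕ k) (toℕ c)))
      (~-trans (~-+ (toℕ k) (sub-+ (sub i k) (sub j k))) (sub-+ i k))))
    where
    open +-*-Solver
    c = sub (sub i k) (sub j k)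

  sub-0 : ∀ i → sub i Fin.zero ≡ i
  sub-0 i = ≡.sym (sub-unique i Fin.zero i (≡⇒~ (ℕ.+-identityʳ (toℕ i))))

  -- The reindexing that swaps the two factors of a convolution.
  reflection : Fin p → Permutation p p
  reflection i = permutation (sub i) (sub i) (sub-involutive i) (sub-involutive i)

  -- The reindexing of the inner sum in the associativity of convolution.
  translation : Fin p → Permutation p p
  translation k = permutation (λ j → sub j k) (λ l → idx (toℕ l ℕ.+ toℕ k))
    (λ l → ≡.sym (sub-unique (idx (toℕ l ℕ.+ toℕ k)) k l (~-sym (toℕ-idx-~ (toℕ l ℕ.+ toℕ k)))))
    (λ j → ≡.trans (idx-cong (sub-+ j k)) (idx-toℕ j))

  ⊗-sum : ∀ (x y : Cyc p) i → (x ⊗ y) i ≡ sum (λ j → x j ℚ.* y (sub i j))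
  ⊗-sum x y i = sumℚ-allFin p (λ j → x j ℚ.* y (sub i j))

  ⊗-comm : ∀ (x y : Cyc p) i → (x ⊗ y) i ≡ (y ⊗ x) i
  ⊗-comm x y i = begin
    (x ⊗ y) i                                        ≡⟨ ⊗-sum x y i ⟩
    sum (λ j → x j ℚ.* y (sub i j))                  ≡⟨ ℚΣ.sum-permute (λ j → x j ℚ.* y (sub i j)) (reflection i) ⟩
    sum (λ j → x (sub i j) ℚ.* y (sub i (sub i j)))  ≡⟨ ℚΣ.sum-cong-≗ (λ j → ≡.trans (≡.cong (λ k → x (sub i j) ℚ.* y k) (sub-involutive i j)) (ℚ.*-comm (x (sub i j)) (y j))) ⟩
    sum (λ j → y j ℚ.* x (sub i j))                  ≡⟨ ⊗-sum y x i ⟨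
    (y ⊗ x) i                                        ∎
    where open ≡.≡-Reasoning

  ⊗-assoc : ∀ (x y z : Cyc p) i → ((x ⊗ y) ⊗ z) i ≡ (x ⊗ (y ⊗ z)) i
  ⊗-assoc x y z i = begin
    ((x ⊗ y) ⊗ z) i
      ≡⟨ ⊗-sum (x ⊗ y) z i ⟩
    sum (λ j → (x ⊗ y) j ℚ.* z (sub i j))
      ≡⟨ ℚΣ.sum-cong-≗ (λ j → ≡.trans (≡.cong (ℚ._* z (sub i j)) (⊗-sum x y j))
           (ℚΣ.*-distribʳ-sum (z (sub i j)) (λ k → x k ℚ.* y (sub j k)))) ⟩
    sum (λ j → sum (λ k → x k ℚ.* y (sub j k) ℚ.* z (sub i j)))
      ≡⟨ ℚΣ.∑-comm (λ j k → x k ℚ.* y (sub j k) ℚ.* z (sub i j)) ⟩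
    sum (λ k → sum (λ j → x k ℚ.* y (sub j k) ℚ.* z (sub i j)))
      ≡⟨ ℚΣ.sum-cong-≗ (λ k → ≡.trans
           (ℚΣ.sum-cong-≗ (λ j → ≡.trans (≡.cong (λ l → x k ℚ.* y (sub j k) ℚ.* z l) (≡.sym (sub-sub i j k))) (ℚ.*-assoc (x k) _ _)))
           (≡.trans (≡.sym (ℚΣ.*-distribˡ-sum (x k) (λ j → y (sub j k) ℚ.* z (sub (sub i k) (sub j k)))))
             (≡.cong (x k ℚ.*_) (≡.sym (ℚΣ.sum-permute (λ l → y l ℚ.* z (sub (sub i k) l)) (translation k)))))) ⟩
    sum (λ k → x k ℚ.* sum (λ l → y l ℚ.* z (sub (sub i k) l)))
      ≡⟨ ℚΣ.sum-cong-≗ (λ k → ≡.cong (x k ℚ.*_) (≡.sym (⊗-sum y z (sub i k)))) ⟩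
    sum (λ k → x k ℚ.* (y ⊗ z) (sub i k))
      ≡⟨ ⊗-sum x (y ⊗ z) i ⟨
    (x ⊗ (y ⊗ z)) i ∎
    where open ≡.≡-Reasoning

  ⊗-distribʳ : ∀ (z x y : Cyc p) i → ((x ⊕ y) ⊗ z) i ≡ ((x ⊗ z) ⊕ (y ⊗ z)) i
  ⊗-distribʳ z x y i = begin
    ((x ⊕ y) ⊗ z) i
      ≡⟨ ⊗-sum (x ⊕ y) z i ⟩
    sum (λ j → (x j ℚ.+ y j) ℚ.* z (sub i j))
      ≡⟨ ℚΣ.sum-cong-≗ (λ j → ℚ.*-distribʳ-+ (z (sub i j)) (x j) (y j)) ⟩
    sum (λ j → x j ℚ.* z (sub i j) ℚ.+ y j ℚ.* z (sub i j))
      ≡⟨ ℚΣ.∑-distrib-+ (λ j → x j ℚ.* z (sub i j)) (λ j → y j ℚ.* z (sub i j)) ⟩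
    sum (λ j → x j ℚ.* z (sub i j)) ℚ.+ sum (λ j → y j ℚ.* z (sub i j))
      ≡⟨ ≡.cong₂ ℚ._+_ (⊗-sum x z i) (⊗-sum y z i) ⟨
    ((x ⊗ z) ⊕ (y ⊗ z)) i ∎
    where open ≡.≡-Reasoning

  ι-⊗ : ∀ a (x : Cyc p) i → (ι a ⊗ x) i ≡ a ℚ.* x i
  ι-⊗ a x i = begin
    (ι a ⊗ x) i
      ≡⟨ ⊗-sum (ι a) x i ⟩
    a ℚ.* x (sub i Fin.zero) ℚ.+ sum {suc q} (λ j → 0ℚ ℚ.* x (sub i (Fin.suc j)))
      ≡⟨ ≡.cong₂ ℚ._+_ (≡.cong (λ k → a ℚ.* x k) (sub-0 i))
           (≡.trans (≡.sym (ℚΣ.*-distribˡ-sum 0ℚ (λ j → x (sub i (Fin.suc j))))) (ℚ.*-zeroˡ (sum (λ j → x (sub i (Fin.suc j)))))) ⟩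
    a ℚ.* x i ℚ.+ 0ℚ
      ≡⟨ ℚ.+-identityʳ _ ⟩
    a ℚ.* x i ∎
    where open ≡.≡-Reasoning

  -- Equality in ℚ(ζ_p), the constant vectors being the multiples of 1 + ζ + ... + ζ^(p-1). The
  -- constant is kept as data, to be tracked through sums and products.
  record _≋_ (x y : Cyc p) : Set where
    constructor shift
    field
      offset : ℚ
      shifts : ∀ i → x i ≡ y i ℚ.+ offset
  open _≋_ public

  ≗⇒≋ : ∀ {x y} → (∀ i → x i ≡ y i) → x ≋ y
  ≗⇒≋ {x} {y} e = shift 0ℚ λ i → ≡.trans (e i) (≡.sym (ℚ.+-identityʳ (y i)))

  ≋-refl : ∀ {x} → x ≋ x
  ≋-refl = ≗⇒≋ λ _ → ≡.refl

  ≋-sym : ∀ {x y} → x ≋ y → y ≋ x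
  ≋-sym {x} {y} (shift c e) = shift (ℚ.- c) λ i → ≡.trans
    (ℚ-Solver.solve 2 (λ y c → y := y :+ c :+ :- c) ≡.refl (y i) c) (≡.cong (ℚ._+ ℚ.- c) (≡.sym (e i)))
    where open ℚ-Solver

  ≋-trans : ∀ {x y z} → x ≋ y → y ≋ z → x ≋ z
  ≋-trans {x} {y} {z} (shift c e) (shift d e′) = shift (d ℚ.+ c) λ i →
    ≡.trans (e i) (≡.trans (≡.cong (ℚ._+ c) (e′ i)) (ℚ.+-assoc (z i) d c))

  ⊕-cong : ∀ {x y u v} → x ≋ y → u ≋ v → x ⊕ u ≋ y ⊕ v
  ⊕-cong {x} {y} {u} {v} (shift c e) (shift d e′) = shift (c ℚ.+ d) λ i → ≡.trans (≡.cong₂ ℚ._+_ (e i) (e′ i))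
    (ℚ-Solver.solve 4 (λ y c v d → (y :+ c) :+ (v :+ d) := y :+ v :+ (c :+ d)) ≡.refl (y i) c (v i) d)
    where open ℚ-Solver

  ⊖-cong : ∀ {x y} → x ≋ y → ⊖ x ≋ ⊖ y
  ⊖-cong {x} {y} (shift c e) = shift (ℚ.- c) λ i → ≡.trans (≡.cong ℚ.-_ (e i)) (ℚ.neg-distrib-+ (y i) c)

  -- Constant vectors form an ideal: x times the constant c is the constant (sum of x)·c.
  ⊗-congˡ : ∀ x {y z} → y ≋ z → x ⊗ y ≋ x ⊗ z
  ⊗-congˡ x {y} {z} (shift c e) = shift (sum x ℚ.* c) λ i → begin
    (x ⊗ y) i
      ≡⟨ ⊗-sum x y i ⟩
    sum (λ j → x j ℚ.* y (sub i j))
      ≡⟨ ℚΣ.sum-cong-≗ (λ j → ≡.trans (≡.cong (x j ℚ.*_) (e (sub i j))) (ℚ.*-distribˡ-+ (x j) (z (sub i j)) c)) ⟩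
    sum (λ j → x j ℚ.* z (sub i j) ℚ.+ x j ℚ.* c)
      ≡⟨ ℚΣ.∑-distrib-+ (λ j → x j ℚ.* z (sub i j)) (λ j → x j ℚ.* c) ⟩
    sum (λ j → x j ℚ.* z (sub i j)) ℚ.+ sum (λ j → x j ℚ.* c)
      ≡⟨ ≡.cong₂ ℚ._+_ (⊗-sum x z i) (ℚΣ.*-distribʳ-sum c x) ⟨
    (x ⊗ z) i ℚ.+ sum x ℚ.* c ∎
    where open ≡.≡-Reasoning

  ⊗-cong : ∀ {x y u v} → x ≋ y → u ≋ v → x ⊗ u ≋ y ⊗ v
  ⊗-cong {x} {y} {u} {v} e e′ = ≋-trans (⊗-congˡ x e′) (≋-trans (≗⇒≋ (⊗-comm x v))
    (≋-trans (⊗-congˡ v e) (≗⇒≋ (⊗-comm v y))))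

-- The ring ℤ_(p)[ζ] and its uniformizer 1 - ζ

module Localization {q : ℕ} (pr : Prime (suc (suc q))) where
  open Integrality pr
  open CyclicGroupAlgebra q

  -- Integrality is demanded of the chosen representative in ℚ[C_p], exactly as for δ in the
  -- definition of the congruence; the quotient by constants is left to `_≈ᴱ_`.
  record Element : Set where
    no-eta-equality
    constructor element
    field
      coefficients : Cyc p
      integrality  : ∀ i → Integral (coefficients i)
  open Element public

  infix 4 _≈ᴱ_

  record _≈ᴱ_ (x y : Element) : Set where
    constructor ≋⇒≈
    field ≈⇒≋ : coefficients x ≋ coefficients y
  open _≈ᴱ_ public

  ≗⇒≈ : ∀ {x y} → (∀ i → coefficients x i ≡ coefficients y i) → x ≈ᴱ y
  ≗⇒≈ e = ≋⇒≈ (≗⇒≋ e)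

  ⊗-integral : ∀ {x y : Cyc p} → (∀ i → Integral (x i)) → (∀ i → Integral (y i)) → ∀ i → Integral ((x ⊗ y) i)
  ⊗-integral {x} {y} ix iy i = ≡.subst Integral (≡.sym (⊗-sum x y i))
    (integral-sum _ (λ j → integral-* (ix j) (iy (sub i j))))

  ι-integral : ∀ {a} → Integral a → ∀ (i : Fin p) → Integral (ι a i)
  ι-integral ia Fin.zero    = ia
  ι-integral ia (Fin.suc _) = integral-0

  ι-⊕ : ∀ a b (i : Fin p) → ι (a ℚ.+ b) i ≡ (ι a ⊕ ι b) i
  ι-⊕ a b Fin.zero    = ≡.refl
  ι-⊕ a b (Fin.suc _) = ≡.refl

  ι-* : ∀ a b (i : Fin p) → ι (a ℚ.* b) i ≡ (ι a ⊗ ι b) i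
  ι-* a b i = ≡.trans (scale i) (≡.sym (ι-⊗ a (ι b) i))
    where
    scale : ∀ (i : Fin p) → ι (a ℚ.* b) i ≡ a ℚ.* ι b i
    scale Fin.zero    = ≡.refl
    scale (Fin.suc _) = ≡.sym (ℚ.*-zeroʳ a)

  ι-neg : ∀ a (i : Fin p) → ι (ℚ.- a) i ≡ (⊖ ι a) i
  ι-neg a Fin.zero    = ≡.refl
  ι-neg a (Fin.suc _) = ≡.refl

  infixl 6 _+ᴱ_
  infixl 7 _*ᴱ_

  _+ᴱ_ _*ᴱ_ : Element → Element → Element
  (x +ᴱ y) .coefficients  = coefficients x ⊕ coefficients y
  (x +ᴱ y) .integrality i = integral-+ (integrality x i) (integrality y i)
  (x *ᴱ y) .coefficients  = coefficients x ⊗ coefficients y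
  (x *ᴱ y) .integrality   = ⊗-integral (integrality x) (integrality y)

  -ᴱ_ : Element → Element
  (-ᴱ x) .coefficients  = ⊖ coefficients x
  (-ᴱ x) .integrality i = integral-neg (integrality x i)

  0ᴱ 1ᴱ : Element
  0ᴱ = element (ι 0ℚ) (ι-integral integral-0)
  1ᴱ = element 𝟙 (ι-integral integral-1)

  localization : CommutativeRing 0ℓ 0ℓ
  localization = record
    { Carrier = Element
    ; _≈_ = _≈ᴱ_
    ; _+_ = _+ᴱ_
    ; _*_ = _*ᴱ_
    ; -_ = -ᴱ_
    ; 0# = 0ᴱ
    ; 1# = 1ᴱ
    ; isCommutativeRing = record
      { isRing = record
        { +-isAbelianGroup = record
          { isGroup = record
            { isMonoid = record
              { isSemigroup = record
                { isMagma = record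
                  { isEquivalence = record
                    { refl = ≋⇒≈ ≋-refl
                    ; sym = λ e → ≋⇒≈ (≋-sym (≈⇒≋ e))
                    ; trans = λ e e′ → ≋⇒≈ (≋-trans (≈⇒≋ e) (≈⇒≋ e′)) }
                  ; ∙-cong = λ e e′ → ≋⇒≈ (⊕-cong (≈⇒≋ e) (≈⇒≋ e′)) }
                ; assoc = λ x y z → ≗⇒≈ λ i → ℚ.+-assoc (x ⟨ i ⟩) (y ⟨ i ⟩) (z ⟨ i ⟩) }
              ; identity = (λ x → ≗⇒≈ λ i → ≡.trans (≡.cong (ℚ._+ x ⟨ i ⟩) (zeros i)) (ℚ.+-identityˡ (x ⟨ i ⟩)))
                         , (λ x → ≗⇒≈ λ i → ≡.trans (≡.cong (x ⟨ i ⟩ ℚ.+_) (zeros i)) (ℚ.+-identityʳ (x ⟨ i ⟩))) }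
            ; inverse = (λ x → ≗⇒≈ λ i → ≡.trans (ℚ.+-inverseˡ (x ⟨ i ⟩)) (≡.sym (zeros i)))
                      , (λ x → ≗⇒≈ λ i → ≡.trans (ℚ.+-inverseʳ (x ⟨ i ⟩)) (≡.sym (zeros i)))
            ; ⁻¹-cong = λ e → ≋⇒≈ (⊖-cong (≈⇒≋ e)) }
          ; comm = λ x y → ≗⇒≈ λ i → ℚ.+-comm (x ⟨ i ⟩) (y ⟨ i ⟩) }
        ; *-cong = λ e e′ → ≋⇒≈ (⊗-cong (≈⇒≋ e) (≈⇒≋ e′))
        ; *-assoc = λ x y z → ≗⇒≈ (⊗-assoc (coefficients x) (coefficients y) (coefficients z))
        ; *-identity = (λ x → ≗⇒≈ (one (coefficients x)))
                     , (λ x → ≗⇒≈ λ i → ≡.trans (⊗-comm (coefficients x) 𝟙 i) (one (coefficients x) i))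
        ; distrib = (λ x y z → ≗⇒≈ (left-distrib (coefficients x) (coefficients y) (coefficients z)))
                  , (λ x y z → ≗⇒≈ (⊗-distribʳ (coefficients x) (coefficients y) (coefficients z))) }
      ; *-comm = λ x y → ≗⇒≈ (⊗-comm (coefficients x) (coefficients y)) }
    }
    where
    infix 8 _⟨_⟩
    _⟨_⟩ : Element → Fin p → ℚ
    x ⟨ i ⟩ = coefficients x i
    left-distrib : ∀ (x y z : Cyc p) i → (x ⊗ (y ⊕ z)) i ≡ ((x ⊗ y) ⊕ (x ⊗ z)) i
    left-distrib x y z i = ≡.trans (⊗-comm x (y ⊕ z) i)
      (≡.trans (⊗-distribʳ x y z i) (≡.cong₂ ℚ._+_ (⊗-comm y x i) (⊗-comm z x i)))
    zeros : ∀ (i : Fin p) → ι 0ℚ i ≡ 0ℚ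
    zeros Fin.zero    = ≡.refl
    zeros (Fin.suc _) = ≡.refl
    one : ∀ (x : Cyc p) i → (𝟙 ⊗ x) i ≡ x i
    one x i = ≡.trans (ι-⊗ 1ℚ x i) (ℚ.*-identityˡ (x i))

  module R where
    private module S = CommutativeRing localization
    open S public
    open Exponentiation S.commutativeSemiring public
    open Naturals localization public using (⟦_⟧)

  open R using (1#; 0#; ⟦_⟧; _≈_)

  infix 4 _⊳_ _≋ι_

  -- The bridge from the vectors in the theorem, which carry no proof of integrality, to elements of
  -- the ring.
  record _⊳_ (y : Cyc p) (x : Element) : Set where
    constructor represents
    field represented : y ≋ coefficients x
  open _⊳_ public

  record _≋ι_ (x : Element) (a : ℚ) : Set where
    constructor scalar
    field scalar-≋ : coefficients x ≋ ι a
  open _≋ι_ public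

  ≋ι-* : ∀ {x y a b} → x ≋ι a → y ≋ι b → x *ᴱ y ≋ι a ℚ.* b
  ≋ι-* {a = a} {b} (scalar e) (scalar e′) = scalar (≋-trans (⊗-cong e e′) (≋-sym (≗⇒≋ (ι-* a b))))

  ≋ι-+ : ∀ {x y a b} → x ≋ι a → y ≋ι b → x +ᴱ y ≋ι a ℚ.+ b
  ≋ι-+ {a = a} {b} (scalar e) (scalar e′) = scalar (≋-trans (⊕-cong e e′) (≋-sym (≗⇒≋ (ι-⊕ a b))))

  ≋ι-≡ : ∀ {x a b} → x ≋ι a → a ≡ b → x ≋ι b
  ≋ι-≡ e ≡.refl = e

  ≋ι-unique : ∀ {x y a} → x ≋ι a → y ≋ι a → x ≈ y
  ≋ι-unique (scalar e) (scalar e′) = ≋⇒≈ (≋-trans e (≋-sym e′))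

  -- Sends non-integral rationals to 0.
  embed : ℚ → Element
  embed x with p ℕ∣.∣? ℚ.denominatorℕ x
  ... | yes _   = 0#
  ... | no  p∤d = element (ι x) (ι-integral (integral p∤d))

  embed-ι : ∀ {x} → Integral x → embed x ≋ι x
  embed-ι {x} (integral p∤d) with p ℕ∣.∣? ℚ.denominatorℕ x
  ... | yes p∣d = contradiction p∣d p∤d
  ... | no  _   = scalar ≋-refl

  1-ι : 1# ≋ι 1ℚ
  1-ι = scalar ≋-refl

  ⟦⟧-ι : ∀ n → ⟦ n ⟧ ≋ι fromℕℚ n
  ⟦⟧-ι zero    = scalar ≋-refl
  ⟦⟧-ι (suc n) = ≋ι-≡ (≋ι-+ 1-ι (⟦⟧-ι n)) (≡.sym (fromℕℚ-suc n))

  inv : ℕ → Element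
  inv k = embed (+ 1 / suc k)

  integral-1/suc : ∀ k → suc k ℕ.< p → Integral (+ 1 / suc k)
  integral-1/suc k k<p = integral-/ (+ 1) (suc k) (p∤suc k k<p)

  inv-eq : ∀ k → suc k ℕ.< p → ⟦ suc k ⟧ R.* inv k ≈ 1#
  inv-eq k k<p = ≋ι-unique (≋ι-≡ (≋ι-* (⟦⟧-ι (suc k)) (embed-ι (integral-1/suc k k<p))) (fromℕℚ-*-inverse k)) 1-ι

  -- Multiplication by v is the circulant matrix with entries x(i - j), so inverting 1 + pv means
  -- solving a linear system with matrix 1 + pM and right-hand side `𝟙`. The solution inverts 1 + pv
  -- already in the group algebra.
  unit : ∀ v → ∃ λ u → (1# R.+ ⟦ p ⟧ R.* v) R.* u ≈ 1#
  unit v = u , (begin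
    (1# R.+ ⟦ p ⟧ R.* v) R.* u      ≈⟨ R.distribʳ u 1# (⟦ p ⟧ R.* v) ⟩
    1# R.* u R.+ ⟦ p ⟧ R.* v R.* u  ≈⟨ R.+-cong (R.*-identityˡ u) (R.*-assoc ⟦ p ⟧ v u) ⟩
    u R.+ ⟦ p ⟧ R.* (v R.* u)       ≈⟨ R.+-congˡ (R.*-cong (≋ι-unique (⟦⟧-ι p) P-ι) (R.*-comm v u)) ⟩
    u R.+ Pᴱ R.* (u R.* v)          ≈⟨ ≗⇒≈ solves ⟩
    1#                              ∎)
    where
    open SetoidReasoning R.setoid
    x : Cyc p
    x = coefficients v
    Pᴱ : Element
    Pᴱ = element (ι P) (ι-integral (integral-/1 (+ p)))
    P-ι : Pᴱ ≋ι P
    P-ι = scalar ≋-refl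
    solution = solve-1+pM p (λ i j → x (sub i j)) 𝟙 (λ i j → integrality v (sub i j)) (ι-integral integral-1)
    y = proj₁ solution
    u : Element
    u = element y (proj₁ (proj₂ solution))
    solves : ∀ i → (y ⊕ ι P ⊗ (y ⊗ x)) i ≡ 𝟙 i
    solves i = ≡.trans (≡.cong (y i ℚ.+_) (≡.trans (ι-⊗ P (y ⊗ x) i) (≡.cong (P ℚ.*_) (≡.trans (⊗-sum y x i)
      (ℚΣ.sum-cong-≗ (λ j → ℚ.*-comm (y j) (x (sub i j)))))))) (proj₂ (proj₂ solution) i)

  ζ^-≡ : ∀ {a} {i : Fin p} → toℕ i ≡ a %ℕ p → ζ^ a i ≡ 1ℚ
  ζ^-≡ {a} {i} e with toℕ i ℕ.≟ (a %ℕ p)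
  ... | yes _ = ≡.refl
  ... | no ne = contradiction e ne

  ζ^-≢ : ∀ {a} {i : Fin p} → ¬ (toℕ i ≡ a %ℕ p) → ζ^ a i ≡ 0ℚ
  ζ^-≢ {a} {i} ne with toℕ i ℕ.≟ (a %ℕ p)
  ... | yes e = contradiction e ne
  ... | no _  = ≡.refl

  ζ^-transport : ∀ {a b} {i j : Fin p} → (toℕ i ≡ a %ℕ p → toℕ j ≡ b %ℕ p) → (toℕ j ≡ b %ℕ p → toℕ i ≡ a %ℕ p) →
                 ζ^ a i ≡ ζ^ b j
  ζ^-transport {a} {b} {i} {j} f g with toℕ j ℕ.≟ (b %ℕ p)
  ... | yes e = ζ^-≡ {a} (g e)
  ... | no ne = ζ^-≢ {a} (λ e → ne (f e))

  ζ^-integral : ∀ a (i : Fin p) → Integral (ζ^ a i)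
  ζ^-integral a i with toℕ i ℕ.≟ (a %ℕ p)
  ... | yes _ = integral-1
  ... | no _  = integral-0

  ζ^0 : ∀ (i : Fin p) → ζ^ (+ 0) i ≡ 𝟙 i
  ζ^0 Fin.zero    = ≡.refl
  ζ^0 (Fin.suc _) = ≡.refl

  one : Fin p
  one = Fin.suc Fin.zero

  -- ζ is the indicator of index 1, so one summand of the convolution survives and multiplication by
  -- ζ is the cyclic shift.
  ζ-⊗ : ∀ (x : Cyc p) i → (ζ^ (+ 1) ⊗ x) i ≡ x (sub i one)
  ζ-⊗ x i = begin
    (ζ^ (+ 1) ⊗ x) i
      ≡⟨ ⊗-sum (ζ^ (+ 1)) x i ⟩
    ζ^ {p} (+ 1) Fin.zero ℚ.* t Fin.zero ℚ.+ (ζ^ {p} (+ 1) one ℚ.* t one ℚ.+ ℚΣ.sum (λ j → ζ^ {p} (+ 1) (Fin.suc (Fin.suc j)) ℚ.* t (Fin.suc (Fin.suc j))))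
      ≡⟨ ≡.cong₂ ℚ._+_ (≡.cong (ℚ._* t Fin.zero) (ζ^-≢ {+ 1} {Fin.zero} (λ e → 0≢1 (≡.trans e 1%p))))
           (≡.cong₂ ℚ._+_ (≡.cong (ℚ._* t one) (ζ^-≡ {+ 1} {one} (≡.sym 1%p)))
             (≡.trans (ℚΣ.sum-cong-≗ (λ j → ≡.cong (ℚ._* t (Fin.suc (Fin.suc j)))
                 (ζ^-≢ {+ 1} {Fin.suc (Fin.suc j)} (λ e → 2+≢1 (≡.trans e 1%p)))))
               (≡.sym (ℚΣ.*-distribˡ-sum 0ℚ (λ j → t (Fin.suc (Fin.suc j))))))) ⟩
    0ℚ ℚ.* t Fin.zero ℚ.+ (1ℚ ℚ.* t one ℚ.+ 0ℚ ℚ.* ℚΣ.sum (λ j → t (Fin.suc (Fin.suc j))))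
      ≡⟨ ℚ-Solver.solve 3 (λ a b c → con 0ℚ :* a :+ (con 1ℚ :* b :+ con 0ℚ :* c) := b) ≡.refl
           (t Fin.zero) (t one) (ℚΣ.sum (λ j → t (Fin.suc (Fin.suc j)))) ⟩
    t one ∎
    where
    open ≡.≡-Reasoning
    open ℚ-Solver
    t : Fin p → ℚ
    t j = x (sub i j)
    1%p : 1 % p ≡ 1
    1%p = m<n⇒m%n≡m {p} {1} (s≤s (s≤s z≤n))
    0≢1 : ¬ (0 ≡ 1)
    0≢1 ()
    2+≢1 : ∀ {n} → ¬ (suc (suc n) ≡ 1)
    2+≢1 ()

  ζ-suc : ∀ n i → (ζ^ (+ 1) ⊗ ζ^ (+ n)) i ≡ ζ^ (+ suc n) i
  ζ-suc n i = ≡.trans (ζ-⊗ (ζ^ (+ n)) i) (ζ^-transport {+ n} {+ suc n} {sub i one} {i}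
    (λ e → ≡.trans (≡.sym (i%p i)) (residues (~-trans (~-sym (sub-+ i one))
      (~-trans (~-+ 1 (congruent {toℕ (sub i one)} {n} (≡.trans (i%p (sub i one)) e))) (≡⇒~ (ℕ.+-comm n 1))))))
    (λ e → ≡.trans (≡.cong toℕ (≡.sym (sub-unique i one (idx n)
        (~-trans (~-+ 1 (toℕ-idx-~ n)) (~-trans (≡⇒~ (ℕ.+-comm n 1)) (congruent (≡.trans (≡.sym e) (≡.sym (i%p i)))))))))
      (toℕ-idx n)))
    where
    i%p : ∀ (i : Fin p) → toℕ i % p ≡ toℕ i
    i%p i = m<n⇒m%n≡m (Fin.toℕ<n i)

  ζ : Element
  ζ = element (ζ^ (+ 1)) (ζ^-integral (+ 1))

  ζ-power : ∀ n → ζ^ (+ n) ⊳ ζ R.^ n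
  ζ-power zero    = represents (≗⇒≋ ζ^0)
  ζ-power (suc n) = represents (≋-sym (≋-trans (⊗-congˡ (ζ^ (+ 1)) (≋-sym (represented (ζ-power n)))) (≗⇒≋ (ζ-suc n))))

  ζ^p≈1 : ζ R.^ p ≈ 1#
  ζ^p≈1 = ≋⇒≈ (≋-trans (≋-sym (represented (ζ-power p))) (≗⇒≋ λ i → ≡.trans (ζ^-transport {+ p} {+ 0} {i} {i}
    (λ e → ≡.trans e (n%n≡0 p)) (λ e → ≡.trans e (≡.sym (n%n≡0 p)))) (ζ^0 i)))

  ƛ : Element
  ƛ = 1# R.+ R.- ζ

  1-ƛ : 1# R.+ R.- ƛ ≈ ζ
  1-ƛ = R.trans (R.+-congˡ (R.sym (-‿+-comm 1# (R.- ζ)))) (R.trans (R.sym (R.+-assoc 1# (R.- 1#) (R.- R.- ζ)))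
    (R.trans (R.+-cong (R.-‿inverseʳ 1#) (-‿involutive ζ)) (R.+-identityˡ ζ)))
    where open RingProperties R.ring using (-‿+-comm; -‿involutive)

  -- If (1 - ζ) z is a constant vector, the coefficients of z form an arithmetic progression of period p.
  ƛ-regular : ∀ z → ƛ R.* z ≈ 0# → z ≈ 0#
  ƛ-regular zᴱ (≋⇒≈ (shift c e)) = ≋⇒≈ (shift (z (idx 0)) λ i → begin
    z i                                              ≡⟨ ≡.cong z (idx-toℕ i) ⟨
    z (idx (toℕ i))                                  ≡⟨ progression (toℕ i) ⟩
    z (idx 0) ℚ.+ fromℕℚ (toℕ i) ℚ.* c               ≡⟨ ≡.cong (λ c → z (idx 0) ℚ.+ fromℕℚ (toℕ i) ℚ.* c) c≡0 ⟩
    z (idx 0) ℚ.+ fromℕℚ (toℕ i) ℚ.* 0ℚ              ≡⟨ solve 2 (λ a b → a :+ b :* con 0ℚ := con 0ℚ :+ a) ≡.refl (z (idx 0)) (fromℕℚ (toℕ i)) ⟩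
    0ℚ ℚ.+ z (idx 0)                                 ≡⟨ ≡.cong (ℚ._+ z (idx 0)) (zeros i) ⟨
    ι 0ℚ i ℚ.+ z (idx 0)                             ∎)
    where
    open ≡.≡-Reasoning
    open ℚ-Solver
    z = coefficients zᴱ
    zeros : ∀ (i : Fin p) → ι 0ℚ i ≡ 0ℚ
    zeros Fin.zero    = ≡.refl
    zeros (Fin.suc _) = ≡.refl
    difference : ∀ i → z i ≡ z (sub i one) ℚ.+ c
    difference i = begin
      z i
        ≡⟨ solve 2 (λ a b → a := b :+ (a :+ :- b)) ≡.refl (z i) (z (sub i one)) ⟩
      z (sub i one) ℚ.+ (z i ℚ.+ ℚ.- z (sub i one))
        ≡⟨ ≡.cong (z (sub i one) ℚ.+_) (begin
             z i ℚ.+ ℚ.- z (sub i one)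
               ≡⟨ ≡.cong₂ (λ a b → a ℚ.+ ℚ.- b) (≡.trans (ι-⊗ 1ℚ z i) (ℚ.*-identityˡ (z i))) (ζ-⊗ z i) ⟨
             (𝟙 ⊗ z) i ℚ.+ ℚ.- (ζ^ (+ 1) ⊗ z) i
               ≡⟨ ≡.cong ((𝟙 ⊗ z) i ℚ.+_) (negated i) ⟨
             (𝟙 ⊗ z) i ℚ.+ ((⊖ ζ^ (+ 1)) ⊗ z) i
               ≡⟨ ⊗-distribʳ z 𝟙 (⊖ ζ^ (+ 1)) i ⟨
             ((𝟙 ⊕ ⊖ ζ^ (+ 1)) ⊗ z) i
               ≡⟨ e i ⟩
             ι 0ℚ i ℚ.+ c
               ≡⟨ ≡.trans (≡.cong (ℚ._+ c) (zeros i)) (ℚ.+-identityˡ c) ⟩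
             c ∎) ⟩
      z (sub i one) ℚ.+ c ∎
      where
      negated : ∀ i → ((⊖ ζ^ (+ 1)) ⊗ z) i ≡ ℚ.- (ζ^ (+ 1) ⊗ z) i
      negated i = begin
        ((⊖ ζ^ (+ 1)) ⊗ z) i
          ≡⟨ solve 2 (λ a b → a := b :+ a :+ :- b) ≡.refl (((⊖ ζ^ (+ 1)) ⊗ z) i) ((ζ^ (+ 1) ⊗ z) i) ⟩
        (ζ^ (+ 1) ⊗ z) i ℚ.+ ((⊖ ζ^ (+ 1)) ⊗ z) i ℚ.+ ℚ.- (ζ^ (+ 1) ⊗ z) i
          ≡⟨ ≡.cong (ℚ._+ ℚ.- (ζ^ (+ 1) ⊗ z) i) (≡.trans (≡.sym (⊗-distribʳ z (ζ^ (+ 1)) (⊖ ζ^ (+ 1)) i))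
               (≡.trans (⊗-sum (ζ^ (+ 1) ⊕ ⊖ ζ^ (+ 1)) z i)
                 (≡.trans (ℚΣ.sum-cong-≗ (λ j → ≡.cong (ℚ._* z (sub i j)) (ℚ.+-inverseʳ (ζ^ (+ 1) j))))
                   (≡.trans (≡.sym (ℚΣ.*-distribˡ-sum 0ℚ (λ j → z (sub i j)))) (ℚ.*-zeroˡ (ℚΣ.sum (λ j → z (sub i j)))))))) ⟩
        0ℚ ℚ.+ ℚ.- (ζ^ (+ 1) ⊗ z) i
          ≡⟨ ℚ.+-identityˡ _ ⟩
        ℚ.- (ζ^ (+ 1) ⊗ z) i ∎
    sub-suc : ∀ n → sub (idx (suc n)) one ≡ idx n
    sub-suc n = ≡.sym (sub-unique (idx (suc n)) one (idx n)
      (~-trans (~-+ 1 (toℕ-idx-~ n)) (~-trans (≡⇒~ (ℕ.+-comm n 1)) (~-sym (toℕ-idx-~ (suc n))))))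
    progression : ∀ n → z (idx n) ≡ z (idx 0) ℚ.+ fromℕℚ n ℚ.* c
    progression zero    = solve 2 (λ a c → a := a :+ con 0ℚ :* c) ≡.refl (z (idx 0)) c
    progression (suc n) = begin
      z (idx (suc n))                                   ≡⟨ difference (idx (suc n)) ⟩
      z (sub (idx (suc n)) one) ℚ.+ c                   ≡⟨ ≡.cong (λ i → z i ℚ.+ c) (sub-suc n) ⟩
      z (idx n) ℚ.+ c                                   ≡⟨ ≡.cong (ℚ._+ c) (progression n) ⟩
      z (idx 0) ℚ.+ fromℕℚ n ℚ.* c ℚ.+ c                ≡⟨ solve 3 (λ a n c → a :+ n :* c :+ c := a :+ (con 1ℚ :+ n) :* c) ≡.refl (z (idx 0)) (fromℕℚ n) c ⟩
      z (idx 0) ℚ.+ (1ℚ ℚ.+ fromℕℚ n) ℚ.* c             ≡⟨ ≡.cong (λ m → z (idx 0) ℚ.+ m ℚ.* c) (fromℕℚ-suc n) ⟨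
      z (idx 0) ℚ.+ fromℕℚ (suc n) ℚ.* c                ∎
    pc≡0 : P ℚ.* c ≡ 0ℚ
    pc≡0 = begin
      P ℚ.* c
        ≡⟨ solve 2 (λ a x → x := (a :+ x) :+ :- a) ≡.refl (z (idx 0)) (P ℚ.* c) ⟩
      z (idx 0) ℚ.+ P ℚ.* c ℚ.+ ℚ.- z (idx 0)
        ≡⟨ ≡.cong (ℚ._+ ℚ.- z (idx 0)) (progression p) ⟨
      z (idx p) ℚ.+ ℚ.- z (idx 0)
        ≡⟨ ≡.cong (λ i → z i ℚ.+ ℚ.- z (idx 0)) (idx-cong {p} {0} (congruent (n%n≡0 p))) ⟩
      z (idx 0) ℚ.+ ℚ.- z (idx 0)
        ≡⟨ ℚ.+-inverseʳ (z (idx 0)) ⟩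
      0ℚ ∎
    c≡0 : c ≡ 0ℚ
    c≡0 = begin
      c                                ≡⟨ ℚ.*-identityˡ c ⟨
      1ℚ ℚ.* c                         ≡⟨ ≡.cong (ℚ._* c) (fromℕℚ-*-inverse (suc q)) ⟨
      P ℚ.* (+ 1 / p) ℚ.* c            ≡⟨ solve 3 (λ p i c → p :* i :* c := i :* (p :* c)) ≡.refl P (+ 1 / p) c ⟩
      (+ 1 / p) ℚ.* (P ℚ.* c)          ≡⟨ ≡.cong ((+ 1 / p) ℚ.*_) pc≡0 ⟩
      (+ 1 / p) ℚ.* 0ℚ                 ≡⟨ ℚ.*-zeroʳ (+ 1 / p) ⟩
      0ℚ                               ∎

  uniformizer : LocalCyclotomic.Uniformizer localization pr
  uniformizer = record
    { inv = inv ; inv-eq = inv-eq ; unit = unit ; ƛ = ƛ ; ƛ-regular = λ z → ƛ-regular z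
    ; [1-ƛ]^p = R.trans (R.^-congˡ p 1-ƛ) ζ^p≈1 }

-- Recursion and normalisation of the Bernoulli numbers

mutual
  -- The weighted sum in the recursion for bRev is private to Defs; bcoef-suc forces this metavariable
  -- to be that function, by abstracting over its two arguments.
  weighted : ℕ → List ℚ → ℚ
  weighted = _

  bcoef-suc : ∀ n → bcoef (suc n) ≡ ℚ.- (weighted 1 (bRev n))
  bcoef-suc n with bRev n | 1
  ... | xs | k = ≡.refl

fact*invFact : ∀ n → fromℕℚ (fact n) ℚ.* invFact n ≡ 1ℚ
fact*invFact zero    = ≡.refl
fact*invFact (suc n) = begin
  fromℕℚ (suc n ℕ.* fact n) ℚ.* (invFact n ℚ.* (+ 1 / suc n))
    ≡⟨ ≡.cong (ℚ._* (invFact n ℚ.* (+ 1 / suc n))) (≡.trans (≡.cong (_/ 1) (ℤ.pos-* (suc n) (fact n))) (≡.sym (/-* (+ suc n) 1 (+ fact n) 1))) ⟩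
  fromℕℚ (suc n) ℚ.* fromℕℚ (fact n) ℚ.* (invFact n ℚ.* (+ 1 / suc n))
    ≡⟨ solve 4 (λ a b c d → a :* b :* (c :* d) := a :* d :* (b :* c)) ≡.refl (fromℕℚ (suc n)) (fromℕℚ (fact n)) (invFact n) (+ 1 / suc n) ⟩
  fromℕℚ (suc n) ℚ.* (+ 1 / suc n) ℚ.* (fromℕℚ (fact n) ℚ.* invFact n)
    ≡⟨ ≡.cong₂ ℚ._*_ (fromℕℚ-*-inverse n) (fact*invFact n) ⟩
  1ℚ ℚ.* 1ℚ
    ≡⟨⟩
  1ℚ ∎
  where
  open ≡.≡-Reasoning
  open ℚ-Solver

-- Turns the B^(m)_j / j! of the theorem back into the coefficient of X^j in (X/(e^X - 1))^m.
Bᵐ/fact : ∀ m j → Bᵐ m j ℚ.* invFact j ≡ coefPow m j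
Bᵐ/fact m j = ≡.trans (solve 3 (λ a b c → a :* b :* c := b :* (a :* c)) ≡.refl (fromℕℚ (fact j)) (coefPow m j) (invFact j))
  (≡.trans (≡.cong (coefPow m j ℚ.*_) (fact*invFact j)) (ℚ.*-identityʳ (coefPow m j)))
  where open ℚ-Solver

-- Transfer of the congruences to the vectors of the theorem

module Translation {q : ℕ} (pr : Prime (suc (suc q))) where
  open Integrality pr
  open CyclicGroupAlgebra q
  open Localization pr
  open R using (⟦_⟧)
  open PowerSeries localization using (Series; tl; _⊛_; _^ˢ_; const; _≈[_]_; below; ev; ev-◂; ev-cong; ⊛-comm; const-⊛)
  open Congruence localization using () renaming (_≡_[_] to _≡ᴿ_[_])
  open LocalCyclotomic.Consequences localization pr uniformizer
    using (π; π^[p-1]; module Powers) renaming (ζ to ζ′)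
  open ExpLog.Inverses localization pr inv inv-eq using (invfact)

  integral-invFact : ∀ k → k ℕ.< p → Integral (invFact k)
  integral-invFact zero    _   = integral-1
  integral-invFact (suc k) k<p = integral-* (integral-invFact k (ℕ.<⇒≤ k<p)) (integral-1/suc k k<p)

  invfact-ι : ∀ k → k ℕ.< p → invfact k ≋ι invFact k
  invfact-ι zero    _   = scalar ≋-refl
  invfact-ι (suc k) k<p = ≋ι-* (invfact-ι k (ℕ.<⇒≤ k<p)) (embed-ι (integral-1/suc k k<p))

  private
    shift-bound : ∀ {k n} → suc (k ℕ.+ suc n) ℕ.< p → suc (suc k ℕ.+ n) ℕ.< p
    shift-bound {k} {n} = ≡.subst (λ j → suc j ℕ.< p) (ℕ.+-suc k n)

    index-bound : ∀ {k n} → suc (k ℕ.+ n) ℕ.< p → suc k ℕ.< p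
    index-bound {k} {n} = ℕ.≤-<-trans (s≤s (ℕ.m≤m+n k n))

  -- Up to degree n the recursion divides by nothing beyond (n + 1)!, and n + 1 < p. The same count
  -- in `integral-weighted`: its last weight is 1/(k + n + 1)!.
  integral-bcoef : ∀ n → n ℕ.< suc q → Integral (bcoef n)
  integral-weighted : ∀ k n → suc (k ℕ.+ n) ℕ.< p → Integral (weighted k (bRev n))
  integral-bcoef zero    _     = integral-1
  integral-bcoef (suc n) n<p-1 = ≡.subst Integral (≡.sym (bcoef-suc n)) (integral-neg (integral-weighted 1 n (s≤s n<p-1)))
  integral-weighted k zero    k<p = integral-+ (integral-* integral-1 (integral-invFact (suc k) (index-bound k<p))) integral-0
  integral-weighted k (suc n) k<p = integral-+
    (integral-* (integral-bcoef (suc n) (ℕ.≤-<-trans (ℕ.m≤n+m (suc n) k) (ℕ.≤-pred k<p)))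
      (integral-invFact (suc k) (index-bound k<p)))
    (integral-weighted (suc k) n (shift-bound {k} k<p))

  w : Series
  w j = embed (bcoef j)

  w-ι : ∀ j → j ℕ.< suc q → w j ≋ι bcoef j
  w-ι j j<p-1 = embed-ι (integral-bcoef j j<p-1)

  -- The weighted sum is a coefficient of the product of `w` with the series 1/(k+1)!, 1/(k+2)!,
  -- ...; k varies because each step of the recursion passes to the tail of that series.
  weighted-ι : ∀ k (g : Series) → (∀ i → suc (k ℕ.+ i) ℕ.< p → g i ≋ι invFact (suc (k ℕ.+ i))) →
               ∀ n → suc (k ℕ.+ n) ℕ.< p → (g ⊛ w) n ≋ι weighted k (bRev n)
  weighted-ι k g g-ι n k<p = go n k<p
    where
    head : g 0 ≋ι invFact (suc k)
    head = ≋ι-≡ (g-ι 0 (≡.subst (λ j → suc j ℕ.< p) (≡.sym (ℕ.+-identityʳ k)) (index-bound {k} {n} k<p)))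
      (≡.cong (λ j → invFact (suc j)) (ℕ.+-identityʳ k))
    go : ∀ n → suc (k ℕ.+ n) ℕ.< p → (g ⊛ w) n ≋ι weighted k (bRev n)
    go zero    k<p = ≋ι-≡ (≋ι-* head (w-ι 0 (s≤s z≤n)))
      (≡.trans (ℚ.*-comm (invFact (suc k)) 1ℚ) (≡.sym (ℚ.+-identityʳ _)))
    go (suc n) k<p = ≋ι-+
      (≋ι-≡ (≋ι-* head (w-ι (suc n) (ℕ.≤-<-trans (ℕ.m≤n+m (suc n) k) (ℕ.≤-pred k<p)))) (ℚ.*-comm (invFact (suc k)) (bcoef (suc n))))
      (weighted-ι (suc k) (tl g)
        (λ i i<p → ≋ι-≡ (g-ι (suc i) (≡.subst (λ j → suc j ℕ.< p) (≡.sym (ℕ.+-suc k i)) i<p)) (≡.cong (λ j → invFact (suc j)) (ℕ.+-suc k i)))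
        n (shift-bound {k} k<p))

  -- The recursion for `bcoef` says precisely this: in degree n + 1 the product is `bcoef (suc n)`
  -- plus its own negative.
  U⊛w : tl invfact ⊛ w ≈[ suc q ] const R.1#
  U⊛w = below λ where
    zero    _     → ≋ι-unique (≋ι-* (invfact-ι 1 (s≤s (s≤s z≤n))) (w-ι 0 (s≤s z≤n))) 1-ι
    (suc n) n<p-1 → ≋ι-unique (≋ι-≡ (≋ι-+ (≋ι-* (invfact-ι 1 (s≤s (s≤s z≤n))) (w-ι (suc n) n<p-1))
        (weighted-ι 1 (tl (tl invfact)) (λ i i<p → invfact-ι (suc (suc i)) i<p) n (s≤s n<p-1)))
      (≡.trans (≡.cong (ℚ._+ weighted 1 (bRev n)) (≡.trans (ℚ.*-identityˡ (bcoef (suc n))) (bcoef-suc n)))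
        (ℚ.+-inverseˡ (weighted 1 (bRev n))))) (⟦⟧-ι 0)

  ⊛-ι : ∀ (f g : Series) (a b : ℕ → ℚ) n → (∀ i → i ℕ.≤ n → f i ≋ι a i) → (∀ i → i ℕ.≤ n → g i ≋ι b i) →
        (f ⊛ g) n ≋ι sumℚ (applyUpTo (λ i → a i ℚ.* b (n ∸ i)) (suc n))
  ⊛-ι f g a b zero    e e′ = ≋ι-≡ (≋ι-* (e 0 z≤n) (e′ 0 z≤n)) (≡.sym (ℚ.+-identityʳ _))
  ⊛-ι f g a b (suc n) e e′ = ≋ι-+ (≋ι-* (e 0 z≤n) (e′ (suc n) ℕ.≤-refl))
    (⊛-ι (tl f) g (λ i → a (suc i)) b n (λ i i≤n → e (suc i) (s≤s i≤n)) (λ i i≤n → e′ i (ℕ.m≤n⇒m≤1+n i≤n)))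

  w^-ι : ∀ m j → j ℕ.< suc q → (w ^ˢ m) j ≋ι coefPow m j
  w^-ι zero    zero    _     = 1-ι
  w^-ι zero    (suc j) _     = scalar ≋-refl
  w^-ι (suc m) j       j<p-1 = ≋ι-≡
    (⊛-ι w (w ^ˢ m) bcoef (coefPow m) j
      (λ i i≤j → w-ι i (ℕ.≤-<-trans i≤j j<p-1)) (λ i i≤j → w^-ι m i (ℕ.≤-<-trans i≤j j<p-1)))
    (≡.cong sumℚ (≡.sym (map-upTo (λ i → bcoef i ℚ.* coefPow m (j ∸ i)) (suc j))))

  ⊳-≈ : ∀ {y x x′} → y ⊳ x → x ≈ᴱ x′ → y ⊳ x′
  ⊳-≈ (represents e) (≋⇒≈ e′) = represents (≋-trans e e′)

  ⊳-^ : ∀ {y x} n → y ⊳ x → y ^ n ⊳ x R.^ n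
  ⊳-^ zero    _ = represents ≋-refl
  ⊳-^ (suc n) e = represents (⊗-cong (represented e) (represented (⊳-^ n e)))

  ⊳-⊗ : ∀ {y y′ x x′} → y ⊳ x → y′ ⊳ x′ → y ⊗ y′ ⊳ x *ᴱ x′
  ⊳-⊗ (represents e) (represents e′) = represents (⊗-cong e e′)

  ⊳-⊕ : ∀ {y y′ x x′} → y ⊳ x → y′ ⊳ x′ → y ⊕ y′ ⊳ x +ᴱ x′
  ⊳-⊕ (represents e) (represents e′) = represents (⊕-cong e e′)

  ⊳-⊖ : ∀ {y x} → y ⊳ x → ⊖ y ⊳ -ᴱ x
  ⊳-⊖ (represents e) = represents (⊖-cong e)

  ⊳-ι : ∀ {x a} → x ≋ι a → ι a ⊳ x
  ⊳-ι (scalar e) = represents (≋-sym e)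

  ⊳-· : ∀ {x y a z} → x ≋ι a → z ⊳ y → a · z ⊳ x *ᴱ y
  ⊳-· {a = a} {z} (scalar e) (represents e′) = represents (≋-trans (≋-sym (≗⇒≋ (ι-⊗ a z))) (⊗-cong (≋-sym e) e′))

  -- Relates the explicit sums of the theorem to Horner evaluation. The offset n covers exponents
  -- that do not start at 0: it is 1 for ϖ, n in the first congruence of (ii) and N + 2 in the
  -- second.
  ⊳-Σ⊕ : ∀ d n (F : ℕ → Cyc p) (f : Series) x → (∀ j → j ℕ.< d → F j ⊳ f j R.* x R.^ (n ℕ.+ j)) →
         Σ⊕ (map F (upTo d)) ⊳ x R.^ n R.* ev d f x
  ⊳-Σ⊕ d n F f x e = ≡.subst (λ l → Σ⊕ l ⊳ x R.^ n R.* ev d f x) (≡.sym (map-upTo F d)) (go d n F f e)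
    where
    open SemiringSolver R.commutativeSemiring using (solve; _:=_; _:+_; _:*_)
    go : ∀ d n (F : ℕ → Cyc p) (f : Series) → (∀ j → j ℕ.< d → F j ⊳ f j R.* x R.^ (n ℕ.+ j)) →
         Σ⊕ (applyUpTo F d) ⊳ x R.^ n R.* ev d f x
    go zero    n F f e = ⊳-≈ (⊳-ι (⟦⟧-ι 0)) (R.sym (R.zeroʳ (x R.^ n)))
    go (suc d) n F f e = ⊳-≈ (⊳-⊕
        (≡.subst (λ k → F 0 ⊳ f 0 R.* x R.^ k) (ℕ.+-identityʳ n) (e 0 (s≤s z≤n)))
        (go d (suc n) (λ j → F (suc j)) (tl f)
          (λ j j<d → ≡.subst (λ k → F (suc j) ⊳ f (suc j) R.* x R.^ k) (ℕ.+-suc n j) (e (suc j) (s≤s j<d)))))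
      (solve 4 (λ c m x v → c :* m :+ x :* m :* v := m :* (c :+ x :* v)) R.refl (f 0) (x R.^ n) x (ev d (tl f) x))

  -- π has the signs inside, as coefficients -1/k of log(1 - X), and ϖ has one sign in front. As log
  -- has no constant term, a factor `ƛ` comes out, leaving a sum of p - 1 terms with offset 1.
  ϖ⊳π : ϖ ⊳ π
  ϖ⊳π = ⊳-≈ (⊳-⊖ (⊳-Σ⊕ (suc q) 1 _ inv ƛ (λ j j<p-1 →
      ⊳-· (embed-ι (integral-1/suc j (s≤s j<p-1))) (⊳-^ {x = ƛ} (suc j) (represents ≋-refl)))))
    (R.sym (R.trans (R.+-identityˡ _)
      (R.trans (R.*-congˡ (R.trans (ev-cong (suc q) ƛ (below λ j _ → R.sym (-1*x≈-x (inv j))))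
          (R.trans (ev-◂ (suc q) (R.- R.1#) inv ƛ) (-1*x≈-x _))))
        (R.trans (R.sym (-‿distribʳ-* ƛ _)) (R.-‿cong (R.*-congʳ (R.sym (R.*-identityʳ ƛ))))))))
    where open RingProperties R.ring using (-1*x≈-x; -‿distribʳ-*)

  ⊳-fromℕℚ-^ : ∀ n → ι (fromℕℚ (p ℕ.^ n)) ⊳ ⟦ p ⟧ R.^ n
  ⊳-fromℕℚ-^ n = ⊳-≈ (⊳-ι (⟦⟧-ι (p ℕ.^ n))) (Naturals.⟦⟧-^ localization p n)

  -- Equality in the ring holds up to a constant vector, and `IsZero` asks just for this, the
  -- constant being compared with its value at index 0.
  ⊳-≡ : ∀ {x y γ α β g} → α ⊳ x → β ⊳ y → g ⊳ γ → x ≡ᴿ y [ γ ] → α ≡ β [mod g ]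
  ⊳-≡ {α = α} {β} {g} (represents ex) (represents ey) (represents eg) (δ , ≋⇒≈ e) =
    d , (λ i → p∤denominator (integrality δ i)) , λ i → ≡.trans (constant i) (≡.sym (constant (idx 0)))
    where
    d = coefficients δ
    difference : α ≋ β ⊕ (g ⊗ d)
    difference = ≋-trans ex (≋-trans e (⊕-cong (≋-sym ey) (⊗-cong (≋-sym eg) (≋-refl {d}))))
    constant : ∀ i → ((α ⊝ β) ⊝ (g ⊗ d)) i ≡ offset difference
    constant i = ≡.trans (≡.cong (λ a → a ℚ.+ ℚ.- β i ℚ.+ ℚ.- (g ⊗ d) i) (shifts difference i))
      (ℚ-Solver.solve 3 (λ b d c → b :+ d :+ c :+ :- b :+ :- d := c) ≡.refl (β i) ((g ⊗ d) i) (offset difference))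
      where open ℚ-Solver

  part-i : ϖ ^ suc q ≡ ι (ℚ.- fromℕℚ p) [mod ι (fromℕℚ (p ℕ.^ 2)) ]
  part-i = ⊳-≡ (⊳-^ (suc q) ϖ⊳π)
    (represents (≋-trans (≗⇒≋ (ι-neg (fromℕℚ p))) (represented (⊳-⊖ (⊳-ι (⟦⟧-ι p))))))
    (⊳-≈ (⊳-fromℕℚ-^ 2) (R.*-congˡ (R.*-identityʳ ⟦ p ⟧)))
    π^[p-1]

  module _ (a : ℤ) where
    α : Element
    α = embed (fromℤℚ a)

    k : ℕ
    k = a %ℕ p

    α-ι : α ≋ι fromℤℚ a
    α-ι = embed-ι (integral-/1 a)

    α≡k : α ≡ᴿ ⟦ k ⟧ [ ⟦ p ⟧ ]
    α≡k = embed (fromℤℚ t) , ≋ι-unique (≋ι-≡ α-ι a/1) (≋ι-+ (⟦⟧-ι k) (≋ι-* (⟦⟧-ι p) (embed-ι (integral-/1 t))))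
      where
      t = a ℤ./ℕ p
      a/1 : fromℤℚ a ≡ fromℕℚ k ℚ.+ fromℕℚ p ℚ.* fromℤℚ t
      a/1 = ≡.trans (≡.cong (_/ 1) (≡.trans (ℤ.a≡a%ℕn+[a/ℕn]*n a p) (≡.cong (λ z → + k ℤ.+ z) (ℤ.*-comm t (+ p)))))
        (≡.trans (/1-homo-+ (+ k) (+ p ℤ.* t)) (≡.cong (fromℕℚ k ℚ.+_) (≡.sym (/-* (+ p) 1 t 1))))

    open Powers {α} {k} α≡k using (x; module Reciprocal)
    open Reciprocal w U⊛w using (T; power-congruence; p-power-congruence)

    ζ^a-1 : ζ^ a ⊝ 𝟙 ⊳ ζ′ R.^ k R.+ R.- R.1#
    ζ^a-1 = ⊳-⊕ (⊳-≈ (represents (≋-trans (≗⇒≋ λ i → ζ^-transport {a} {+ k} {i} {i}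
        (λ e → ≡.trans e (≡.sym k%p)) (λ e → ≡.trans e k%p)) (represented (ζ-power k))))
      (R.sym (R.^-congˡ k 1-ƛ))) (represents ≋-refl)
      where
      k%p : k % p ≡ k
      k%p = m<n⇒m%n≡m (ℤ.n%ℕd<d a p)

    aϖ⊳x : fromℤℚ a · ϖ ⊳ x
    aϖ⊳x = ⊳-· α-ι ϖ⊳π

    part-ii : ∀ n m → p ℕ∣.∣ m ℕ.+ n →
      ((ζ^ a ⊝ 𝟙) ^ n)
        ≡ Σ⊕ (map (λ j → (Bᵐ m j ℚ.* invFact j) · ((fromℤℚ a · ϖ) ^ (n ℕ.+ j))) (upTo (suc q)))
        [mod ι (fromℕℚ p) ⊗ (ϖ ^ n) ]
    part-ii n m p∣m+n = ⊳-≡ (⊳-^ n ζ^a-1)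
      (⊳-Σ⊕ (suc q) n _ (w ^ˢ m) x (λ j j<p-1 →
        ⊳-· (≋ι-≡ (w^-ι m j j<p-1) (≡.sym (Bᵐ/fact m j))) (⊳-^ (n ℕ.+ j) aϖ⊳x)))
      (⊳-⊗ (⊳-ι (⟦⟧-ι p)) (⊳-^ n ϖ⊳π))
      (power-congruence n m p∣m+n)

    part-ii-p-power : ∀ b n → let N = p ℕ.^ suc b ℕ.* n in
      ((ζ^ a ⊝ 𝟙) ^ N)
        ≡ ((fromℤℚ a · ϖ) ^ N)
          ⊕ (fromℕℚ N · Σ⊕ (map (λ i → (Bern (2 ℕ.+ i) ℚ.* invFact (2 ℕ.+ i) ℚ.* (+ 1 / (2 ℕ.+ i)))
                                  · ((fromℤℚ a · ϖ) ^ (N ℕ.+ (2 ℕ.+ i)))) (upTo (q ∸ 1))))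
        [mod ι (fromℕℚ (p ℕ.^ suc (suc b))) ⊗ (ϖ ^ N) ]
    part-ii-p-power b n = ⊳-≡ (⊳-^ N ζ^a-1)
      (⊳-⊕ (⊳-^ N aϖ⊳x) (⊳-· (⟦⟧-ι N)
        -- The factor x² of M is absorbed into the exponent N + 2.
        (⊳-≈ (⊳-Σ⊕ (q ∸ 1) (N ℕ.+ 2) _ (λ i → w (suc (suc i)) R.* inv (suc i)) x term)
          (R.trans (R.*-congʳ (R.trans (R.^-homo-* x N 2) (R.*-congˡ (R.*-congˡ (R.*-identityʳ x)))))
            (R.*-assoc (x R.^ N) (x R.* x) T)))))
      (⊳-⊗ (⊳-fromℕℚ-^ (suc (suc b))) (⊳-^ N ϖ⊳π))
      (p-power-congruence b n)
      where
      N = p ℕ.^ suc b ℕ.* n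
      term : ∀ i → i ℕ.< q ∸ 1 →
        (Bern (2 ℕ.+ i) ℚ.* invFact (2 ℕ.+ i) ℚ.* (+ 1 / (2 ℕ.+ i))) · ((fromℤℚ a · ϖ) ^ (N ℕ.+ (2 ℕ.+ i)))
          ⊳ w (suc (suc i)) R.* inv (suc i) R.* x R.^ ((N ℕ.+ 2) ℕ.+ i)
      term i i<q-1 = ≡.subst
        (λ e → (Bern (2 ℕ.+ i) ℚ.* invFact (2 ℕ.+ i) ℚ.* (+ 1 / (2 ℕ.+ i))) · ((fromℤℚ a · ϖ) ^ e)
          ⊳ w (suc (suc i)) R.* inv (suc i) R.* x R.^ (N ℕ.+ 2 ℕ.+ i))
        (ℕ.+-assoc N 2 i)
        (⊳-· (≋ι-* coefficient (embed-ι (integral-1/suc (suc i) (s≤s (ℕ.<⇒≤ 2+i<p-1))))) (⊳-^ (N ℕ.+ 2 ℕ.+ i) aϖ⊳x))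
        where
        2+i<p-1 : suc (suc i) ℕ.< suc q
        2+i<p-1 = s≤s (bound q i<q-1)
          where
          bound : ∀ q → i ℕ.< q ∸ 1 → suc i ℕ.< q
          bound (suc q) i<q = s≤s i<q
        coefficient : w (suc (suc i)) ≋ι Bern (2 ℕ.+ i) ℚ.* invFact (2 ℕ.+ i)
        -- `Bern` comes from the first convolution power, so `w` is first replaced by w·1.
        coefficient = ≋ι-≡ (scalar (≋-trans
            (≈⇒≋ (R.sym (R.trans (⊛-comm w (const R.1#) (suc (suc i))) (R.trans (const-⊛ R.1# w (suc (suc i))) (R.*-identityˡ _)))))
            (scalar-≋ (w^-ι 1 (suc (suc i)) 2+i<p-1))))
          (≡.sym (Bᵐ/fact 1 (suc (suc i))))

open import Data.Nat.Base using (_+_)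
open import Data.Nat.Divisibility using (_∣_)
open import Data.Product using (_×_)

theorem2p1 : (p : ℕ) .{{_ : NonZero p}} → Prime p →
    (ϖ ^ (p ∸ 1) ≡ ι (ℚ.- fromℕℚ p) [mod ι (fromℕℚ (p ℕ.^ 2)) ])
    × ((a : ℤ) (n : ℕ) →
    ((m : ℕ) → p ∣ m + n →
    ((ζ^ a ⊝ 𝟙) ^ n)
    ≡ Σ⊕ (map (λ j → (Bᵐ m j ℚ.* invFact j) · ((fromℤℚ a · ϖ) ^ (n + j))) (upTo (p ∸ 1)))
    [mod ι (fromℕℚ p) ⊗ (ϖ ^ n) ])
    × ((b : ℕ) → 1 ℕ.≤ b →
    ((ζ^ a ⊝ 𝟙) ^ (p ℕ.^ b ℕ.* n))
    ≡ ((fromℤℚ a · ϖ) ^ (p ℕ.^ b ℕ.* n))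
    ⊕ (fromℕℚ (p ℕ.^ b ℕ.* n)
    · Σ⊕ (map (λ i → (Bern (2 + i) ℚ.* invFact (2 + i) ℚ.* (+ 1 / (2 + i)))
    · ((fromℤℚ a · ϖ) ^ (p ℕ.^ b ℕ.* n + (2 + i))))
    (upTo (p ∸ 3))))
    [mod ι (fromℕℚ (p ℕ.^ suc b)) ⊗ (ϖ ^ (p ℕ.^ b ℕ.* n)) ]))
theorem2p1 zero          pr = contradiction pr ¬prime[0]
theorem2p1 (suc zero)    pr = contradiction pr ¬prime[1]
theorem2p1 (suc (suc q)) pr = part-i , λ a n →
    (λ m → part-ii a n m) , λ { (suc b) _ → part-ii-p-power a b n }
  where open Translation pr
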